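{- Let $a_1,\dots,a_r$ be integers with $a_i\ge 2$ for $i=1,\dots,r$, and let $m=\sum_{i=1}^r(a_i-1)+1$. Let $k$ be an integer such that $m-k>\max\{a_1,\dots,a_r\}$. Then: if $-1\le k\le 5$, $F_v(a_1,\dots,a_r;m-k)\ge m+2k+2$; if $k=6$, $F_v(a_1,\dots,a_r;m-6)\ge m+13$; if $k=7$, $F_v(a_1,\dots,a_r;m-7)\ge m+15$; if $k=8$, $F_v(a_1,\dots,a_r;m-8)\ge m+16$; if $k=9$, $F_v(a_1,\dots,a_r;m-9)\ge m+17$; if $k=10$, $F_v(a_1,\dots,a_r;m-10)\ge m+19$; if $k=11$, $F_v(a_1,\dots,a_r;m-11)\ge m+20$, and moreover $F_v(a_1,\dots,a_r;m-11)\ge m+21$ if $R(10,3)\le 41$; if $k\ge 12$, $F_v(a_1,\dots,a_r;m-k)\ge m+k+10$.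
   Context: All graphs are finite, simple and undirected; $\omega(G)$ is the clique number and $\alpha(G)$ the independence number. For positive integers $a_1,\dots,a_r$, $G\overset{v}{\to}(a_1,\dots,a_r)$ means that for every partition $V(G)=V_1\cup\dots\cup V_r$ into pairwise disjoint (possibly empty) sets there is some $i$ such that $V_i$ contains an $a_i$-clique. $F_v(a_1,\dots,a_r;q)$ is the minimum of $|V(G)|$ over all graphs $G$ with $G\overset{v}{\to}(a_1,\dots,a_r)$ and $\omega(G)<q$ (it exists iff $q>\max\{a_1,\dots,a_r\}$). $R(10,3)$ is the smallest $n$ such that every graph on at least $n$ vertices has $\omega(G)\ge 10$ or $\alpha(G)\ge 3$. -}

module Defs where

open import Data.Nat using (ℕ; _∸_; _⊔_; _+_; _≤_)
open import Data.Fin using (Fin)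
open import Data.Vec using (Vec; lookup; foldr′; map; sum)
open import Data.Bool using (Bool; true; false)
open import Data.Product using (Σ; ∃; _×_)
open import Data.Sum using (_⊎_)
open import Data.Unit using (⊤)
open import Relation.Binary.PropositionalEquality using (_≡_; _≢_)
open import Relation.Nullary using (¬_)
open import Function.Definitions using (Injective)

record Graph (n : ℕ) : Set where
  field
    adj   : Fin n → Fin n → Bool
    sym   : ∀ u v → adj u v ≡ adj v u
    irrefl : ∀ v → adj v v ≡ false
open Graph public

CliqueIn : {n : ℕ} → Graph n → ℕ → (Fin n → Set) → Set
CliqueIn {n} G s P =
  Σ (Fin s → Fin n) λ f →
    Injective _≡_ _≡_ f
    × (∀ i j → i ≢ j → adj G (f i) (f j) ≡ true)
    × (∀ i → P (f i))

HasClique : {n : ℕ} → Graph n → ℕ → Set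
HasClique G s = CliqueIn G s (λ _ → ⊤)

HasIndep : {n : ℕ} → Graph n → ℕ → Set
HasIndep {n} G s =
  Σ (Fin s → Fin n) λ f →
    Injective _≡_ _≡_ f
    × (∀ i j → i ≢ j → adj G (f i) (f j) ≡ false)

CliqueNumberLt : {n : ℕ} → Graph n → ℕ → Set
CliqueNumberLt G q = ¬ HasClique G q

VertexArrows : {n r : ℕ} → Graph n → Vec ℕ r → Set
VertexArrows {n} {r} G a =
  ∀ (c : Fin n → Fin r) → ∃ λ (i : Fin r) → CliqueIn G (lookup a i) (λ v → c v ≡ i)

mOf : {r : ℕ} → Vec ℕ r → ℕ
mOf a = sum (map (λ x → x ∸ 1) a) + 1

maxOf : {r : ℕ} → Vec ℕ r → ℕ
maxOf a = foldr′ _⊔_ 0 a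

RamseyLe : ℕ → ℕ → ℕ → Set
RamseyLe s t N = ∀ (n : ℕ) → N ≤ n → (G : Graph n) → HasClique G s ⊎ HasIndep G t

{-# OPTIONS --safe --termination-depth=2 #-}
-- Colour G greedily with independent triples. If no independent triple is left, the complement H of
-- what remains is triangle-free, and colours are saved exactly by the edges of a matching of H. By
-- Gallai's lemma it suffices to treat factor-critical H, which have 2ν + 1 vertices and a matching of
-- size ν; a clique of the required size is then an independent set of H, and its existence is a bound
-- R(3, k) ≤ 2ν + 1. So everything rests on R(3,7) ≤ 23, R(3,8) ≤ 29, R(3,9) ≤ 37 and R(3,10) ≤ 43.
--
-- These follow Radziszowski and Kreher. Let e(k, n) be the least number of edges of a triangle-free
-- graph on n vertices with independence number at most k, and let far(v) be the graph of the vertices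
-- different from and not adjacent to v. Summing e(G) = Σ_{u ~ v} deg u + e(far(v)) over v gives
-- n e(G) = Σ (deg(v)² + e(far(v))), a linear program that bounds e(k, n) by e(k - 1, ·). Where it is
-- too weak, it still yields a v such that far(v) has few edges, hence is one of a few explicit graphs
-- K. The neighbours of v then have neighbourhoods S in K such that every independent set T of K is
-- missed by at most k - |T| of them. These are enumerated; a weighting of the largest sets T, found
-- by linear programming, excludes nearly all S at once.
module Submission where

-- If a colouring of G by independent sets has n - t classes, arrowing forces m ≤ n - t, so the
-- question is how large t must be. The colouring comes with a clique Q such that its number of
-- classes is at most |Q| + g t, where g is a fixed function; as |Q| < q and m = q + k, this yields
-- g t ≥ k + 1, and the constants of the theorem are the least such t. The function g is dictated by
-- one factor-critical piece: 2ν + 1 vertices take ν + 1 colours, and g ν is the allowed deficit of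
-- the clique, so ν + 1 - g ν independent vertices of H have to be guaranteed. The pieces fit
-- together because g is superadditive. While the Ramsey bounds grow by about 4 per step, g has
-- slope 1/2, whence 2k + 2; their irregular growth accounts for k = 6 to 11; from ν = 21 on,
-- R(3,10) ≤ 43 gives g ν = ν - 9, whence k + 10. The obstacle is that the Ramsey bounds have to be
-- established by evaluation. Therefore each computation is a Boolean test on small encodings with a
-- separate soundness proof, and whatever is costly to find (dual solutions, lists of graphs) is
-- supplied as data and only checked.

module Development where

  open import Defs using (Graph; adj; RamseyLe; VertexArrows; CliqueIn; HasClique; CliqueNumberLt; mOf)
  import Data.Bool as Bool
  open import Data.Bool using (Bool; true; false; not; _∧_; _∨_; if_then_else_; T)
  open import Data.Bool.ListAction using (all; any)
  import Data.Bool.Properties as Boolₚ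
  open import Data.Empty using (⊥; ⊥-elim)
  open import Data.Fin using (Fin; toℕ; fromℕ<; inject≤)
  import Data.Fin.Properties as Finₚ
  open import Data.List using (List; []; _∷_; _++_; [_]; allFin; concat; concatMap; downFrom; filter; filterᵇ; foldr; length; lookup; map; tabulate; take; upTo; zipWith)
  open import Data.List.Properties using (++-assoc; length-++; length-map; length-tabulate; length-take; map-++; map-∘)
  open import Data.List.Membership.Propositional using (_∈_; _∉_; find; lose)
  open import Data.List.Membership.Propositional.Properties
    using (∈-++⁺ˡ; ∈-++⁺ʳ; ∈-++⁻; ∈-allFin; ∈-filter⁺; ∈-filter⁻; ∈-lookup; ∈-map⁺; ∈-map⁻; ∈-tabulate⁻; ∈-upTo⁺)
  open import Data.List.Relation.Binary.Permutation.Propositional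
    using (_↭_; refl; prep; swap; ↭-sym; ↭-trans) renaming (trans to trans↭)
  open import Data.List.Relation.Binary.Permutation.Propositional.Properties
    using (∈-resp-↭; All-resp-↭; ↭-length; ↭-map-inv; shift; ++⁺ˡ; ++⁺ʳ; map⁺)
  open import Data.List.Relation.Binary.Subset.Propositional using (_⊆_)
  open import Data.List.Relation.Unary.All as All using (All; []; _∷_)
  import Data.List.Relation.Unary.All.Properties as Allₚ
  open import Data.List.Relation.Unary.AllPairs as AllPairs using (AllPairs; []; _∷_)
  import Data.List.Relation.Unary.AllPairs.Properties as AllPairsₚ
  open import Data.List.Relation.Unary.Any as Any using (Any; any?; here; there)
  open import Data.List.Relation.Unary.Unique.Propositional.Properties using (allFin⁺)
  open import Data.Maybe as Maybe using (Maybe; just; nothing; _<∣>_)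
  open import Data.Nat
  open import Data.Nat.DivMod using (m*n%n≡0)
  open import Data.Nat.Properties
  open import Data.Nat.Tactic.RingSolver using (solve-∀)
  open import Data.Product using (∃; _×_; _,_; proj₁; proj₂)
  open import Data.Sum using (_⊎_; inj₁; inj₂)
  open import Data.Vec as Vec using (Vec)
  open import Function using (_∘_; id)
  open import Relation.Binary.PropositionalEquality
    using (_≡_; _≢_; refl; sym; trans; cong; cong₂; subst; subst₂; module ≡-Reasoning)
  open import Relation.Nullary using (¬_; Dec; yes; no; does)
  open import Relation.Nullary.Decidable using (¬?; _×-dec_)

  private variable
    A B : Set

  -- Sums and edge counts

  AllPairs-resp-↭ : {R : A → A → Set} → (∀ {x y} → R x y → R y x) →
                    ∀ {xs ys} → xs ↭ ys → AllPairs R xs → AllPairs R ys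
  AllPairs-resp-↭ s refl          r                        = r
  AllPairs-resp-↭ s (prep x p)    (rx ∷ r)                 = All-resp-↭ p rx ∷ AllPairs-resp-↭ s p r
  AllPairs-resp-↭ s (swap x y p)  ((rxy ∷ rx) ∷ (ry ∷ r))  =
    (s rxy ∷ All-resp-↭ p ry) ∷ (All-resp-↭ p rx ∷ AllPairs-resp-↭ s p r)
  AllPairs-resp-↭ s (trans↭ p q)  r                        = AllPairs-resp-↭ s q (AllPairs-resp-↭ s p r)

  ∑ : (A → ℕ) → List A → ℕ
  ∑ f []       = 0
  ∑ f (x ∷ xs) = f x + ∑ f xs

  ∑-↭ : (f : A → ℕ) → ∀ {xs ys} → xs ↭ ys → ∑ f xs ≡ ∑ f ys
  ∑-↭ f refl         = refl
  ∑-↭ f (prep x p)   = cong (f x +_) (∑-↭ f p)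
  ∑-↭ f (swap {ys = ys} x y p) rewrite ∑-↭ f p = lem (f x) (f y) (∑ f ys)
    where
    lem : ∀ a b c → a + (b + c) ≡ b + (a + c)
    lem = solve-∀
  ∑-↭ f (trans↭ p q) = trans (∑-↭ f p) (∑-↭ f q)

  ∑-++ : (f : A → ℕ) → ∀ xs ys → ∑ f (xs ++ ys) ≡ ∑ f xs + ∑ f ys
  ∑-++ f []       ys = refl
  ∑-++ f (x ∷ xs) ys = trans (cong (f x +_) (∑-++ f xs ys)) (sym (+-assoc (f x) _ _))

  ∑-cong : {f g : A → ℕ} → ∀ xs → (∀ x → x ∈ xs → f x ≡ g x) → ∑ f xs ≡ ∑ g xs
  ∑-cong []       h = refl
  ∑-cong (x ∷ xs) h = cong₂ _+_ (h x (here refl)) (∑-cong xs (λ y m → h y (there m)))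

  ∑-mono : {f g : A → ℕ} → ∀ xs → (∀ x → x ∈ xs → f x ≤ g x) → ∑ f xs ≤ ∑ g xs
  ∑-mono []       h = z≤n
  ∑-mono (x ∷ xs) h = +-mono-≤ (h x (here refl)) (∑-mono xs (λ y m → h y (there m)))

  ∑-+ : (f g : A → ℕ) → ∀ xs → ∑ (λ x → f x + g x) xs ≡ ∑ f xs + ∑ g xs
  ∑-+ f g []       = refl
  ∑-+ f g (x ∷ xs) rewrite ∑-+ f g xs = lem (f x) (g x) (∑ f xs) (∑ g xs)
    where
    lem : ∀ a b c d → a + b + (c + d) ≡ a + c + (b + d)
    lem = solve-∀

  ∑-const : (c : ℕ) → ∀ (xs : List A) → ∑ (λ _ → c) xs ≡ length xs * c
  ∑-const c []       = refl
  ∑-const c (x ∷ xs) = cong (c +_) (∑-const c xs)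

  ∑-*ˡ : (c : ℕ) (f : A → ℕ) → ∀ xs → ∑ (λ x → c * f x) xs ≡ c * ∑ f xs
  ∑-*ˡ c f []       = sym (*-zeroʳ c)
  ∑-*ˡ c f (x ∷ xs) rewrite ∑-*ˡ c f xs = sym (*-distribˡ-+ c (f x) _)

  ∑-zero : {f : A → ℕ} → ∀ xs → (∀ x → x ∈ xs → f x ≡ 0) → ∑ f xs ≡ 0
  ∑-zero xs h = trans (∑-cong xs h) (trans (∑-const 0 xs) (*-zeroʳ (length xs)))

  ∑-swap : (f : A → B → ℕ) → ∀ xs ys → ∑ (λ x → ∑ (f x) ys) xs ≡ ∑ (λ y → ∑ (λ x → f x y) xs) ys
  ∑-swap f []       ys = sym (∑-zero ys (λ _ _ → refl))
  ∑-swap f (x ∷ xs) ys rewrite ∑-swap f xs ys = sym (∑-+ (f x) (λ y → ∑ (λ x → f x y) xs) ys)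

  ∑-map : (f : B → ℕ) (g : A → B) → ∀ xs → ∑ f (map g xs) ≡ ∑ (f ∘ g) xs
  ∑-map f g []       = refl
  ∑-map f g (x ∷ xs) = cong (f (g x) +_) (∑-map f g xs)

  b2n : Bool → ℕ
  b2n false = 0
  b2n true  = 1

  filter-partition : {P : A → Set} (P? : ∀ x → Dec (P x)) → ∀ xs →
                     xs ↭ filter P? xs ++ filter (λ x → ¬? (P? x)) xs
  filter-partition P? []       = refl
  filter-partition P? (x ∷ xs) with P? x
  ... | yes _ = prep x (filter-partition P? xs)
  ... | no _  = ↭-trans (prep x (filter-partition P? xs)) (↭-sym (shift x (filter P? xs) _))

  ∑-filter : (p : A → Bool) (f : A → ℕ) → ∀ xs →
             ∑ f (filter (λ x → p x Bool.≟ true) xs) ≡ ∑ (λ x → b2n (p x) * f x) xs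
  ∑-filter p f []       = refl
  ∑-filter p f (x ∷ xs) with p x
  ... | true  = cong₂ _+_ (sym (+-identityʳ (f x))) (∑-filter p f xs)
  ... | false = ∑-filter p f xs

  length-filter : (p : A → Bool) → ∀ xs → length (filter (λ x → p x Bool.≟ true) xs) ≡ ∑ (b2n ∘ p) xs
  length-filter p []       = refl
  length-filter p (x ∷ xs) with p x
  ... | true  = cong suc (length-filter p xs)
  ... | false = length-filter p xs

  module _ {A : Set} (_≟_ : (x y : A) → Dec (x ≡ y)) where
    ∈-remove : ∀ {x : A} {xs} → AllPairs _≢_ xs → x ∈ xs → xs ↭ x ∷ filter (λ y → ¬? (y ≟ x)) xs
    ∈-remove {x} {y ∷ xs} (u ∷ us) (here refl) with x ≟ x
    ... | no ¬p = ⊥-elim (¬p refl)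
    ... | yes _ = prep x (lem xs u)
      where
      lem : ∀ zs → All (x ≢_) zs → zs ↭ filter (λ y → ¬? (y ≟ x)) zs
      lem []       []      = refl
      lem (z ∷ zs) (n ∷ a) with z ≟ x
      ... | yes p = ⊥-elim (n (sym p))
      ... | no _  = prep z (lem zs a)
    ∈-remove {x} {y ∷ xs} (u ∷ us) (there m) with y ≟ x
    ... | yes p = ⊥-elim (All.lookup u m p)
    ... | no _  = ↭-trans (prep y (∈-remove us m)) (swap y x refl)

  TriangleFree : ∀ {n} → Graph n → Set
  TriangleFree G = ∀ x y z → adj G x y ≡ true → adj G y z ≡ true → adj G x z ≡ false

  true≢false : ∀ {b} → b ≡ true → b ≡ false → ⊥
  true≢false refl ()

  module OnGraph {n : ℕ} (G : Graph n) where

    V : Set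
    V = Fin n

    _~_ : V → V → Bool
    _~_ = adj G

    ~-sym : ∀ x y → x ~ y ≡ y ~ x
    ~-sym = Graph.sym G

    Distinct : List V → Set
    Distinct = AllPairs _≢_

    Indep : List V → Set
    Indep = AllPairs (λ x y → x ~ y ≡ false)

    -- Induced subgraphs are duplicate-free vertex lists in one fixed ambient graph, so that passing
    -- to `far L v` or deleting a vertex never renumbers anything.
    α≤ : ℕ → List V → Set
    α≤ k L = ∀ I → Distinct I → Indep I → I ⊆ L → length I ≤ k

    α≤-mono : ∀ {k L L′} → L′ ⊆ L → α≤ k L → α≤ k L′
    α≤-mono s α I d i I⊆L′ = α I d i (s ∘ I⊆L′)

    Distinct-↭ : ∀ {xs ys} → xs ↭ ys → Distinct xs → Distinct ys
    Distinct-↭ = AllPairs-resp-↭ (λ p q → p (sym q))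

    Indep-↭ : ∀ {xs ys} → xs ↭ ys → Indep xs → Indep ys
    Indep-↭ = AllPairs-resp-↭ (λ {x} {y} p → trans (~-sym y x) p)

    deg : List V → V → ℕ
    deg L x = ∑ (λ y → b2n (x ~ y)) L

    edges : List V → ℕ
    edges []      = 0
    edges (x ∷ L) = deg L x + edges L

    -- The number of adjacent ordered pairs in K × L. It is additive in both arguments, so
    -- identities between edge counts become expansions of `X L L`.
    X : List V → List V → ℕ
    X K L = ∑ (deg L) K

    X-sym : ∀ K L → X K L ≡ X L K
    X-sym K L = trans (∑-swap (λ x y → b2n (x ~ y)) K L)
      (∑-cong L (λ y _ → ∑-cong K (λ x _ → cong b2n (~-sym x y))))

    X-++ˡ : ∀ J K L → X (J ++ K) L ≡ X J L + X K L
    X-++ˡ J K L = ∑-++ (deg L) J K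

    X-++ʳ : ∀ J K L → X J (K ++ L) ≡ X J K + X J L
    X-++ʳ J K L = trans (∑-cong J (λ x _ → ∑-++ _ K L)) (∑-+ (deg K) (deg L) J)

    X-↭ : ∀ {J J′ L L′} → J ↭ J′ → L ↭ L′ → X J L ≡ X J′ L′
    X-↭ {J} {J′} p q = trans (∑-↭ _ p) (∑-cong J′ (λ x _ → ∑-↭ _ q))

    deg-self : ∀ x → b2n (x ~ x) ≡ 0
    deg-self x = cong b2n (Graph.irrefl G x)

    handshake : ∀ L → X L L ≡ 2 * edges L
    handshake []      = refl
    handshake (x ∷ L) = begin
      b2n (x ~ x) + deg L x + X L (x ∷ L)     ≡⟨ cong₂ _+_ (cong (_+ deg L x) (deg-self x)) (X-++ʳ L [ x ] L) ⟩
      deg L x + (X L [ x ] + X L L)           ≡⟨ cong (λ z → deg L x + (z + X L L)) (trans (X-sym L [ x ]) (+-identityʳ _)) ⟩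
      deg L x + (deg L x + X L L)             ≡⟨ cong (λ z → deg L x + (deg L x + z)) (handshake L) ⟩
      deg L x + (deg L x + 2 * edges L)       ≡⟨ lem (deg L x) (edges L) ⟩
      2 * (deg L x + edges L)                 ∎
      where
      open ≡-Reasoning
      lem : ∀ a b → a + (a + 2 * b) ≡ 2 * (a + b)
      lem = solve-∀

    edges-↭ : ∀ {L L′} → L ↭ L′ → edges L ≡ edges L′
    edges-↭ {L} {L′} p = *-cancelˡ-≡ _ _ 2 (trans (sym (handshake L)) (trans (X-↭ p p) (handshake L′)))

    nbrs : List V → V → List V
    nbrs L v = filter (λ y → v ~ y Bool.≟ true) L

    far : List V → V → List V
    far L v = filter (λ y → ¬? (y Finₚ.≟ v)) (filter (λ y → ¬? (v ~ y Bool.≟ true)) L)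

    Z : List V → V → ℕ
    Z L v = ∑ (deg L) (nbrs L v)

    length-nbrs : ∀ L v → length (nbrs L v) ≡ deg L v
    length-nbrs L v = length-filter (v ~_) L

    ∈-nbrs⁻ : ∀ L v {y} → y ∈ nbrs L v → y ∈ L × v ~ y ≡ true
    ∈-nbrs⁻ L v = ∈-filter⁻ (λ y → v ~ y Bool.≟ true)

    ∈-far⁻ : ∀ L v {y} → y ∈ far L v → y ∈ L × v ~ y ≡ false × y ≢ v
    ∈-far⁻ L v m with ∈-filter⁻ (λ y → ¬? (y Finₚ.≟ v)) {xs = filter (λ y → ¬? (v ~ y Bool.≟ true)) L} m
    ... | m′ , ne with ∈-filter⁻ (λ y → ¬? (v ~ y Bool.≟ true)) {xs = L} m′
    ... | m″ , na = m″ , Boolₚ.¬-not na , ne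

    star-split : ∀ {L v} → Distinct L → v ∈ L → L ↭ v ∷ nbrs L v ++ far L v
    star-split {L} {v} d m = ↭-trans (filter-partition _ L)
      (↭-trans (++⁺ˡ (nbrs L v) (∈-remove Finₚ._≟_ (AllPairsₚ.filter⁺ _ d)
         (∈-filter⁺ (λ y → ¬? (v ~ y Bool.≟ true)) m (λ e → true≢false e (Graph.irrefl G v)))))
      (shift v (nbrs L v) (far L v)))

    Distinct-nbrs : ∀ {L} v → Distinct L → Distinct (nbrs L v)
    Distinct-nbrs v = AllPairsₚ.filter⁺ _

    Distinct-far : ∀ {L} v → Distinct L → Distinct (far L v)
    Distinct-far v d = AllPairsₚ.filter⁺ _ (AllPairsₚ.filter⁺ _ d)

    length-far : ∀ {L v} → Distinct L → v ∈ L → length L ≡ suc (deg L v + length (far L v))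
    length-far {L} {v} d m = trans (↭-length (star-split d m))
      (cong suc (trans (length-++ (nbrs L v)) (cong (_+ length (far L v)) (length-nbrs L v))))

    far-α : ∀ {k L v} → v ∈ L → α≤ (suc k) L → α≤ k (far L v)
    far-α {k} {L} {v} m α I d i I⊆ = s≤s⁻¹ (α (v ∷ I)
      (All.tabulate (λ y∈ e → proj₂ (proj₂ (∈-far⁻ L v (I⊆ y∈))) (sym e)) ∷ d)
      (All.tabulate (λ y∈ → proj₁ (proj₂ (∈-far⁻ L v (I⊆ y∈)))) ∷ i)
      (λ { (here refl) → m ; (there y∈) → proj₁ (∈-far⁻ L v (I⊆ y∈)) }))

    X-zero : ∀ J L → (∀ x y → x ∈ J → y ∈ L → x ~ y ≡ false) → X J L ≡ 0
    X-zero J L h = ∑-zero J (λ x x∈ → ∑-zero L (λ y y∈ → cong b2n (h x y x∈ y∈)))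

    X-nbrs-self : ∀ L v → X [ v ] (nbrs L v) ≡ deg L v
    X-nbrs-self L v = trans (+-identityʳ _) (trans (∑-cong (nbrs L v)
      (λ y m → cong b2n (proj₂ (∈-nbrs⁻ L v m)))) (trans (∑-const 1 (nbrs L v)) (trans (*-identityʳ _) (length-nbrs L v))))

    module _ (tf : TriangleFree G) where

      nbrs-nonadjacent : ∀ L v x y → x ∈ nbrs L v → y ∈ nbrs L v → x ~ y ≡ false
      nbrs-nonadjacent L v x y mx my =
        tf x v y (trans (~-sym x v) (proj₂ (∈-nbrs⁻ L v mx))) (proj₂ (∈-nbrs⁻ L v my))

      deg≤α : ∀ {k L v} → Distinct L → α≤ k L → deg L v ≤ k
      deg≤α {k} {L} {v} d α = subst (_≤ k) (length-nbrs L v) (α (nbrs L v) (Distinct-nbrs v d)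
        (indep (nbrs L v) (nbrs-nonadjacent L v)) (λ m → proj₁ (∈-nbrs⁻ L v m)))
        where
        indep : ∀ I → (∀ x y → x ∈ I → y ∈ I → x ~ y ≡ false) → Indep I
        indep []      h = []
        indep (x ∷ I) h = All.tabulate (λ {y} m → h x y (here refl) (there m)) ∷ indep I (λ a b p q → h a b (there p) (there q))

      -- The neighbours of v are pairwise nonadjacent, so an edge that is not inside `far L v` has
      -- exactly one end in `nbrs L v`, and `Z` counts it once.
      star-edges : ∀ {L v} → Distinct L → v ∈ L → edges L ≡ Z L v + edges (far L v)
      star-edges {L} {v} d m = *-cancelˡ-≡ _ _ 2 (begin
        2 * edges L ≡⟨ handshake L ⟨
        X L L ≡⟨ X-↭ sp sp ⟩
        X P P ≡⟨ trans (X-++ˡ [ v ] (N ++ F) P) (cong (X [ v ] P +_) (X-++ˡ N F P)) ⟩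
        X [ v ] P + (X N P + X F P) ≡⟨ cong₂ _+_ e1 (cong₂ _+_ e2 e3) ⟩
        D + ((D + X N F) + (X N F + X F F)) ≡⟨ cong (λ z → D + ((D + X N F) + (X N F + z))) (handshake F) ⟩
        D + ((D + X N F) + (X N F + 2 * edges F)) ≡⟨ lem D (X N F) (edges F) ⟩
        2 * ((D + X N F) + edges F) ≡⟨ cong (λ z → 2 * (z + edges F)) (sym (trans (X-↭ {J = N} refl sp) e2)) ⟩
        2 * (Z L v + edges F) ∎)
        where
        open ≡-Reasoning
        N = nbrs L v
        F = far L v
        P = v ∷ N ++ F
        D = deg L v
        sp = star-split d m
        lem : ∀ a b c → a + ((a + b) + (b + 2 * c)) ≡ 2 * ((a + b) + c)
        lem = solve-∀
        expand : ∀ J → X J P ≡ X J [ v ] + (X J N + X J F)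
        expand J = trans (X-++ʳ J [ v ] (N ++ F)) (cong (X J [ v ] +_) (X-++ʳ J N F))
        vF : X [ v ] F ≡ 0
        vF = X-zero [ v ] F (λ { x y (here refl) q → proj₁ (proj₂ (∈-far⁻ L v q)) })
        vv : X [ v ] [ v ] ≡ 0
        vv = X-zero [ v ] [ v ] (λ { x y (here refl) (here refl) → Graph.irrefl G v })
        e1 : X [ v ] P ≡ D
        e1 = trans (expand [ v ]) (trans (cong₂ _+_ vv (cong₂ _+_ (X-nbrs-self L v) vF)) (+-identityʳ D))
        e2 : X N P ≡ D + X N F
        e2 = trans (expand N) (cong₂ _+_ (trans (X-sym N [ v ]) (X-nbrs-self L v))
               (cong (_+ X N F) (X-zero N N (nbrs-nonadjacent L v))))
        e3 : X F P ≡ X N F + X F F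
        e3 = trans (expand F) (cong₂ _+_ (trans (X-sym F [ v ]) vF) (cong (_+ X F F) (X-sym F N)))

      -- The degree of y is summed once for each of the neighbours of y.
      ∑Z : ∀ L → ∑ (Z L) L ≡ ∑ (λ v → deg L v * deg L v) L
      ∑Z L = begin
        ∑ (Z L) L ≡⟨ ∑-cong L (λ v _ → ∑-filter (v ~_) (deg L) L) ⟩
        ∑ (λ v → ∑ (λ y → b2n (v ~ y) * deg L y) L) L ≡⟨ ∑-swap _ L L ⟩
        ∑ (λ y → ∑ (λ v → b2n (v ~ y) * deg L y) L) L ≡⟨ ∑-cong L (λ y _ → trans
            (∑-cong L (λ v _ → trans (*-comm (b2n (v ~ y)) (deg L y)) (cong (λ b → deg L y * b2n b) (~-sym v y))))
            (∑-*ˡ (deg L y) (λ v → b2n (y ~ v)) L)) ⟩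
        ∑ (λ v → deg L v * deg L v) L ∎
        where open ≡-Reasoning

      averaging : ∀ {L} → Distinct L →
        length L * edges L ≡ ∑ (λ v → deg L v * deg L v) L + ∑ (λ v → edges (far L v)) L
      averaging {L} d = begin
        length L * edges L ≡⟨ ∑-const (edges L) L ⟨
        ∑ (λ _ → edges L) L ≡⟨ ∑-cong L (λ v m → star-edges d m) ⟩
        ∑ (λ v → Z L v + edges (far L v)) L ≡⟨ ∑-+ (Z L) _ L ⟩
        ∑ (Z L) L + ∑ (λ v → edges (far L v)) L ≡⟨ cong (_+ ∑ (λ v → edges (far L v)) L) (∑Z L) ⟩
        ∑ (λ v → deg L v * deg L v) L + ∑ (λ v → edges (far L v)) L ∎
        where open ≡-Reasoning

      -- The linear program behind all edge bounds: t bounds the edges of far L v in terms of deg L v.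
      -- The factor 2 admits half-integral slopes p / 2.
      linear-bound : ∀ {k L} (t : ℕ → ℕ) (p q c : ℕ) → Distinct L → α≤ k L →
        (∀ d → d ≤ k → p * d + q ≤ 2 * (d * d + t d) + c) →
        (∀ v → v ∈ L → t (deg L v) ≤ edges (far L v)) →
        p * (2 * edges L) + length L * q ≤ 2 * (length L * edges L) + length L * c
      linear-bound {k} {L} t p q c d α hp ht = begin
        p * (2 * edges L) + length L * q ≡⟨ cong₂ _+_ (cong (p *_) (sym (handshake L))) (sym (∑-const q L)) ⟩
        p * ∑ (deg L) L + ∑ (λ _ → q) L ≡⟨ cong (_+ _) (sym (∑-*ˡ p (deg L) L)) ⟩
        ∑ (λ v → p * deg L v) L + ∑ (λ _ → q) L ≡⟨ ∑-+ _ _ L ⟨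
        ∑ (λ v → p * deg L v + q) L ≤⟨ ∑-mono L (λ v m → ≤-trans (hp (deg L v) (deg≤α d α))
            (+-monoˡ-≤ c (*-monoʳ-≤ 2 (+-monoʳ-≤ (deg L v * deg L v) (ht v m))))) ⟩
        ∑ (λ v → 2 * (deg L v * deg L v + edges (far L v)) + c) L ≡⟨ ∑-+ _ _ L ⟩
        ∑ (λ v → 2 * (deg L v * deg L v + edges (far L v))) L + ∑ (λ _ → c) L
          ≡⟨ cong₂ _+_ (trans (∑-*ˡ 2 _ L) (cong (2 *_) (∑-+ _ _ L))) (∑-const c L) ⟩
        2 * (∑ (λ v → deg L v * deg L v) L + ∑ (λ v → edges (far L v)) L) + length L * c
          ≡⟨ cong (λ z → 2 * z + length L * c) (averaging d) ⟨
        2 * (length L * edges L) + length L * c ∎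
        where open ≤-Reasoning

  -- Linear programming bounds

  minUpTo : ℕ → (ℕ → ℕ) → ℕ
  minUpTo zero    f = f 0
  minUpTo (suc k) f = f (suc k) ⊓ minUpTo k f

  minUpTo-≤ : ∀ k f d → d ≤ k → minUpTo k f ≤ f d
  minUpTo-≤ zero    f zero z≤n = ≤-refl
  minUpTo-≤ (suc k) f d    d≤ with m≤n⇒m<n∨m≡n d≤
  ... | inj₁ d<  = ≤-trans (m⊓n≤n _ _) (minUpTo-≤ k f d (s≤s⁻¹ d<))
  ... | inj₂ refl = m⊓n≤m _ _

  module _ (k : ℕ) (t : ℕ → ℕ) (p : ℕ) where

    -- The highest line of slope p below 2 (d² + t d) on 0 ≤ d ≤ k. Its constant term may be
    -- negative; adding p * k, here and on the other side in `intercept-≤`, keeps it a natural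
    -- number.
    intercept : ℕ
    intercept = minUpTo k (λ d → 2 * (d * d + t d) + p * (k ∸ d))

    intercept-≤ : ∀ d → d ≤ k → p * d + intercept ≤ 2 * (d * d + t d) + p * k
    intercept-≤ d d≤k = begin
      p * d + intercept                           ≤⟨ +-monoʳ-≤ (p * d) (minUpTo-≤ k _ d d≤k) ⟩
      p * d + (2 * (d * d + t d) + p * (k ∸ d))   ≡⟨ lem (p * d) (2 * (d * d + t d)) _ ⟩
      2 * (d * d + t d) + (p * d + p * (k ∸ d))   ≡⟨ cong (2 * (d * d + t d) +_) (sym (*-distribˡ-+ p d (k ∸ d))) ⟩
      2 * (d * d + t d) + p * (d + (k ∸ d))       ≡⟨ cong (λ z → 2 * (d * d + t d) + p * z) (m+[n∸m]≡n d≤k) ⟩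
      2 * (d * d + t d) + p * k                   ∎
      where
      open ≤-Reasoning
      lem : ∀ a b c → a + (b + c) ≡ b + (a + c)
      lem = solve-∀

    -- For p ≤ n the refuted inequality only gets harder to satisfy as e decreases.
    refutes : ℕ → ℕ → Bool
    refutes n e = (p ≤ᵇ n) ∧ (2 * (n * e) + n * (p * k) <ᵇ p * (2 * e) + n * intercept)

    refutes-sound : ∀ n E e → refutes n E ≡ true → e ≤ E → ¬ (p * (2 * e) + n * intercept ≤ 2 * (n * e) + n * (p * k))
    refutes-sound n E e r e≤E h with p ≤ᵇ n in eq₁ | 2 * (n * E) + n * (p * k) <ᵇ p * (2 * E) + n * intercept in eq₂
    refutes-sound n E e () e≤E h | false | _
    refutes-sound n E e () e≤E h | true | false
    ... | true | true = <-irrefl refl (begin-strict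
      2 * (n * E) + n * (p * k)                  <⟨ <ᵇ⇒< (2 * (n * E) + n * (p * k)) _ (subst T (sym eq₂) _) ⟩
      p * (2 * E) + n * intercept                ≡⟨ cong (λ z → p * (2 * z) + n * intercept) (sym eE) ⟩
      p * (2 * (e + f)) + n * intercept          ≡⟨ lem₁ p e f (n * intercept) ⟩
      2 * f * p + (p * (2 * e) + n * intercept)  ≤⟨ +-mono-≤ (*-monoʳ-≤ (2 * f) (≤ᵇ⇒≤ p n (subst T (sym eq₁) _))) h ⟩
      2 * f * n + (2 * (n * e) + n * (p * k))    ≡⟨ lem₂ n e f (n * (p * k)) ⟩
      2 * (n * (e + f)) + n * (p * k)            ≡⟨ cong (λ z → 2 * (n * z) + n * (p * k)) eE ⟩
      2 * (n * E) + n * (p * k)                  ∎)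
      where
      open ≤-Reasoning
      f = E ∸ e
      eE : e + f ≡ E
      eE = m+[n∸m]≡n e≤E
      lem₁ : ∀ p e f c → p * (2 * (e + f)) + c ≡ 2 * f * p + (p * (2 * e) + c)
      lem₁ = solve-∀
      lem₂ : ∀ n e f c → 2 * f * n + (2 * (n * e) + c) ≡ 2 * (n * (e + f)) + c
      lem₂ = solve-∀

  anyUpTo : ℕ → (ℕ → Bool) → Bool
  anyUpTo zero    f = f 0
  anyUpTo (suc k) f with f (suc k)
  ... | true  = true
  ... | false = anyUpTo k f

  anyUpTo-sound : ∀ k f → anyUpTo k f ≡ true → ∃ λ i → f i ≡ true
  anyUpTo-sound zero    f h = 0 , h
  anyUpTo-sound (suc k) f h with f (suc k) in eq
  ... | true  = suc k , eq
  ... | false = anyUpTo-sound k f h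

  -- The default 0 is the trivially valid edge bound, so a row says nothing beyond its end.
  nth : List ℕ → ℕ → ℕ
  nth []       _       = 0
  nth (x ∷ _)  zero    = x
  nth (_ ∷ xs) (suc n) = nth xs n

  slopeExists : ℕ → (ℕ → ℕ) → ℕ → ℕ → Bool
  slopeExists k t n e = anyUpTo 40 (λ p → refutes k t p n e)

  -- To prove the bound `suc e`, the edge counts up to e have to be refuted. Degrees are at most
  -- `suc k`, so none exceeds half of n * suc k; this cap is what makes an entry 1000 provable.
  rowValue : ℕ → List ℕ → ℕ → ℕ → Bool
  rowValue k row n zero      = true
  rowValue k row n (suc e)   = slopeExists (suc k) (λ d → nth row (n ∸ suc d)) n (e ⊓ ⌊ n * suc k /2⌋)

  module Bounds {N : ℕ} (G : Graph N) (tf : TriangleFree G) where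
    open OnGraph G

    MinEdges : ℕ → ℕ → ℕ → Set
    MinEdges k n e = ∀ L → Distinct L → length L ≡ n → α≤ k L → e ≤ edges L

    RowValid : ℕ → List ℕ → Set
    RowValid k row = ∀ n → MinEdges k n (nth row n)

    edges≤ : ∀ {k L} → Distinct L → α≤ k L → edges L ≤ ⌊ length L * k /2⌋
    edges≤ {k} {L} d α = subst (_≤ ⌊ length L * k /2⌋) (half (edges L))
      (⌊n/2⌋-mono (subst (_≤ length L * k) (trans (handshake L) (cong (edges L +_) (+-identityʳ _)))
        (≤-trans (∑-mono L (λ v _ → deg≤α tf d α)) (≤-reflexive (∑-const k L)))))
      where
      half : ∀ e → ⌊ e + e /2⌋ ≡ e
      half zero = refl
      half (suc e) rewrite +-suc e e = cong suc (half e)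

    length-far≡ : ∀ {L v} → Distinct L → v ∈ L → length (far L v) ≡ length L ∸ suc (deg L v)
    length-far≡ {L} {v} d m = sym (trans (cong (_∸ suc (deg L v)) (length-far d m)) (m+n∸m≡n (deg L v) _))

    -- Were t a lower bound at every vertex, averaging over the vertices would contradict the line
    -- found. So t need not be a proven bound: raising it above the truth turns a refutation into a
    -- search for a special vertex.
    low-vertex : ∀ k t n E L → slopeExists k t n E ≡ true →
      Distinct L → length L ≡ n → α≤ k L → edges L ≤ E →
      ∃ λ v → v ∈ L × edges (far L v) < t (deg L v)
    low-vertex k t n E L s d refl α e≤E with any? (λ v → edges (far L v) <? t (deg L v)) L
    ... | yes a = find a
    ... | no ¬a with anyUpTo-sound 40 _ s
    ... | p , r = ⊥-elim (refutes-sound k t p n E (edges L) r e≤E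
      (linear-bound tf t p (intercept k t p) (p * k) d α (intercept-≤ k t p)
        (λ v m → ≮⇒≥ (λ lt → ¬a (Any.map (λ { refl → lt }) m)))))

    rowValue-sound : ∀ k row → RowValid k row → ∀ n e → rowValue k row n e ≡ true → MinEdges (suc k) n e
    rowValue-sound k row R n zero    c L d l α = z≤n
    rowValue-sound k row R n (suc e) c L d refl α with suc e ≤? edges L
    ... | yes p = p
    ... | no ¬p with low-vertex (suc k) _ n (e ⊓ ⌊ n * suc k /2⌋) L c d refl α (⊓-glb (s≤s⁻¹ (≰⇒> ¬p)) (edges≤ d α))
    ... | v , m , lt = ⊥-elim (<⇒≱ lt (R _ (far L v) (Distinct-far v d) (length-far≡ d m) (far-α m α)))

  -- At a listed degree the threshold is one more than e, so that the vertex found has a far graph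
  -- with at most e edges. At the other degrees it is the proven minimum, so that no such vertex
  -- exists.
  thresholds : List (ℕ × ℕ) → List ℕ → ℕ → ℕ → ℕ
  thresholds []             row n d = nth row (n ∸ suc d)
  thresholds ((d′ , e) ∷ s) row n d = if d ≡ᵇ d′ then suc e else thresholds s row n d

  -- Gluing: the computation

  Row Tri : Set
  Row = List Bool
  Tri = List Row

  Family : Set
  Family = List (ℕ × Row)

  -- Let-bound terms are not shared during evaluation, so an intermediate result that is used twice
  -- is passed to an auxiliary function.
  consBit : Bool → Row × ℕ → Row × ℕ
  consBit b (r , m) = b ∷ r , m

  bits : ℕ → ℕ → Row × ℕ
  bits zero    m = [] , m
  bits (suc n) m = consBit (m % 2 ≡ᵇ 1) (bits n (m / 2))

  -- A graph on n vertices is encoded by the binary digits of its upper triangle.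
  decode : ℕ → ℕ → Tri
  decodeRows : ℕ → Row × ℕ → Tri

  decode zero    m = []
  decode (suc n) m = decodeRows n (bits n m)

  decodeRows n (r , m) = r ∷ decode n m

  popcount : Row → ℕ
  popcount = ∑ b2n

  triEdges : Tri → ℕ
  triEdges = ∑ popcount

  none : {A : Set} → List A → Row
  none = map (λ _ → false)

  _∪_ : Row → Row → Row
  _∪_ = zipWith _∨_

  disjoint : Row → Row → Bool
  disjoint []          t           = true
  disjoint (b ∷ s)     []          = true
  disjoint (false ∷ s) (_ ∷ t)     = disjoint s t
  disjoint (true ∷ s)  (false ∷ t) = disjoint s t
  disjoint (true ∷ s)  (true ∷ t)  = false

  -- The first row marks the vertices forbidden by earlier choices; choosing a vertex adds its row
  -- to the marks.
  independent : Row → Tri → Row → Bool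
  independent []           []       []          = true
  independent (f ∷ fs)     (r ∷ rs) (false ∷ s) = independent fs rs s
  independent (false ∷ fs) (r ∷ rs) (true ∷ s)  = independent (fs ∪ r) rs s
  independent _            _        _           = false

  independentSets : ℕ → Row → Tri → List Row
  independentSets zero    fs       rs       = [ none rs ]
  independentSets (suc n) (f ∷ fs) (r ∷ rs) =
    map (false ∷_) (independentSets (suc n) fs rs) ++
    (if f then [] else map (true ∷_) (independentSets n (fs ∪ r) rs))
  independentSets (suc n) _        _        = []

  missed : Family → Row → ℕ
  missed F s = ∑ (λ (w , t) → if disjoint s t then w else 0) F

  skip : Family → Family
  skip []                = []
  skip ((w , []) ∷ F)    = (w , []) ∷ skip F
  skip ((w , _ ∷ t) ∷ F) = (w , t) ∷ skip F

  keep : Family → Family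
  keep []                    = []
  keep ((w , []) ∷ F)        = (w , []) ∷ keep F
  keep ((w , false ∷ t) ∷ F) = (w , t) ∷ keep F
  keep ((w , true ∷ t) ∷ F)  = keep F

  -- The independent s whose `price` is at most lim. Each vertex is decided in turn: choosing it
  -- pays lam and drops from F the sets that it meets, so at the end exactly the missed sets remain
  -- to be paid for.
  cheapSets : ℕ → ℕ → Row → Tri → Family → List Row
  cheapSets lam lim (f ∷ fs) (r ∷ rs) F =
    map (false ∷_) (cheapSets lam lim fs rs (skip F)) ++
    (if f ∨ (lim <ᵇ lam) then [] else map (true ∷_) (cheapSets lam (lim ∸ lam) (fs ∪ r) rs (keep F)))
  cheapSets lam lim _ _ F = if ∑ proj₁ F ≤ᵇ lim then [ [] ] else []

  -- A candidate neighbourhood with the mask of the maximal independent sets it misses.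
  record Item : Set where
    constructor item
    field
      cost size : ℕ
      misses    : Row
      set       : Row
  open Item public

  insert : Item → List Item → List Item
  insert q []       = q ∷ []
  insert q (p ∷ ps) = if size q ≤ᵇ size p then q ∷ p ∷ ps else p ∷ insert q ps

  sort : List Item → List Item
  sort []       = []
  sort (q ∷ qs) = insert q (sort qs)

  sift : Row → List Item → List Item
  siftWith : Bool → Row → Item → List Item → List Item

  sift s []       = []
  sift s (p ∷ ps) = siftWith (disjoint s (misses p)) s p ps

  siftWith true  s p ps = p ∷ sift s ps
  siftWith false s p ps = sift s ps

  -- Chooses d more rows with total cost at most b and total size at most z. Items are sorted by
  -- size, so once q is too large the whole branch ends. The chosen q stays available, since two
  -- neighbours of v may have the same row; `sift` keeps it only if it misses no maximal set.
  search : ℕ → (d b z : ℕ) → List Item → List (List Row)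
  search mu zero    b z cs       = [ [] ]
  search mu (suc d) b z []       = []
  search mu (suc d) b z (q ∷ cs) =
    if z <ᵇ suc d * size q then [] else
    (if b <ᵇ cost q + d * mu then []
     else map (set q ∷_) (search mu d (b ∸ cost q) (z ∸ size q) (sift (misses q) (q ∷ cs)))) ++
    search mu (suc d) b z cs

  -- The vertices are listed as the neighbours of v, then v, then K.
  build : Tri → List Row → Tri
  build K []      = none K ∷ K
  build K (s ∷ r) = (none r ++ true ∷ s) ∷ build K r

  behind : A → A × List A → A × List A
  behind x (z , zs) = z , x ∷ zs

  pick : ℕ → A → List A → A × List A
  pick zero    x xs       = x , xs
  pick (suc i) x []       = x , []
  pick (suc i) x (y ∷ ys) = behind x (pick i y ys)

  permute : List ℕ → List A → List A
  permuteRest : List ℕ → A × List A → List A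

  permute []      xs       = xs
  permute (i ∷ c) []       = []
  permute (i ∷ c) (x ∷ xs) = permuteRest c (pick i x xs)

  permuteRest c (y , ys) = y ∷ permute c ys

  behindTri : Bool × Row → Row × Tri → Row × Tri
  behindTri (c , cs) (r , rs) = c ∷ r , cs ∷ rs

  -- Moves vertex i to the front: the entries of its column above the diagonal are collected and
  -- joined to its row.
  pickTri : ℕ → Row → Tri → Row × Tri
  pickTri zero    r        rs        = r , rs
  pickTri (suc i) r        []        = r , []
  pickTri (suc i) []       (r′ ∷ rs) = [] , []
  pickTri (suc i) (b ∷ bs) (r′ ∷ rs) = behindTri (pick i b bs) (pickTri i r′ rs)

  permuteTri : List ℕ → Tri → Tri
  permuteTriRest : List ℕ → Row × Tri → Tri

  permuteTri []      F        = F
  permuteTri (i ∷ c) []       = []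
  permuteTri (i ∷ c) (r ∷ rs) = permuteTriRest c (pickTri i r rs)

  permuteTriRest c (r , rs) = permute c r ∷ permuteTri c rs

  times : Tri → List ℕ → List ℕ
  times (r ∷ rs) (x ∷ xs) = dot r xs ∷ add r (times rs xs)
    where
    dot : Row → List ℕ → ℕ
    dot (true ∷ r)  (y ∷ ys) = y + dot r ys
    dot (false ∷ r) (y ∷ ys) = dot r ys
    dot _           _        = 0
    add : Row → List ℕ → List ℕ
    add (true ∷ r)  (y ∷ ys) = x + y ∷ add r ys
    add (false ∷ r) (y ∷ ys) = y ∷ add r ys
    add _           _        = []
  times _ _ = []

  -- The fourth power of the adjacency matrix applied to the all-ones vector: the number of walks of
  -- length 4 from each vertex, an isomorphism invariant.
  walks : Tri → List ℕ
  walks F = times F (times F (times F (times F (map (λ _ → 1) F))))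

  matchFrom : Tri → List ℕ → Tri → List ℕ → Maybe (List ℕ)
  matchFrom []      _          _        _  = just []
  matchFrom (r ∷ R) (kr ∷ krs) (f ∷ F) (k₀ ∷ ks₀) = tryAll 0 (k₀ ∷ ks₀)
    where
    -- One bit is appended for the adjacency to the vertex just placed, so equal keys mean equal
    -- walk counts and equal adjacency to all vertices placed so far.
    extend : Row → List ℕ → List ℕ
    extend = zipWith (λ b k → if b then suc (2 * k) else 2 * k)
    attempt : Row × Tri → ℕ × List ℕ → Maybe (List ℕ)
    attempt (ρ , F′) (_ , ks) = matchFrom R (extend r krs) F′ (extend ρ ks)
    tryAll : ℕ → List ℕ → Maybe (List ℕ)
    tryAll i []       = nothing
    tryAll i (k ∷ ks) = if k ≡ᵇ kr then Maybe.map (i ∷_) (attempt (pickTri i f F) (pick i k₀ ks₀)) <∣> tryAll (suc i) ks else tryAll (suc i) ks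
  matchFrom _       _          _        _  = nothing

  eqRow : Row → Row → Bool
  eqRow []          []          = true
  eqRow (true ∷ r)  (true ∷ s)  = eqRow r s
  eqRow (false ∷ r) (false ∷ s) = eqRow r s
  eqRow _           _           = false

  eqTri : Tri → Tri → Bool
  eqTri []      []      = true
  eqTri (r ∷ R) (s ∷ S) = eqRow r s ∧ eqTri R S
  eqTri _       _       = false

  -- The keys only steer the search for a permutation; the permutation found is checked.
  isomorphic : Tri → List ℕ → Tri × List ℕ → Bool
  isomorphic F key (R , keyR) with matchFrom R keyR F key
  ... | just c  = eqTri (permuteTri c F) R
  ... | nothing = false

  violates : ℕ → Tri → List Row → Row → Bool
  violates k K rows t = (k <ᵇ popcount t + ∑ (λ s → b2n (disjoint s t)) rows) ∧ independent (none K) K t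

  -- The weights of a certificate are the digits of one number to the base suc radix.
  record Cert : Set where
    constructor cert
    field
      lam mu radix weights : ℕ

  weigh : ℕ → ℕ → List Row → Family
  weighWith : ℕ → ℕ → ℕ → Row → List Row → Family

  weigh b w []      = []
  weigh b w (t ∷ T) = weighWith b (w % suc b) (w / suc b) t T

  weighWith b zero    w t T = weigh b w T
  weighWith b (suc v) w t T = (suc v , t) ∷ weigh b w T

  -- The charge on a row under dual variables: lam for the bound on the total size of the rows, and
  -- one weight for each maximal independent T, which at most one row may miss.
  price : ℕ → Family → Row → ℕ
  price lam F s = lam * popcount s + missed F s

  toItem : ℕ → Family → List Row → Row → Item
  toItem lam F T s = item (price lam F s) (popcount s) (map (disjoint s) T) s

  module Glue (k d E : ℕ) (reps : List Tri) where

    maximal : Tri → List Row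
    maximal K = independentSets (k ∸ 1) (none K) K

    -- Of the E edges allowed, those of K and the d edges at v are fixed; the rest run between the
    -- neighbours of v and K.
    budget : Tri → ℕ
    budget K = E ∸ (triEdges K + d)

    total : Tri → ℕ → Family → ℕ
    total K lam F = lam * budget K + ∑ proj₁ F

    -- If every row costs at least mu, none costs more than tot - (d - 1) mu. The maximum with mu -
    -- 1 makes the claim about mu checkable: an independent set cheaper than mu would itself appear
    -- among the candidates, where `searchOK` tests that all costs are at least mu.
    limit : ℕ → ℕ → ℕ
    limit mu tot = (mu ∸ 1) ⊔ (tot ∸ (d ∸ 1) * mu)

    candidates : Tri → ℕ → ℕ → List Row → Family → ℕ → List Item
    candidates K lam mu T F tot = sort (map (toItem lam F T) (cheapSets lam (limit mu tot) (none K) K F))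

    uncovered : Tri → List Row → List Row → List Row
    uncovered K rows = filterᵇ (disjoint (foldr _∪_ (none K) rows))

    -- A choice of rows is settled if it forces too large an independent set or yields a listed
    -- graph. The cheap test that settles most leaves comes first, and the full list of test sets
    -- comes last.
    leafTest : Tri → List Row → List Row → List (Tri × List ℕ) → List Row → Tri → List ℕ → Bool
    leafTest K Us Ts keyed rows F key =
      any (violates k K rows) (uncovered K rows Us) ∨ any (isomorphic F key) keyed ∨ any (violates k K rows) Ts

    leafOK : Tri → List Row → List Row → List (Tri × List ℕ) → List Row → Tri → Bool
    leafOK K Us Ts keyed rows F = leafTest K Us Ts keyed rows F (walks F)

    leavesOK : Tri → List Row → List Row → List (Tri × List ℕ) → List (List Row) → Bool
    leavesOK K Us Ts keyed []       = true
    leavesOK K Us Ts keyed (r ∷ rs) = leafOK K Us Ts keyed r (build K r) ∧ leavesOK K Us Ts keyed rs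

    -- Most dead ends leave some independent set of this size uncovered by all d neighbours.
    smallSets : Tri → List Row
    smallSets K = independentSets (suc k ∸ d) (none K) K

    -- Sizes below k - 1 suffice, because `search` has already enforced the condition for the sets
    -- of size k - 1.
    testSets : Tri → List Row
    testSets K = concatMap (λ i → independentSets i (none K) K) (downFrom (k ∸ 1))

    keyedReps : List (Tri × List ℕ)
    keyedReps = map (λ R → R , walks R) reps

    searchOK : Tri → ℕ → ℕ → List Item → Bool
    searchOK K mu tot cs =
      all (λ q → mu ≤ᵇ cost q) cs ∧ leavesOK K (smallSets K) (testSets K) keyedReps (search mu d tot (budget K) cs)

    totalOK : Tri → ℕ → ℕ → List Row → Family → ℕ → Bool
    totalOK K lam mu T F tot = searchOK K mu tot (candidates K lam mu T F tot)

    familyOK : Tri → ℕ → ℕ → List Row → Family → Bool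
    familyOK K lam mu T F = totalOK K lam mu T F (total K lam F)

    maximalOK : Tri → ℕ → ℕ → ℕ → ℕ → List Row → Bool
    maximalOK K lam mu b w T =
      all (λ t → independent (none K) K t ∧ (suc (popcount t) ≡ᵇ k)) T ∧ familyOK K lam mu T (weigh b w T)

    glueOK : Tri → ℕ → ℕ → ℕ → ℕ → Bool
    glueOK K lam mu b w = maximalOK K lam mu b w (maximal K)

    -- The first alternative disposes of a K that exceeds the edge bound already together with the d
    -- edges at v.
    certOK : Tri → Cert → Bool
    certOK K (cert lam mu b w) = (E <ᵇ triEdges K + d) ∨ glueOK K lam mu b w

    certsOK : List Tri → List Cert → Bool
    certsOK []       _        = true
    certsOK (K ∷ Ks) []       = false
    certsOK (K ∷ Ks) (c ∷ cs) = certOK K c ∧ certsOK Ks cs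

  within : ℕ → List Tri → List Tri
  within E = filterᵇ (λ K → triEdges K ≤ᵇ E)

  -- Gluing: soundness

  ∧-true : ∀ {a b} → a ∧ b ≡ true → a ≡ true × b ≡ true
  ∧-true {true} {true} _ = refl , refl

  ∨-true : ∀ {a b} → a ∨ b ≡ true → a ≡ true ⊎ b ≡ true
  ∨-true {true}  _ = inj₁ refl
  ∨-true {false} h = inj₂ h

  ∨-false : ∀ {a b} → a ∨ b ≡ false → a ≡ false × b ≡ false
  ∨-false {false} {false} _ = refl , refl

  all-∈ : (p : A → Bool) → ∀ xs → all p xs ≡ true → ∀ {x} → x ∈ xs → p x ≡ true
  all-∈ p (x ∷ xs) h (here refl) = proj₁ (∧-true h)
  all-∈ p (x ∷ xs) h (there m)   = all-∈ p xs (proj₂ (∧-true {p x} h)) m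

  any-∃ : (p : A → Bool) → ∀ xs → any p xs ≡ true → ∃ λ x → x ∈ xs × p x ≡ true
  any-∃ p (x ∷ xs) h with ∨-true {p x} h
  ... | inj₁ e = x , here refl , e
  ... | inj₂ e with any-∃ p xs e
  ... | y , m , e′ = y , there m , e′

  ∈-filterᵇ⁺ : (p : A → Bool) → ∀ {x xs} → x ∈ xs → p x ≡ true → x ∈ filterᵇ p xs
  ∈-filterᵇ⁺ p {x} {y ∷ xs} (here refl) e rewrite e = here refl
  ∈-filterᵇ⁺ p {x} {y ∷ xs} (there m)   e with p y
  ... | true  = there (∈-filterᵇ⁺ p m e)
  ... | false = ∈-filterᵇ⁺ p m e

  disjoint-[]ʳ : ∀ s → disjoint s [] ≡ true
  disjoint-[]ʳ []      = refl
  disjoint-[]ʳ (_ ∷ s) = refl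

  missed-[] : ∀ F → missed F [] ≡ ∑ proj₁ F
  missed-[] []            = refl
  missed-[] ((w , t) ∷ F) = cong (w +_) (missed-[] F)

  missed-skip : ∀ F s → missed F (false ∷ s) ≡ missed (skip F) s
  missed-skip []                s = refl
  missed-skip ((w , []) ∷ F)    s rewrite disjoint-[]ʳ s = cong (w +_) (missed-skip F s)
  missed-skip ((w , _ ∷ t) ∷ F) s = cong (_ +_) (missed-skip F s)

  missed-keep : ∀ F s → missed F (true ∷ s) ≡ missed (keep F) s
  missed-keep []                    s = refl
  missed-keep ((w , []) ∷ F)        s rewrite disjoint-[]ʳ s = cong (w +_) (missed-keep F s)
  missed-keep ((w , false ∷ t) ∷ F) s = cong (_ +_) (missed-keep F s)
  missed-keep ((w , true ∷ t) ∷ F)  s = missed-keep F s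

  ≤ᵇ-true : ∀ {m n} → m ≤ n → (m ≤ᵇ n) ≡ true
  ≤ᵇ-true {m} {n} h with m ≤ᵇ n | ≤⇒≤ᵇ h
  ... | true | _ = refl

  ≤ᵇ-sound : ∀ {m n} → (m ≤ᵇ n) ≡ true → m ≤ n
  ≤ᵇ-sound {m} {n} h = ≤ᵇ⇒≤ m n (subst T (sym h) _)

  <ᵇ-sound : ∀ {m n} → (m <ᵇ n) ≡ true → m < n
  <ᵇ-sound {m} {n} h = <ᵇ⇒< m n (subst T (sym h) _)

  <ᵇ-false : ∀ {m n} → n ≤ m → (m <ᵇ n) ≡ false
  <ᵇ-false {m} {n} h with m <ᵇ n in eq
  ... | false = refl
  ... | true  = ⊥-elim (<⇒≱ (<ᵇ-sound eq) h)

  cheapSets-complete : ∀ lam lim fs rs F s → independent fs rs s ≡ true →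
    lam * popcount s + missed F s ≤ lim → s ∈ cheapSets lam lim fs rs F
  cheapSets-complete lam lim [] [] F [] i h
    rewrite ≤ᵇ-true {∑ proj₁ F} {lim} (subst (_≤ lim) (missed-[] F) (subst (λ z → z + missed F [] ≤ lim) (*-zeroʳ lam) h)) = here refl
  cheapSets-complete lam lim (f ∷ fs) (r ∷ rs) F (false ∷ s) i h =
    ∈-++⁺ˡ (∈-map⁺ (false ∷_) (cheapSets-complete lam lim fs rs (skip F) s i
      (subst (λ z → lam * popcount s + z ≤ lim) (missed-skip F s) h)))
  cheapSets-complete lam lim (false ∷ fs) (r ∷ rs) F (true ∷ s) i h
    rewrite <ᵇ-false {lim} {lam} (≤-trans (≤-trans (m≤m+n lam (lam * popcount s)) (≤-reflexive (sym (*-suc lam (popcount s))))) (m+n≤o⇒m≤o _ h)) =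
    ∈-++⁺ʳ _ (∈-map⁺ (true ∷_) (cheapSets-complete lam (lim ∸ lam) (fs ∪ r) rs (keep F) s i
      (≤-trans (≤-reflexive (sym (m+n∸m≡n lam _))) (∸-monoˡ-≤ lam (≤-trans (≤-reflexive e) h)))))
    where
    e : lam + (lam * popcount s + missed (keep F) s) ≡ lam * suc (popcount s) + missed F (true ∷ s)
    e = trans (sym (+-assoc lam _ _)) (cong₂ _+_ (sym (*-suc lam (popcount s))) (sym (missed-keep F s)))

  Compat : List Row → Row → Row → Set
  Compat T s s′ = ∀ t → t ∈ T → disjoint s t ≡ true → disjoint s′ t ≡ true → ⊥

  disjoint-sym : ∀ s t → disjoint s t ≡ disjoint t s
  disjoint-sym []          t           = sym (disjoint-[]ʳ t)
  disjoint-sym (_ ∷ s)     []          = refl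
  disjoint-sym (false ∷ s) (false ∷ t) = disjoint-sym s t
  disjoint-sym (false ∷ s) (true ∷ t)  = disjoint-sym s t
  disjoint-sym (true ∷ s)  (false ∷ t) = disjoint-sym s t
  disjoint-sym (true ∷ s)  (true ∷ t)  = refl

  misses-disjoint : ∀ T s s′ → Compat T s s′ → disjoint (map (disjoint s) T) (map (disjoint s′) T) ≡ true
  misses-disjoint []      s s′ h = refl
  misses-disjoint (t ∷ T) s s′ h with disjoint s t in e | disjoint s′ t in e′
  ... | true  | true  = ⊥-elim (h t (here refl) e e′)
  ... | true  | false = misses-disjoint T s s′ (λ t m → h t (there m))
  ... | false | true  = misses-disjoint T s s′ (λ t m → h t (there m))
  ... | false | false = misses-disjoint T s s′ (λ t m → h t (there m))

  BySize : List Item → Set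
  BySize = AllPairs (λ p q → size p ≤ size q)

  insert-∈ : ∀ q ps {p} → p ∈ q ∷ ps → p ∈ insert q ps
  insert-∈ q []       m = m
  insert-∈ q (x ∷ ps) m with size q ≤ᵇ size x
  ... | true = m
  insert-∈ q (x ∷ ps) (here e)          | false = there (insert-∈ q ps (here e))
  insert-∈ q (x ∷ ps) (there (here e))  | false = here e
  insert-∈ q (x ∷ ps) (there (there m)) | false = there (insert-∈ q ps (there m))

  insert-All : {P : Item → Set} → ∀ q ps → P q → All P ps → All P (insert q ps)
  insert-All q []       h []      = h ∷ []
  insert-All q (x ∷ ps) h (a ∷ b) with size q ≤ᵇ size x
  ... | true  = h ∷ a ∷ b
  ... | false = a ∷ insert-All q ps h b

  insert-sorted : ∀ q ps → BySize ps → BySize (insert q ps)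
  insert-sorted q []       []      = [] ∷ []
  insert-sorted q (x ∷ ps) (a ∷ b) with size q ≤ᵇ size x in e
  ... | true  = (≤ᵇ-sound e ∷ All.map (≤-trans (≤ᵇ-sound e)) a) ∷ a ∷ b
  ... | false = insert-All q ps (≰⇒≥ (λ le → true≢false (≤ᵇ-true le) e)) a ∷ insert-sorted q ps b

  sort-∈ : ∀ qs {p} → p ∈ qs → p ∈ sort qs
  sort-∈ (q ∷ qs) (here e)  = insert-∈ q (sort qs) (here e)
  sort-∈ (q ∷ qs) (there m) = insert-∈ q (sort qs) (there (sort-∈ qs m))

  sort-sorted : ∀ qs → BySize (sort qs)
  sort-sorted []       = []
  sort-sorted (q ∷ qs) = insert-sorted q (sort qs) (sort-sorted qs)

  extract : {q : A} {cs P : List A} → All (_∈ q ∷ cs) P → (∃ λ P′ → P ↭ q ∷ P′) ⊎ All (_∈ cs) P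
  extract []                = inj₂ []
  extract (here refl ∷ a)   = inj₁ (_ , refl)
  extract {P = p ∷ _} (there m ∷ a) with extract a
  ... | inj₁ (P′ , π) = inj₁ (p ∷ P′ , ↭-trans (prep p π) (swap p _ refl))
  ... | inj₂ a′ = inj₂ (m ∷ a′)

  ∈-sift : ∀ s {p ps} → p ∈ ps → disjoint s (misses p) ≡ true → p ∈ sift s ps
  ∈-sift s {p} {x ∷ ps} (here refl) e rewrite e = here refl
  ∈-sift s {p} {x ∷ ps} (there m)   e with disjoint s (misses x)
  ... | true  = there (∈-sift s m e)
  ... | false = ∈-sift s m e

  sift-All : {P : Item → Set} → ∀ s {ps} → All P ps → All P (sift s ps)
  sift-All s []               = []
  sift-All s {x ∷ ps} (a ∷ b) with disjoint s (misses x)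
  ... | true  = a ∷ sift-All s b
  ... | false = sift-All s b

  sift-sorted : ∀ s {ps} → BySize ps → BySize (sift s ps)
  sift-sorted s []               = []
  sift-sorted s {x ∷ ps} (a ∷ b) with disjoint s (misses x)
  ... | true  = sift-All s a ∷ sift-sorted s b
  ... | false = sift-sorted s b

  ∑-lower : {f : A → ℕ} {μ : ℕ} → ∀ xs → All (λ x → μ ≤ f x) xs → length xs * μ ≤ ∑ f xs
  ∑-lower []       []      = z≤n
  ∑-lower (_ ∷ xs) (x ∷ a) = +-mono-≤ x (∑-lower xs a)

  -- P is the unknown selection, known only up to order. `extract` follows the branching of
  -- `search`: either the first candidate occurs in P and can be moved to its front, or P lies in
  -- the remaining candidates.
  search-complete : ∀ mu d b z cs (P : List Item) → BySize cs → length P ≡ d → All (_∈ cs) P →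
    AllPairs (λ p q → disjoint (misses p) (misses q) ≡ true) P → All (λ p → mu ≤ cost p) P →
    ∑ cost P ≤ b → ∑ size P ≤ z →
    ∃ λ r → r ∈ search mu d b z cs × map set P ↭ r
  search-complete mu zero b z cs [] so l a c m h h′ = [] , here refl , refl
  search-complete mu (suc d) b z [] (p ∷ P) so l (() ∷ a) c m h h′
  search-complete mu (suc d) b z (q ∷ cs) P (sq ∷ so) l a co m h h′ with z <ᵇ suc d * size q in ez
  ... | true = ⊥-elim (<⇒≱ (<ᵇ-sound ez) (≤-trans (subst (λ n → n * size q ≤ ∑ size P) l
      (∑-lower P (All.map (λ { (here refl) → ≤-refl ; (there x) → All.lookup sq x }) a))) h′))
  ... | false with extract a
  ... | inj₂ a′ with search-complete mu (suc d) b z cs P so l a′ co m h h′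
  ... | r , r∈ , π = r , ∈-++⁺ʳ _ r∈ , π
  search-complete mu (suc d) b z (q ∷ cs) P (sq ∷ so) l a co m h h′ | false | inj₁ (P′ , π)
    with AllPairs-resp-↭ (λ {x} {y} e → trans (disjoint-sym (misses y) (misses x)) e) π co | All-resp-↭ π m | All-resp-↭ π a
       | subst (_≤ b) (∑-↭ cost π) h | subst (_≤ z) (∑-↭ size π) h′
  ... | cq ∷ co′ | mq ∷ m′ | _ ∷ a′ | hc | hz
    with search-complete mu d (b ∸ cost q) (z ∸ size q) (sift (misses q) (q ∷ cs)) P′
      (sift-sorted (misses q) (sq ∷ so))
      (suc-injective (trans (sym (↭-length π)) l))
      (All.zipWith (λ { (p∈ , cp) → ∈-sift (misses q) p∈ cp }) (a′ , cq))
      co′ m′ (≤-trans (≤-reflexive (sym (m+n∸m≡n (cost q) _))) (∸-monoˡ-≤ (cost q) hc))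
      (≤-trans (≤-reflexive (sym (m+n∸m≡n (size q) _))) (∸-monoˡ-≤ (size q) hz))
  ... | r , r∈ , π′ = set q ∷ r , ∈-++⁺ˡ branch , ↭-trans (map⁺ set π) (prep (set q) π′)
    where
    enough : cost q + d * mu ≤ b
    enough = ≤-trans (+-monoʳ-≤ (cost q) (subst (λ n → n * mu ≤ ∑ cost P′) (suc-injective (trans (sym (↭-length π)) l)) (∑-lower P′ m′))) hc
    branch : set q ∷ r ∈ (if b <ᵇ cost q + d * mu then [] else
      map (set q ∷_) (search mu d (b ∸ cost q) (z ∸ size q) (sift (misses q) (q ∷ cs))))
    branch rewrite <ᵇ-false enough = ∈-map⁺ (set q ∷_) r∈

  eqRow-sound : ∀ r s → eqRow r s ≡ true → r ≡ s
  eqRow-sound []          []          h = refl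
  eqRow-sound (true ∷ r)  (true ∷ s)  h = cong (true ∷_) (eqRow-sound r s h)
  eqRow-sound (false ∷ r) (false ∷ s) h = cong (false ∷_) (eqRow-sound r s h)

  eqTri-sound : ∀ R S → eqTri R S ≡ true → R ≡ S
  eqTri-sound []      []      h = refl
  eqTri-sound (r ∷ R) (s ∷ S) h with ∧-true {eqRow r s} h
  ... | a , b = cong₂ _∷_ (eqRow-sound r s a) (eqTri-sound R S b)

  pick-↭ : ∀ i (x : A) xs → x ∷ xs ↭ proj₁ (pick i x xs) ∷ proj₂ (pick i x xs)
  pick-↭ zero    x xs       = refl
  pick-↭ (suc i) x []       = refl
  pick-↭ (suc i) x (y ∷ ys) = ↭-trans (prep x (pick-↭ i y ys)) (swap x _ refl)

  -- Each entry of a code is a position among the elements still left, and a position out of range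
  -- takes the last one. Hence every list of numbers codes a permutation, and a code found by search
  -- needs no validation.
  permute-↭ : ∀ c (xs : List A) → permute c xs ↭ xs
  permute-↭ []      xs       = refl
  permute-↭ (i ∷ c) []       = refl
  permute-↭ (i ∷ c) (x ∷ xs) = ↭-trans (prep _ (permute-↭ c _)) (↭-sym (pick-↭ i x xs))

  pick-map : (f : A → B) → ∀ i x xs → pick i (f x) (map f xs) ≡ (f (proj₁ (pick i x xs)) , map f (proj₂ (pick i x xs)))
  pick-map f zero    x xs       = refl
  pick-map f (suc i) x []       = refl
  pick-map f (suc i) x (y ∷ ys) rewrite pick-map f i y ys = refl

  permute-map : (f : A → B) → ∀ c xs → permute c (map f xs) ≡ map f (permute c xs)
  permute-map f []      xs       = refl
  permute-map f (i ∷ c) []       = refl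
  permute-map f (i ∷ c) (x ∷ xs) rewrite pick-map f i x xs = cong (_ ∷_) (permute-map f c _)

  select : Row → List A → List A
  select (true ∷ s)  (x ∷ xs) = x ∷ select s xs
  select (false ∷ s) (x ∷ xs) = select s xs
  select _           _        = []

  select-⊆ : ∀ s (xs : List A) → select s xs ⊆ xs
  select-⊆ (true ∷ s)  (x ∷ xs) (here e)  = here e
  select-⊆ (true ∷ s)  (x ∷ xs) (there m) = there (select-⊆ s xs m)
  select-⊆ (false ∷ s) (x ∷ xs) m         = there (select-⊆ s xs m)

  select-AllPairs : {R : A → A → Set} → ∀ s {xs} → AllPairs R xs → AllPairs R (select s xs)
  select-AllPairs []          r            = []
  select-AllPairs (true ∷ s)  []           = []
  select-AllPairs (false ∷ s) []           = []
  select-AllPairs (true ∷ s) {x ∷ xs} (a ∷ r) = All.tabulate (λ m → All.lookup a (select-⊆ s xs m)) ∷ select-AllPairs s r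
  select-AllPairs (false ∷ s) (_ ∷ r) = select-AllPairs s r

  ∪-map : (f g : A → Bool) → ∀ xs → map f xs ∪ map g xs ≡ map (λ x → f x ∨ g x) xs
  ∪-map f g []       = refl
  ∪-map f g (x ∷ xs) = cong (_ ∷_) (∪-map f g xs)

  ∑-b2n-map : (f : A → Bool) → ∀ xs → popcount (map f xs) ≡ ∑ (b2n ∘ f) xs
  ∑-b2n-map f xs = ∑-map b2n f xs

  ∑-weigh : ∀ (c : Row → ℕ) b w T → (∀ t → t ∈ T → c t ≤ 1) →
    ∑ (λ (v , t) → v * c t) (weigh b w T) ≤ ∑ proj₁ (weigh b w T)
  ∑-weigh c b w []      h = z≤n
  ∑-weigh c b w (t ∷ T) h with w % suc b
  ... | zero  = ∑-weigh c b (w / suc b) T (λ t m → h t (there m))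
  ... | suc v = +-mono-≤ (≤-trans (*-monoʳ-≤ (suc v) (h t (here refl))) (≤-reflexive (*-identityʳ (suc v))))
    (∑-weigh c b (w / suc b) T (λ t m → h t (there m)))

  -- Interchange of summation: the weight of t is paid once by every row that misses t.
  sum-of-costs : ∀ (F : Family) (rows : List Row) → ∑ (missed F) rows ≡ ∑ (λ (v , t) → v * ∑ (λ s → b2n (disjoint s t)) rows) F
  sum-of-costs F rows = trans (∑-swap (λ s (w , t) → if disjoint s t then w else 0) rows F)
    (∑-cong F (λ { (v , t) _ → trans (∑-cong rows (λ s _ → ite (disjoint s t) v)) (∑-*ˡ v (λ s → b2n (disjoint s t)) rows) }))
    where
    ite : ∀ b v → (if b then v else 0) ≡ v * b2n b
    ite false v = sym (*-zeroʳ v)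
    ite true  v = sym (*-identityʳ v)

  one-of : {f : A → ℕ} {μ b : ℕ} → ∀ xs → (∀ x → x ∈ xs → μ ≤ f x) → ∑ f xs ≤ b → ∀ {x} → x ∈ xs → f x ≤ b ∸ (length xs ∸ 1) * μ
  one-of {f = f} {μ} {b} (y ∷ xs) lo hi {x} m = m+n≤o⇒m≤o∸n (f x) (≤-trans (go (y ∷ xs) lo m) hi)
    where
    lower : ∀ ys → (∀ x → x ∈ ys → μ ≤ f x) → length ys * μ ≤ ∑ f ys
    lower []       l = z≤n
    lower (z ∷ ys) l = +-mono-≤ (l z (here refl)) (lower ys (λ x m → l x (there m)))
    go : ∀ ys → (∀ x → x ∈ ys → μ ≤ f x) → ∀ {x} → x ∈ ys → f x + (length ys ∸ 1) * μ ≤ ∑ f ys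
    go (z ∷ ys) l (here refl) = +-monoʳ-≤ (f z) (lower ys (λ x m → l x (there m)))
    go (z ∷ w ∷ ys) l {x} (there m) = begin
      f x + (μ + length ys * μ) ≡⟨ lem (f x) μ _ ⟩
      μ + (f x + length ys * μ) ≤⟨ +-mono-≤ (l z (here refl)) (go (w ∷ ys) (λ x m → l x (there m)) m) ⟩
      f z + ∑ f (w ∷ ys) ∎
      where
      open ≤-Reasoning
      lem : ∀ a b c → a + (b + c) ≡ b + (a + c)
      lem = solve-∀

  module Gluing {N : ℕ} (G : Graph N) (tf : TriangleFree G) where
    open OnGraph G
    open Bounds G tf

    tri : List V → Tri
    tri []       = []
    tri (x ∷ xs) = map (x ~_) xs ∷ tri xs

    edges-tri : ∀ xs → edges xs ≡ triEdges (tri xs)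
    edges-tri []       = refl
    edges-tri (x ∷ xs) = cong₂ _+_ (sym (∑-b2n-map (x ~_) xs)) (edges-tri xs)

    none-tri : ∀ xs → none (tri xs) ≡ map (λ _ → false) xs
    none-tri []       = refl
    none-tri (x ∷ xs) = cong (false ∷_) (none-tri xs)

    pickTri-tri : ∀ i x xs → pickTri i (map (x ~_) xs) (tri xs) ≡
      (map (proj₁ (pick i x xs) ~_) (proj₂ (pick i x xs)) , tri (proj₂ (pick i x xs)))
    pickTri-tri zero    x xs       = refl
    pickTri-tri (suc i) x []       = refl
    pickTri-tri (suc i) x (y ∷ ys) rewrite pick-map (x ~_) i y ys | pickTri-tri i y ys | ~-sym x (proj₁ (pick i y ys)) = refl

    permuteTri-tri : ∀ c xs → permuteTri c (tri xs) ≡ tri (permute c xs)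
    permuteTri-tri []      xs       = refl
    permuteTri-tri (i ∷ c) []       = refl
    permuteTri-tri (i ∷ c) (x ∷ xs) rewrite pickTri-tri i x xs =
      cong₂ _∷_ (permute-map _ c _) (permuteTri-tri c (proj₂ (pick i x xs)))

    isomorphic-sound : ∀ xs key R keyR → isomorphic (tri xs) key (R , keyR) ≡ true → ∃ λ ys → ys ↭ xs × tri ys ≡ R
    isomorphic-sound xs key R keyR h with matchFrom R keyR (tri xs) key
    ... | just c = permute c xs , permute-↭ c xs , trans (sym (permuteTri-tri c xs)) (eqTri-sound _ R h)

    row : List V → V → Row
    row xs x = map (x ~_) xs

    -- Two neighbours of x are nonadjacent, so choosing one never forbids another. The marks f are
    -- general because the induction adds the row of each chosen vertex to them.
    row-independent : ∀ x (f : V → Bool) xs → (∀ y → x ~ y ≡ true → f y ≡ false) →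
      independent (map f xs) (tri xs) (row xs x) ≡ true
    row-independent x f []       h = refl
    row-independent x f (y ∷ xs) h with x ~ y in e
    ... | false = row-independent x f xs h
    ... | true rewrite h y e | ∪-map f (y ~_) xs =
      row-independent x _ xs (λ z xz → cong₂ _∨_ (h z xz) (tf y x z (trans (~-sym y x) e) xz))

    select-independent : ∀ (f : V → Bool) xs t → independent (map f xs) (tri xs) t ≡ true →
      Indep (select t xs) × (∀ y → y ∈ select t xs → f y ≡ false) × length (select t xs) ≡ popcount t
    select-independent f []       []          h = [] , (λ _ ()) , refl
    select-independent f (x ∷ xs) (false ∷ t) h with f x
    ... | true  = select-independent f xs t h
    ... | false = select-independent f xs t h
    select-independent f (x ∷ xs) (true ∷ t)  h with f x in e
    ... | false rewrite ∪-map f (x ~_) xs with select-independent (λ y → f y ∨ x ~ y) xs t h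
    ... | i , a , l = All.tabulate (λ {y} m → proj₂ (∨-false {f y} (a y m))) ∷ i ,
      (λ { y (here refl) → e ; y (there m) → proj₁ (∨-false {f y} (a y m)) }) , cong suc l

    disjoint-select : ∀ x xs t → disjoint (row xs x) t ≡ true → ∀ {y} → y ∈ select t xs → x ~ y ≡ false
    disjoint-select x (z ∷ xs) (false ∷ t) h m with x ~ z
    ... | true  = disjoint-select x xs t h m
    ... | false = disjoint-select x xs t h m
    disjoint-select x (z ∷ xs) (true ∷ t) h m with x ~ z in e
    disjoint-select x (z ∷ xs) (true ∷ t) h (here refl) | false = e
    disjoint-select x (z ∷ xs) (true ∷ t) h (there m)   | false = disjoint-select x xs t h m

    build-tri : ∀ v xs N → (∀ {x y} → x ∈ N → y ∈ N → x ~ y ≡ false) → (∀ {x} → x ∈ N → x ~ v ≡ true) →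
      (∀ {x} → x ∈ xs → v ~ x ≡ false) → tri (N ++ v ∷ xs) ≡ build (tri xs) (map (row xs) N)
    build-tri v xs [] nn nv vx = cong (_∷ tri xs) (trans (row-none xs vx) (sym (none-tri xs)))
      where
      row-none : ∀ ys → (∀ {x} → x ∈ ys → v ~ x ≡ false) → row ys v ≡ none ys
      row-none []       h = refl
      row-none (y ∷ ys) h = cong₂ _∷_ (h (here refl)) (row-none ys (h ∘ there))
    build-tri v xs (x ∷ N) nn nv vx = cong₂ _∷_
      (trans (map-++ (x ~_) N (v ∷ xs)) (cong₂ _++_ (lem N (λ m → nn (here refl) (there m))) (cong (_∷ row xs x) (nv (here refl)))))
      (build-tri v xs N (λ a b → nn (there a) (there b)) (nv ∘ there) vx)
      where
      lem : ∀ M → (∀ {y} → y ∈ M → x ~ y ≡ false) → map (x ~_) M ≡ none (map (row xs) M)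
      lem []      h = refl
      lem (y ∷ M) h = cong₂ _∷_ (h (here refl)) (lem M (h ∘ there))

    -- Isomorphism with a listed graph is expressed by an ordering of the vertices whose upper
    -- triangle is literally the listed one.
    Classified : ℕ → ℕ → ℕ → List Tri → Set
    Classified k n E Rs = ∀ L → Distinct L → length L ≡ n → α≤ k L → edges L ≤ E →
      ∃ λ xs → xs ↭ L × tri xs ∈ Rs

    module _ {k L v xs} (dL : Distinct L) (v∈ : v ∈ L) (α : α≤ k L) (π : xs ↭ far L v) where

      private
        K  = tri xs
        Nb = nbrs L v
        rows = map (row xs) Nb

        L↭ : L ↭ Nb ++ v ∷ xs
        L↭ = ↭-trans (star-split dL v∈) (↭-trans (↭-sym (shift v Nb (far L v))) (++⁺ˡ Nb (prep v (↭-sym π))))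

        nonadj : ∀ {x y} → x ∈ Nb → y ∈ Nb → x ~ y ≡ false
        nonadj = nbrs-nonadjacent tf L v _ _

        Indep-nonadj : ∀ I → (∀ {x y} → x ∈ I → y ∈ I → x ~ y ≡ false) → Indep I
        Indep-nonadj []      h = []
        Indep-nonadj (x ∷ I) h = All.tabulate (λ m → h (here refl) (there m)) ∷ Indep-nonadj I (λ a b → h (there a) (there b))

      ∑rows : (f : Row → ℕ) → ∑ f rows ≡ ∑ (f ∘ row xs) Nb
      ∑rows f = ∑-map f (row xs) Nb

      -- The set t and the neighbours of v whose rows miss t form one independent set of L, since
      -- the neighbours of v are pairwise nonadjacent.
      cap : ∀ t → independent (none K) K t ≡ true → popcount t + ∑ (λ s → b2n (disjoint s t)) rows ≤ k
      cap t it rewrite none-tri xs with select-independent (λ _ → false) xs t it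
      ... | i , _ , l = subst (_≤ k) len (α I dI iI I⊆)
        where
        p : V → Bool
        p x = disjoint (row xs x) t
        M = filter (λ x → p x Bool.≟ true) Nb
        I = select t xs ++ M
        M⁻ : ∀ {x} → x ∈ M → x ∈ Nb × p x ≡ true
        M⁻ = ∈-filter⁻ (λ x → p x Bool.≟ true)
        s∈ : ∀ {y} → y ∈ select t xs → y ∈ far L v
        s∈ m = ∈-resp-↭ π (select-⊆ t xs m)
        len : length I ≡ popcount t + ∑ (λ s → b2n (disjoint s t)) rows
        len = trans (length-++ (select t xs)) (cong₂ _+_ l (trans (length-filter p Nb) (sym (∑rows _))))
        dI : Distinct I
        dI = AllPairsₚ.++⁺ (select-AllPairs t (Distinct-↭ (↭-sym π) (Distinct-far v dL)))
          (AllPairsₚ.filter⁺ _ (Distinct-nbrs v dL))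
          (All.tabulate (λ {y} my → All.tabulate (λ {x} mx e → true≢false (proj₂ (∈-nbrs⁻ L v (proj₁ (M⁻ mx))))
            (subst (λ z → v ~ z ≡ false) e (proj₁ (proj₂ (∈-far⁻ L v (s∈ my))))))))
        iI : Indep I
        iI = AllPairsₚ.++⁺ i (Indep-nonadj M (λ a b → nonadj (proj₁ (M⁻ a)) (proj₁ (M⁻ b))))
          (All.tabulate (λ {y} my → All.tabulate (λ {x} mx → trans (~-sym y x) (disjoint-select x xs t (proj₂ (M⁻ mx)) my))))
        I⊆ : I ⊆ L
        I⊆ m with ∈-++⁻ (select t xs) m
        ... | inj₁ a = proj₁ (∈-far⁻ L v (s∈ a))
        ... | inj₂ b = proj₁ (∈-nbrs⁻ L v (proj₁ (M⁻ b)))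

      Z-rows : Z L v ≡ deg L v + ∑ popcount rows
      Z-rows = begin
        ∑ (deg L) Nb ≡⟨ ∑-cong Nb (λ x m → trans (∑-↭ _ L↭) (trans (∑-++ _ Nb (v ∷ xs))
            (cong₂ _+_ (∑-zero Nb (λ y m′ → cong b2n (nonadj m m′)))
               (cong₂ _+_ (cong b2n (trans (~-sym x v) (proj₂ (∈-nbrs⁻ L v m)))) (sym (∑-b2n-map (x ~_) xs)))))) ⟩
        ∑ (λ x → 1 + popcount (row xs x)) Nb ≡⟨ ∑-+ (λ _ → 1) _ Nb ⟩
        ∑ (λ _ → 1) Nb + ∑ (popcount ∘ row xs) Nb ≡⟨ cong₂ _+_ (trans (∑-const 1 Nb) (trans (*-identityʳ _) (length-nbrs L v))) (sym (∑rows popcount)) ⟩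
        deg L v + ∑ popcount rows ∎
        where open ≡-Reasoning

      edges-rows : edges L ≡ ∑ popcount rows + (triEdges K + deg L v)
      edges-rows = trans (star-edges tf dL v∈) (trans (cong₂ _+_ Z-rows (trans (edges-↭ (↭-sym π)) (edges-tri xs))) (lem (deg L v) _ _))
        where
        lem : ∀ a b c → a + b + c ≡ b + (c + a)
        lem = solve-∀

      module _ (d E : ℕ) (reps : List Tri) (deg≡ : deg L v ≡ d) (e≤ : edges L ≤ E) (lam mu radix weights : ℕ) where
        private
          module Gl = Glue k d E reps
          budget  = Gl.budget K
          maximal = Gl.maximal K
          family  = weigh radix weights maximal
          total   = Gl.total K lam family
          limit   = Gl.limit mu total
          cheap   = cheapSets lam limit (none K) K family
          items   = Gl.candidates K lam mu maximal family total

        popcount≤budget : ∑ popcount rows ≤ budget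
        popcount≤budget = m+n≤o⇒m≤o∸n _ (subst (_≤ E) (trans edges-rows (cong (λ z → ∑ popcount rows + (triEdges K + z)) deg≡)) e≤)

        rows∈ : ∀ {s} → s ∈ rows → independent (none K) K s ≡ true
        rows∈ m with ∈-map⁻ (row xs) m
        ... | x , _ , refl rewrite none-tri xs = row-independent x (λ _ → false) xs (λ _ _ → refl)

        length-rows : length rows ≡ d
        length-rows = trans (length-map (row xs) Nb) (trans (length-nbrs L v) deg≡)

        -- The actual rows of L satisfy every constraint used for pruning, so `search` lists them up
        -- to order. The leaf test cannot have succeeded by a violation, which would contradict
        -- `cap`; hence it found an isomorphism.
        glue-sound : Gl.glueOK K lam mu radix weights ≡ true → ∃ λ ys → ys ↭ L × tri ys ∈ reps
        glue-sound ok with ∧-true {all (λ t → independent (none K) K t ∧ (suc (popcount t) ≡ᵇ k)) maximal} ok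
        ... | okT , ok′ with ∧-true {all (λ q → mu ≤ᵇ cost q) items} ok′
        ... | okC , okS = finish
          where
          -- Here |t| = k - 1, so `cap` leaves room for a single row.
          maximal-cap : ∀ t → t ∈ maximal → ∑ (λ s → b2n (disjoint s t)) rows ≤ 1
          maximal-cap t m with ∧-true {independent (none K) K t} (all-∈ _ maximal okT m)
          ... | it , e = +-cancelˡ-≤ (popcount t) _ _ (≤-trans (cap t it)
            (≤-reflexive (trans (sym (≡ᵇ⇒≡ (suc (popcount t)) k (subst T (sym e) _))) (+-comm 1 (popcount t)))))

          -- Weak duality: the constraints are added up with the multipliers of the certificate.
          total-cost : ∑ (price lam family) rows ≤ total
          total-cost = begin
            ∑ (λ s → lam * popcount s + missed family s) rows ≡⟨ ∑-+ _ _ rows ⟩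
            ∑ (λ s → lam * popcount s) rows + ∑ (missed family) rows ≡⟨ cong₂ _+_ (∑-*ˡ lam popcount rows) (sum-of-costs family rows) ⟩
            lam * ∑ popcount rows + ∑ (λ (v , t) → v * ∑ (λ s → b2n (disjoint s t)) rows) family
              ≤⟨ +-mono-≤ (*-monoʳ-≤ lam popcount≤budget) (∑-weigh _ radix weights maximal maximal-cap) ⟩
            total ∎
            where open ≤-Reasoning

          cheap∈ : ∀ {s} → s ∈ rows → price lam family s ≤ limit → toItem lam family maximal s ∈ items
          cheap∈ m h = sort-∈ _ (∈-map⁺ (toItem lam family maximal) (cheapSets-complete lam limit (none K) K family _ (rows∈ m) h))

          -- A cheaper row would have price at most mu - 1, hence would be among the items and fail
          -- the test.
          mu≤ : ∀ s → s ∈ rows → mu ≤ price lam family s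
          mu≤ s m with mu ≤? price lam family s
          ... | yes p = p
          ... | no ¬p = ≤ᵇ-sound (all-∈ (λ q → mu ≤ᵇ cost q) _ okC
            (cheap∈ m (≤-trans (∸-monoˡ-≤ 1 (≰⇒> ¬p)) (m≤m⊔n (mu ∸ 1) _))))

          price≤ : ∀ {s} → s ∈ rows → price lam family s ≤ limit
          price≤ {s} m = ≤-trans (subst (λ z → price lam family s ≤ total ∸ (z ∸ 1) * mu) length-rows (one-of rows mu≤ total-cost m)) (m≤n⊔m (mu ∸ 1) _)

          pairs : ∀ (S : List Row) → (∀ t → t ∈ maximal → ∑ (λ s → b2n (disjoint s t)) S ≤ 1) → AllPairs (Compat maximal) S
          pairs []      h = []
          pairs (s ∷ S) h = All.tabulate (λ {s′} m t t∈ e e′ → two t (h t t∈) e m e′) ∷ pairs S (λ t m → m+n≤o⇒n≤o (b2n (disjoint s t)) (h t m))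
            where
            member : ∀ t {s′} S → s′ ∈ S → disjoint s′ t ≡ true → 1 ≤ ∑ (λ s → b2n (disjoint s t)) S
            member t (s ∷ S) (here refl) e rewrite e = s≤s z≤n
            member t (s ∷ S) (there m) e = ≤-trans (member t S m e) (m≤n+m _ (b2n (disjoint s t)))
            two : ∀ t {s′} → b2n (disjoint s t) + ∑ (λ s → b2n (disjoint s t)) S ≤ 1 → disjoint s t ≡ true → s′ ∈ S → disjoint s′ t ≡ true → ⊥
            two t h e m e′ rewrite e = <⇒≱ (member t S m e′) (s≤s⁻¹ h)

          leaf : ∀ rs {r} → Gl.leavesOK K (Gl.smallSets K) (Gl.testSets K) Gl.keyedReps rs ≡ true → r ∈ rs →
            Gl.leafOK K (Gl.smallSets K) (Gl.testSets K) Gl.keyedReps r (build K r) ≡ true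
          leaf (r ∷ rs) h (here refl) = proj₁ (∧-true h)
          leaf (r ∷ rs) h (there m)   = leaf rs (proj₂ (∧-true {Gl.leafOK K (Gl.smallSets K) (Gl.testSets K) Gl.keyedReps r (build K r)} h)) m

          no-violation : ∀ {M} → Nb ↭ M → ∀ Ts → any (violates k K (map (row xs) M)) Ts ≡ true → ⊥
          no-violation {M} πM Ts viol with any-∃ _ Ts viol
          ... | t , _ , bad with ∧-true {k <ᵇ popcount t + ∑ (λ s → b2n (disjoint s t)) (map (row xs) M)} bad
          ... | lt , it = <⇒≱ (<ᵇ-sound lt) (≤-trans (≤-reflexive (cong (popcount t +_) (∑-↭ _ (map⁺ (row xs) (↭-sym πM))))) (cap t it))

          finish : ∃ λ ys → ys ↭ L × tri ys ∈ reps
          finish with search-complete mu d total budget items (map (toItem lam family maximal) rows) (sort-sorted (map (toItem lam family maximal) cheap))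
              (trans (length-map _ rows) length-rows)
              (Allₚ.map⁺ (All.tabulate (λ m → cheap∈ m (price≤ m))))
              (AllPairsₚ.map⁺ (AllPairs.map (λ {s} {s′} → misses-disjoint maximal s s′) (pairs rows maximal-cap)))
              (Allₚ.map⁺ (All.tabulate (λ {s} m → mu≤ s m)))
              (≤-trans (≤-reflexive (∑-map cost (toItem lam family maximal) rows)) total-cost)
              (≤-trans (≤-reflexive (∑-map size (toItem lam family maximal) rows)) popcount≤budget)
          ... | r , r∈ , πr with ↭-map-inv (row xs) (subst (_↭ r) (trans (sym (map-∘ rows)) (map-id rows)) πr)
            where
            map-id : ∀ (S : List Row) → map (λ s → s) S ≡ S
            map-id []      = refl
            map-id (s ∷ S) = cong (s ∷_) (map-id S)
          ... | M , refl , πM with ∨-true {any (violates k K (map (row xs) M)) (Gl.uncovered K (map (row xs) M) (Gl.smallSets K))} (leaf _ okS r∈)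
          ... | inj₁ viol = ⊥-elim (no-violation πM (Gl.uncovered K (map (row xs) M) (Gl.smallSets K)) viol)
          ... | inj₂ ok″ with ∨-true {any (isomorphic (build K (map (row xs) M)) (walks (build K (map (row xs) M)))) Gl.keyedReps} ok″
          ... | inj₂ viol = ⊥-elim (no-violation πM (Gl.testSets K) viol)
          finish | r , r∈ , πr | M , refl , πM | inj₂ ok″ | inj₁ iso with any-∃ _ Gl.keyedReps iso
          ... | (R , keyR) , m , eq with ∈-map⁻ (λ R → R , walks R) m
          ... | _ , R∈ , refl with isomorphic-sound (M ++ v ∷ xs) (walks (build K (map (row xs) M))) R keyR (trans (cong (λ F → isomorphic F (walks (build K (map (row xs) M))) (R , keyR))
                (build-tri v xs M (λ a b → nonadj (∈-resp-↭ (↭-sym πM) a) (∈-resp-↭ (↭-sym πM) b))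
                  (λ {x} a → trans (~-sym x v) (proj₂ (∈-nbrs⁻ L v (∈-resp-↭ (↭-sym πM) a))))
                  (λ a → proj₁ (proj₂ (∈-far⁻ L v (∈-resp-↭ π a)))))) eq)
          ... | ys , πy , e = ys , ↭-trans πy (↭-trans (++⁺ʳ (v ∷ xs) (↭-sym πM)) (↭-sym L↭)) , subst (_∈ reps) (sym e) R∈

  -- Classification of small graphs

  exceptional : ℕ → ℕ → List (ℕ × ℕ) → Bool
  exceptional n e = any (λ (n′ , e′) → (n ≡ᵇ n′) ∧ (e ≤ᵇ e′))

  rowOK : ℕ → List ℕ → ℕ → List (ℕ × ℕ) → List ℕ → Bool
  rowOK k row n exc []       = true
  rowOK k row n exc (e ∷ es) = (exceptional n e exc ∨ rowValue k row n e) ∧ rowOK k row (suc n) exc es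

  -- A record, so that its parameters are compared without evaluating the check.
  record GlueChecked (k d E : ℕ) (reps Ks : List Tri) (cs : List Cert) : Set where
    constructor checked
    field
      check : Glue.certsOK k d E reps Ks cs ≡ true

  module Classifying {N : ℕ} (G : Graph N) (tf : TriangleFree G) where
    open OnGraph G
    open Bounds G tf
    open Gluing G tf

    Classified-within : ∀ {k n E Rs} E′ → E′ ≤ E → Classified k n E Rs → Classified k n E′ (within E′ Rs)
    Classified-within E′ E′≤E C L d l α e with C L d l α (≤-trans e E′≤E)
    ... | xs , π , m = xs , π , ∈-filterᵇ⁺ _ m (≤ᵇ-true (subst (_≤ E′) (trans (edges-↭ (↭-sym π)) (edges-tri xs)) e))

    Classified-empty : ∀ {k n E} → Classified k n E [] → MinEdges k n (suc E)
    Classified-empty {E = E} C L d l α with suc E ≤? edges L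
    ... | yes p = p
    ... | no ¬p with C L d l α (s≤s⁻¹ (≰⇒> ¬p))
    ... | _ , _ , ()

    -- The edge bound E is beyond what degrees at most k permit, so an empty classification excludes
    -- all graphs and any value e is a valid minimum.
    Classified-none : ∀ {k n E e} → ⌊ n * k /2⌋ ≤ E → Classified k n E [] → MinEdges k n e
    Classified-none le C L d refl α with C L d refl α (≤-trans (edges≤ d α) le)
    ... | _ , _ , ()

    Classified-min : ∀ {k n E Rs} e → e ≤ suc E → all (λ K → e ≤ᵇ triEdges K) Rs ≡ true → Classified k n E Rs → MinEdges k n e
    Classified-min {E = E} {Rs} e e≤ h C L d l α with suc E ≤? edges L
    ... | yes p = ≤-trans e≤ p
    ... | no ¬p with C L d l α (s≤s⁻¹ (≰⇒> ¬p))
    ... | xs , π , m = subst (e ≤_) (sym (trans (edges-↭ (↭-sym π)) (edges-tri xs))) (≤ᵇ-sound (all-∈ _ Rs h m))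

    -- A step (d , E′) of the case distinction: some v of degree d has edges (far L v) ≤ E′.
    data Steps (k n E : ℕ) (reps : List Tri) : List (ℕ × ℕ) → Set where
      []   : Steps k n E reps []
      step : ∀ {d E′ Ks s} (cs : List Cert) → Classified k (n ∸ suc d) E′ Ks →
             GlueChecked (suc k) d E reps Ks cs → Steps k n E reps s → Steps k n E reps ((d , E′) ∷ s)

    certsOK-∈ : ∀ k d E reps Ks cs → Glue.certsOK k d E reps Ks cs ≡ true → ∀ {K} → K ∈ Ks →
      ∃ λ c → Glue.certOK k d E reps K c ≡ true
    certsOK-∈ k d E reps (K ∷ Ks) (c ∷ cs) h (here refl) = c , proj₁ (∧-true {Glue.certOK k d E reps K c} h)
    certsOK-∈ k d E reps (K ∷ Ks) (c ∷ cs) h (there m)   = certsOK-∈ k d E reps Ks cs (proj₂ (∧-true {Glue.certOK k d E reps K c} h)) m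

    -- The linear program provides a vertex whose far graph lies below its threshold. At a degree
    -- listed in s the far graph is one of the classified K and is glued; at any other degree it
    -- would have fewer edges than the row permits.
    classify : ∀ {k n E reps} row s → RowValid k row → slopeExists (suc k) (thresholds s row n) n E ≡ true →
      Steps k n E reps s → Classified (suc k) n E reps
    classify {k} {n} {E} {reps} row s R sl st L dL refl α e≤ with low-vertex (suc k) _ n E L sl dL refl α e≤
    ... | v , v∈ , lt = go s st lt
      where
      go : ∀ s → Steps k n E reps s → edges (far L v) < thresholds s row n (deg L v) → ∃ λ xs → xs ↭ L × tri xs ∈ reps
      go [] [] lt = ⊥-elim (<⇒≱ lt (R _ (far L v) (Distinct-far v dL) (length-far≡ dL v∈) (far-α v∈ α)))
      go ((d , E′) ∷ s) (step {Ks = Ks} cs C (checked ok) st) lt with deg L v ≡ᵇ d in eq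
      ... | false = go s st lt
      ... | true with ≡ᵇ⇒≡ (deg L v) d (subst T (sym eq) _)
      ... | refl with C (far L v) (Distinct-far v dL) (length-far≡ dL v∈) (far-α v∈ α) (s≤s⁻¹ lt)
      ... | xs , π , K∈ with certsOK-∈ (suc k) d E reps Ks cs ok K∈
      ... | cert lam mu b w , cok with ∨-true {E <ᵇ triEdges (tri xs) + d} cok
      ... | inj₁ over = ⊥-elim (<⇒≱ (<ᵇ-sound over) (m+n≤o⇒n≤o (∑ popcount (map (Gluing.row G tf xs) (nbrs L v))) (subst (_≤ E) (edges-rows dL v∈ α π) e≤)))
      ... | inj₂ g = glue-sound dL v∈ α π d E reps refl e≤ lam mu b w g

    classified-empty-graph : Classified 0 0 0 ([] ∷ [])
    classified-empty-graph [] d l α e = [] , refl , here refl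

    -- The entries in exc are those that come from a classification or a special argument; all
    -- others follow from the preceding row by the linear program.
    row-valid : ∀ {k} row exc row′ → RowValid k row → rowOK k row 0 exc row′ ≡ true →
      All (λ (n , e) → MinEdges (suc k) n e) exc → RowValid (suc k) row′
    row-valid {k} row exc row′ R ok ex = go row′ 0 ok
      where
      go : ∀ es m → rowOK k row m exc es ≡ true → ∀ i → MinEdges (suc k) (m + i) (nth es i)
      go []       m h i       L d l α = z≤n
      go (e ∷ es) m h (suc i) rewrite +-suc m i = go es (suc m) (proj₂ (∧-true {exceptional m e exc ∨ rowValue k row m e} h)) i
      go (e ∷ es) m h zero    rewrite +-identityʳ m
        with ∨-true {exceptional m e exc} (proj₁ (∧-true {exceptional m e exc ∨ rowValue k row m e} h))
      ... | inj₂ v = rowValue-sound k row R m e v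
      ... | inj₁ x with any-∃ _ exc x
      ... | (n , e′) , mem , eq with ∧-true {m ≡ᵇ n} eq
      ... | eqn , le with ≡ᵇ⇒≡ m n (subst T (sym eqn) _)
      ... | refl = λ L d l α → ≤-trans (≤ᵇ-sound le) (All.lookup ex mem L d l α)

  -- R(3,8) ≤ 29

  module _ {N : ℕ} (G : Graph N) (tf : TriangleFree G) where
    open OnGraph G
    open Bounds G tf

    RowMin : Set
    RowMin = MinEdges 6 22 60 × (∀ n → 23 ≤ n → n ≤ 28 → MinEdges 6 n 1000)

    -- Degrees at most k allow only 500 edges, which is why 1000 can stand for nonexistence.
    impossible : ∀ {k n} → MinEdges k n 1000 → n * k ≤ 1000 → ∀ L → Distinct L → length L ≡ n → α≤ k L → ⊥
    impossible {k} min nk L d refl α = <⇒≱ (≤-trans (s≤s (≤-trans (edges≤ d α) (⌊n/2⌋-mono nk))) (m≤m+n 501 499)) (min L d refl α)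

    -- Such a graph has degrees 6 and 7 only, and by parity a vertex w of degree 6. The edge count of
    -- far L w forces a neighbour w′ of degree 6, and then the 12 edge stars at nbrs w and nbrs w′ are too heavy.
    no-29 : RowMin → ∀ L → Distinct L → length L ≡ 29 → α≤ 7 L → ⊥
    no-29 (min60 , none) L d l α = main
      where
      far-length : ∀ {v} → v ∈ L → length (far L v) ≡ 28 ∸ deg L v
      far-length {v} m = trans (length-far≡ d m) (cong (_∸ suc (deg L v)) l)
      -- A vertex of degree at most 5 has a far graph on 23 to 28 vertices without 7 independent
      -- ones.
      six≤ : ∀ v → v ∈ L → 6 ≤ deg L v
      six≤ v m with 6 ≤? deg L v
      ... | yes p = p
      ... | no ¬p = ⊥-elim (impossible (none (28 ∸ deg L v) (∸-monoʳ-≤ 28 (s≤s⁻¹ (≰⇒> ¬p))) (m∸n≤m 28 (deg L v)))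
        (≤-trans (*-monoˡ-≤ 6 (m∸n≤m 28 (deg L v))) (m≤m+n 168 832)) (far L v) (Distinct-far v d) (far-length m) (far-α m α))
      ≤7 : ∀ v → deg L v ≤ 7
      ≤7 v = deg≤α tf d α
      odd : ∀ e → 2 * e ≡ 203 → ⊥
      odd e eq with trans (sym (m*n%n≡0 e 2)) (cong (_% 2) (trans (*-comm e 2) eq))
      ... | ()
      ∑deg : ∑ (deg L) L ≡ 2 * edges L
      ∑deg = handshake L
      heavy : ∀ w → w ∈ L → deg L w ≡ 6 → Z L w + 60 ≤ edges L
      heavy w m e = subst (Z L w + 60 ≤_) (sym (star-edges tf d m)) (+-monoʳ-≤ (Z L w)
        (min60 (far L w) (Distinct-far w d) (trans (far-length m) (cong (28 ∸_) e)) (far-α m α)))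
      exists6 : ∃ λ w → w ∈ L × deg L w ≡ 6
      exists6 with any? (λ v → deg L v ≟ 6) L
      ... | yes six = find six
      ... | no ¬six = ⊥-elim (odd (edges L) (trans (sym ∑deg) (trans (∑-cong L all7) (trans (∑-const 7 L) (cong (_* 7) l)))))
        where
        all7 : ∀ v → v ∈ L → deg L v ≡ 7
        all7 v m with m≤n⇒m<n∨m≡n (six≤ v m)
        ... | inj₁ lt = ≤-antisym (≤7 v) lt
        ... | inj₂ e  = ⊥-elim (¬six (lose m (sym e)))
      twice≤203 : 2 * edges L ≤ 203
      twice≤203 = subst (_≤ 203) ∑deg (≤-trans (∑-mono L (λ v _ → ≤7 v)) (≤-reflexive (trans (∑-const 7 L) (cong (_* 7) l))))
      w = proj₁ exists6
      w∈ = proj₁ (proj₂ exists6)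
      w6 = proj₂ (proj₂ exists6)
      neighbour6 : ∃ λ w′ → w′ ∈ nbrs L w × deg L w′ ≡ 6
      neighbour6 with any? (λ v → deg L v ≟ 6) (nbrs L w)
      ... | yes six = find six
      -- Six neighbours of degree 7 give at least 42 + 60 = 102 edges, but the degree sum is at most
      -- 29 * 7 = 203.
      ... | no ¬six = ⊥-elim (<⇒≱ (*-monoʳ-≤ 2 (subst (λ z → z + 60 ≤ edges L) Z42 (heavy w w∈ w6))) twice≤203)
        where
        Z42 : Z L w ≡ 42
        Z42 = trans (∑-cong (nbrs L w) all7) (trans (∑-const 7 (nbrs L w)) (cong (_* 7) (trans (length-nbrs L w) w6)))
          where
          all7 : ∀ v → v ∈ nbrs L w → deg L v ≡ 7
          all7 v m with m≤n⇒m<n∨m≡n (six≤ v (proj₁ (∈-nbrs⁻ L w m)))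
          ... | inj₁ lt = ≤-antisym (≤7 v) lt
          ... | inj₂ e  = ⊥-elim (¬six (lose m (sym e)))
      w′ = proj₁ neighbour6
      w′∈ = proj₁ (∈-nbrs⁻ L w (proj₁ (proj₂ neighbour6)))
      ww′ = proj₂ (∈-nbrs⁻ L w (proj₁ (proj₂ neighbour6)))
      w′6 = proj₂ (proj₂ neighbour6)
      -- As w and w′ are adjacent, their neighbourhoods are disjoint; the other 17 vertices have
      -- degree at most 7. Summed, twice the edge number is at most `Z L w` + `Z L w′` + 119,
      -- against at least + 120 from `heavy`. The term 7 * 12 = 84 is added on both sides to avoid
      -- subtraction.
      pointwise : ∀ x → deg L x + (7 * b2n (w ~ x) + 7 * b2n (w′ ~ x)) ≤ b2n (w ~ x) * deg L x + b2n (w′ ~ x) * deg L x + 7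
      pointwise x with w ~ x in e | w′ ~ x in e′
      ... | true  | true  = ⊥-elim (true≢false e (tf w w′ x ww′ e′))
      ... | true  | false = ≤-reflexive (lem (deg L x))
        where
        lem : ∀ a → a + 7 ≡ a + 0 + 0 + 7
        lem = solve-∀
      ... | false | true  = ≤-reflexive (lem (deg L x))
        where
        lem : ∀ a → a + 7 ≡ a + 0 + 7
        lem = solve-∀
      ... | false | false = ≤-trans (≤-reflexive (+-identityʳ (deg L x))) (≤7 x)
      summed : 2 * edges L + 84 ≤ Z L w + Z L w′ + 203
      summed = begin
        2 * edges L + 84
          ≡⟨ cong₂ _+_ (sym ∑deg) (sym (cong₂ (λ a b → 7 * a + 7 * b) w6 w′6)) ⟩
        ∑ (deg L) L + (7 * deg L w + 7 * deg L w′)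
          ≡⟨ cong (∑ (deg L) L +_) (sym (trans (∑-+ _ _ L) (cong₂ _+_ (∑-*ˡ 7 _ L) (∑-*ˡ 7 _ L)))) ⟩
        ∑ (deg L) L + ∑ (λ x → 7 * b2n (w ~ x) + 7 * b2n (w′ ~ x)) L ≡⟨ ∑-+ _ _ L ⟨
        ∑ (λ x → deg L x + (7 * b2n (w ~ x) + 7 * b2n (w′ ~ x))) L ≤⟨ ∑-mono L (λ x _ → pointwise x) ⟩
        ∑ (λ x → b2n (w ~ x) * deg L x + b2n (w′ ~ x) * deg L x + 7) L ≡⟨ ∑-+ _ _ L ⟩
        ∑ (λ x → b2n (w ~ x) * deg L x + b2n (w′ ~ x) * deg L x) L + ∑ (λ _ → 7) L
          ≡⟨ cong₂ _+_ (trans (∑-+ _ _ L) (sym (cong₂ _+_ (∑-filter (w ~_) (deg L) L) (∑-filter (w′ ~_) (deg L) L))))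
               (trans (∑-const 7 L) (cong (_* 7) l)) ⟩
        Z L w + Z L w′ + 203 ∎
        where open ≤-Reasoning
      main : ⊥
      main = <⇒≱ {203} {204} ≤-refl (+-cancelˡ-≤ (Z L w + Z L w′) _ _ (begin
        Z L w + Z L w′ + 204 ≡⟨ lem (Z L w) (Z L w′) ⟩
        (Z L w + 60) + (Z L w′ + 60) + 84 ≤⟨ +-monoˡ-≤ 84 (+-mono-≤ (heavy w w∈ w6) (heavy w′ w′∈ w′6)) ⟩
        edges L + edges L + 84 ≡⟨ cong (λ z → edges L + z + 84) (sym (+-identityʳ (edges L))) ⟩
        2 * edges L + 84 ≤⟨ summed ⟩
        Z L w + Z L w′ + 203 ∎))
        where
        open ≤-Reasoning
        lem : ∀ a b → a + b + 204 ≡ (a + 60) + (b + 60) + 84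
        lem = solve-∀

  -- Certificates

  -- rowk lists lower bounds for e(k, n), n = 0, 1, 2, …, where 1000 stands for nonexistence. The list
  -- graphs-k-n contains all graphs counted by e(k, n) with at most E edges, for the E of class-k-n below;
  -- the weights in certs-k-n-d come from an optimal solution of the linear program for v of degree d.
  row0 : List ℕ
  row0 = 0 ∷ 1000 ∷ 1000 ∷ 1000 ∷ 1000 ∷ 1000 ∷ 1000 ∷ 1000 ∷ 1000 ∷ 1000 ∷ 1000 ∷ 1000 ∷ 1000 ∷ 1000 ∷ 1000 ∷ 1000 ∷ 1000 ∷ 1000 ∷ 1000 ∷ 1000 ∷ 1000 ∷ 1000 ∷ 1000 ∷ 1000 ∷ 1000 ∷ 1000 ∷ 1000 ∷ 1000 ∷ 1000 ∷ 1000 ∷ 1000 ∷ 1000 ∷ 1000 ∷ 1000 ∷ 1000 ∷ []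

  row1 : List ℕ
  row1 = 0 ∷ 0 ∷ 1 ∷ 1000 ∷ 1000 ∷ 1000 ∷ 1000 ∷ 1000 ∷ 1000 ∷ 1000 ∷ 1000 ∷ 1000 ∷ 1000 ∷ 1000 ∷ 1000 ∷ 1000 ∷ 1000 ∷ 1000 ∷ 1000 ∷ 1000 ∷ 1000 ∷ 1000 ∷ 1000 ∷ 1000 ∷ 1000 ∷ 1000 ∷ 1000 ∷ 1000 ∷ 1000 ∷ 1000 ∷ 1000 ∷ 1000 ∷ 1000 ∷ 1000 ∷ 1000 ∷ 1000 ∷ []

  row2 : List ℕ
  row2 = 0 ∷ 0 ∷ 0 ∷ 1 ∷ 2 ∷ 5 ∷ 1000 ∷ 1000 ∷ 1000 ∷ 1000 ∷ 1000 ∷ 1000 ∷ 1000 ∷ 1000 ∷ 1000 ∷ 1000 ∷ 1000 ∷ 1000 ∷ 1000 ∷ 1000 ∷ 1000 ∷ 1000 ∷ 1000 ∷ 1000 ∷ 1000 ∷ 1000 ∷ 1000 ∷ 1000 ∷ 1000 ∷ 1000 ∷ 1000 ∷ 1000 ∷ 1000 ∷ 1000 ∷ 1000 ∷ 1000 ∷ 1000 ∷ []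

  row3 : List ℕ
  row3 = 0 ∷ 0 ∷ 0 ∷ 0 ∷ 1 ∷ 2 ∷ 3 ∷ 6 ∷ 10 ∷ 1000 ∷ 1000 ∷ 1000 ∷ 1000 ∷ 1000 ∷ 1000 ∷ 1000 ∷ 1000 ∷ 1000 ∷ 1000 ∷ 1000 ∷ 1000 ∷ 1000 ∷ 1000 ∷ 1000 ∷ 1000 ∷ 1000 ∷ 1000 ∷ 1000 ∷ 1000 ∷ 1000 ∷ 1000 ∷ 1000 ∷ 1000 ∷ 1000 ∷ 1000 ∷ 1000 ∷ 1000 ∷ 1000 ∷ []

  row4 : List ℕ
  row4 = 0 ∷ 0 ∷ 0 ∷ 0 ∷ 0 ∷ 1 ∷ 2 ∷ 3 ∷ 4 ∷ 7 ∷ 10 ∷ 15 ∷ 20 ∷ 26 ∷ 1000 ∷ 1000 ∷ 1000 ∷ 1000 ∷ 1000 ∷ 1000 ∷ 1000 ∷ 1000 ∷ 1000 ∷ 1000 ∷ 1000 ∷ 1000 ∷ 1000 ∷ 1000 ∷ 1000 ∷ 1000 ∷ 1000 ∷ 1000 ∷ 1000 ∷ 1000 ∷ 1000 ∷ 1000 ∷ 1000 ∷ 1000 ∷ 1000 ∷ []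

  row5 : List ℕ
  row5 = 0 ∷ 0 ∷ 0 ∷ 0 ∷ 0 ∷ 0 ∷ 1 ∷ 2 ∷ 3 ∷ 4 ∷ 5 ∷ 8 ∷ 11 ∷ 15 ∷ 20 ∷ 25 ∷ 32 ∷ 39 ∷ 45 ∷ 1000 ∷ 1000 ∷ 1000 ∷ 1000 ∷ 1000 ∷ 1000 ∷ 1000 ∷ 1000 ∷ 1000 ∷ 1000 ∷ 1000 ∷ 1000 ∷ 1000 ∷ 1000 ∷ 1000 ∷ 1000 ∷ 1000 ∷ 1000 ∷ 1000 ∷ 1000 ∷ 1000 ∷ []

  row6 : List ℕ
  row6 = 0 ∷ 0 ∷ 0 ∷ 0 ∷ 0 ∷ 0 ∷ 0 ∷ 1 ∷ 2 ∷ 3 ∷ 4 ∷ 5 ∷ 6 ∷ 9 ∷ 12 ∷ 15 ∷ 20 ∷ 24 ∷ 30 ∷ 37 ∷ 44 ∷ 50 ∷ 60 ∷ 1000 ∷ 1000 ∷ 1000 ∷ 1000 ∷ 1000 ∷ 1000 ∷ 1000 ∷ 1000 ∷ 1000 ∷ 1000 ∷ 1000 ∷ 1000 ∷ 1000 ∷ 1000 ∷ 1000 ∷ 1000 ∷ 1000 ∷ 1000 ∷ []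

  row7 : List ℕ
  row7 = 0 ∷ 0 ∷ 0 ∷ 0 ∷ 0 ∷ 0 ∷ 0 ∷ 0 ∷ 1 ∷ 2 ∷ 3 ∷ 4 ∷ 5 ∷ 6 ∷ 7 ∷ 10 ∷ 13 ∷ 16 ∷ 20 ∷ 24 ∷ 29 ∷ 34 ∷ 40 ∷ 46 ∷ 54 ∷ 64 ∷ 73 ∷ 80 ∷ 88 ∷ 1000 ∷ 1000 ∷ 1000 ∷ 1000 ∷ 1000 ∷ 1000 ∷ 1000 ∷ 1000 ∷ 1000 ∷ 1000 ∷ 1000 ∷ 1000 ∷ 1000 ∷ []

  row8 : List ℕ
  row8 = 0 ∷ 0 ∷ 0 ∷ 0 ∷ 0 ∷ 0 ∷ 0 ∷ 0 ∷ 0 ∷ 1 ∷ 2 ∷ 3 ∷ 4 ∷ 5 ∷ 6 ∷ 7 ∷ 8 ∷ 11 ∷ 14 ∷ 17 ∷ 20 ∷ 25 ∷ 29 ∷ 33 ∷ 39 ∷ 45 ∷ 50 ∷ 57 ∷ 64 ∷ 71 ∷ 80 ∷ 90 ∷ 101 ∷ 113 ∷ 124 ∷ 135 ∷ 144 ∷ 1000 ∷ 1000 ∷ 1000 ∷ 1000 ∷ 1000 ∷ 1000 ∷ []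

  graphs-0-0 : List Tri
  graphs-0-0 = map (decode 0) (0 ∷ [])

  graphs-1-2 : List Tri
  graphs-1-2 = map (decode 2) (1 ∷ [])

  graphs-2-4 : List Tri
  graphs-2-4 = map (decode 4) (33
    ∷ 41 ∷ [])

  graphs-2-5 : List Tri
  graphs-2-5 = map (decode 5) (803 ∷ [])

  graphs-3-6 : List Tri
  graphs-3-6 = map (decode 6) (16897 ∷ [])

  graphs-3-7 : List Tri
  graphs-3-7 = map (decode 7) (1644545
    ∷ 1361985
    ∷ 1642627 ∷ [])

  graphs-3-8 : List Tri
  graphs-3-8 = map (decode 8) (210551043 ∷ [])

  graphs-4-10 : List Tri
  graphs-4-10 = map (decode 10) (27590886949891
    ∷ 27597346308097
    ∷ 22541079093267
    ∷ 27600685760513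
    ∷ 27597329793537
    ∷ 27591963705857
    ∷ 27597346178051
    ∷ 27114179134467
    ∷ 24294533104643
    ∷ 22541105236485
    ∷ 27112000065539
    ∷ 27114145452553
    ∷ 18143691417607 ∷ [])

  graphs-4-11 : List Tri
  graphs-4-11 = map (decode 11) (18867673221334069
    ∷ 25619996529928195
    ∷ 28259940588589059
    ∷ 23402023337076041
    ∷ 28259665713309699
    ∷ 23117257745443107
    ∷ 18864614805612547 ∷ [])

  graphs-4-12 : List Tri
  graphs-4-12 = map (decode 12) (57792479928601038923 ∷ [])

  graphs-5-14 : List Tri
  graphs-5-14 = map (decode 14) (1296582460489473268073439329
    ∷ 1939193837875608415671156737
    ∷ 1908067487400005145081167875
    ∷ 1941989440372145814853730307
    ∷ 1941990602553050980696539139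
    ∷ 1608250393188481108671475713
    ∷ 1898731421817761496194777095
    ∷ 1589850838013860945326145543
    ∷ 1296576630995916390301515843
    ∷ 1907686317816784827405377601
    ∷ 1908970913439979024771457033
    ∷ 1608253879660054748715843587
    ∷ 1941990602554176880435560451
    ∷ 1941989440552289525875949571
    ∷ 1281616617067084087541530627
    ∷ 1296366458267892585997549571
    ∷ 1605851431195749507303227395 ∷ [])

  graphs-5-15 : List Tri
  graphs-5-15 = map (decode 15) (31773007885641522199759537078419
    ∷ 28018396272465015635555129655299
    ∷ 26349574481558538132328382889987
    ∷ 20960868787475933786076192064005
    ∷ 28845342579924256007454900650003
    ∷ 26027874448647685064120256864259
    ∷ 26346038709992707605500692807701
    ∷ 31277019797055776324999449165877 ∷ [])

  graphs-5-16 : List Tri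
  graphs-5-16 = map (decode 16) (1069982135747042214359303520893862027
    ∷ 1069740717652245787531158307612197387
    ∷ 939938262820765360729303566585987209
    ∷ 853534547427844788254570170481180707
    ∷ 937352911760643711159780375259316355
    ∷ 863587927894292003753659125436055555
    ∷ 1042842596480654769197213203840106503
    ∷ 918551831120624710983453145703946241
    ∷ 937342139133884483364003032928387097
    ∷ 1024406213890432274728667813513330699
    ∷ 1069984007531725017264187412234666249
    ∷ 1065113791263517093189778886179979529
    ∷ 936277404273225666285373208940052491
    ∷ 935963579007240665273224125495967811
    ∷ 936280083763008314866182868566147091
    ∷ 1042394820561650244944655724157931523
    ∷ 863432958222705045846567417909905417
    ∷ 936282455375537595335200906932273155
    ∷ 941799139218331313270952915848434177
    ∷ 853205891002487423924956597951430681
    ∷ 876374402435673170914276538000771585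
    ∷ 1060740576672807317372762421108867603
    ∷ 1065111780665209468885959023337473059
    ∷ 1060740319312455179250607200143474691
    ∷ 692097534783048708148267658346823715
    ∷ 863443139040605876865807563700174867
    ∷ 918108742709265237230926619161526291
    ∷ 1060896792380140688049653450534848585
    ∷ 937351723260379507378222390277867657
    ∷ 937351723260530327960161576802617481
    ∷ 937577206688738222842843512810539529
    ∷ 853205869482200972685963580512993795
    ∷ 936297845755741592082111394826485827
    ∷ 1024404341578697367826104238647607363
    ∷ 863960690863855035974865770293297171
    ∷ 1060578692555240871727627548041216131
    ∷ 941327873086169711140519827125340169
    ∷ 941327873105436929532034901644706825
    ∷ 918430781021714945936412638363910179
    ∷ 939933452631148825234599546393526339
    ∷ 1024385931456123672371008544150159397
    ∷ 858722407494238709291473885681221651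
    ∷ 858722526046419105810431953957158947
    ∷ 936135432628404564156033232415031331 ∷ [])

  graphs-6-19 : List Tri
  graphs-6-19 = map (decode 19) (2128410609161359393543244375260791428426612645036085
    ∷ 1944255427649833576997501239161302090630823338311691
    ∷ 1941071530485352271443057732908917069415764046643253
    ∷ 1945260519796758103077246573839296668352326830915591
    ∷ 1921879309117024575153248446126762909079232546340885
    ∷ 2067396863446950992806735196170715685201880153325621
    ∷ 2110731112059959065413737820837206238090668376588341
    ∷ 2307177328576047852033599834916611298435163922890771
    ∷ 2306707830658840057747330839017189588507762639642629
    ∷ 1945260120909417732519825928890342577142962240377481
    ∷ 2389653849519839042783891078197808124497508698685475 ∷ [])

  graphs-6-20 : List Tri
  graphs-6-20 = map (decode 20) (872231117145682724889422850865584186916748770587094024203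
    ∷ 1084289241281825160192838272989915824282334743095560634379
    ∷ 1019362468065204576907650023037661578594086288603298660363
    ∷ 1262926803417974638921670024047753130161078913124348198933
    ∷ 1083908375564970810018959469967240588837948307537505288233
    ∷ 1019206069808548388265377784731500480952282555458164099113
    ∷ 1209957054477337691522080597477539631233074505585389469707
    ∷ 1019351999316177599986059604171364592121676200570944225291
    ∷ 1007619589560034393654775574663403432742419824250069204995
    ∷ 1209382182399436421522772702453745790753062166937604196355
    ∷ 1253679021757530732014633170498379606976219301148938469387
    ∷ 1109683242923882030455769593267664997253537850438303350819
    ∷ 1256910567024497246234708615022598592772317520741593514027
    ∷ 1107288695391481769600296194275614600855361259836675719813
    ∷ 1231360927112401988690705562001075711937149333807314239915 ∷ [])

  certs-1-2-1 : List Cert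
  certs-1-2-1 =
      cert 1 0 9 0 ∷ []

  certs-2-4-1 : List Cert
  certs-2-4-1 =
      cert 1 0 9 0 ∷ []

  certs-2-5-2 : List Cert
  certs-2-5-2 =
      cert 0 1 9 11 ∷ []

  certs-3-6-1 : List Cert
  certs-3-6-1 =
      cert 1 0 9 0 ∷ []

  certs-3-7-2 : List Cert
  certs-3-7-2 =
      cert 0 1 9 1111
    ∷ cert 1 2 9 101 ∷ []

  certs-3-8-2 : List Cert
  certs-3-8-2 =
      cert 0 2 9 11111 ∷ []

  certs-4-10-3 : List Cert
  certs-4-10-3 =
      cert 1 0 9 0 ∷ []

  certs-4-10-2 : List Cert
  certs-4-10-2 =
      cert 1 5 9 1111111111
    ∷ cert 2 4 9 1001101
    ∷ cert 5 16 9 3333333 ∷ []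

  certs-4-11-3 : List Cert
  certs-4-11-3 =
      cert 0 2 9 1111111111
    ∷ cert 1 3 9 1001101
    ∷ cert 3 10 9 2222222 ∷ []

  certs-4-12-3 : List Cert
  certs-4-12-3 =
      cert 1 5 9 101101011011 ∷ []

  certs-5-14-3 : List Cert
  certs-5-14-3 =
      cert 2 12 9 1111111111111111111111111
    ∷ cert 1 6 9 101100110111101100110111
    ∷ cert 6 24 9 313313331133010121010
    ∷ cert 3 11 9 10011201111010111111
    ∷ cert 1 3 9 10010000000010001
    ∷ cert 1 4 9 10010010000001001011
    ∷ cert 4 14 9 10221121022112001
    ∷ cert 2 7 9 1111010000110011
    ∷ cert 39 138 99 1515051515150520200500150010001510
    ∷ cert 2 6 9 110010000200001001
    ∷ cert 9 29 9 60330101006131039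
    ∷ cert 28 96 99 100000001010100000000010201010201000
    ∷ cert 6 19 9 11111111550050000 ∷ []

  certs-5-14-2 : List Cert
  certs-5-14-2 =
      cert 31 131 99 20200020000020101020000000000010100010100010000000100000 ∷ []

  certs-5-15-4 : List Cert
  certs-5-15-4 =
      cert 2 12 9 1111111111111111111111111 ∷ []

  certs-5-15-3 : List Cert
  certs-5-15-3 =
      cert 4 21 9 5505005000550050000000000500
    ∷ cert 1 5 9 110010000001110101000
    ∷ cert 75 307 99 37000018235114002300320000000514421409092309236005
    ∷ cert 4 16 9 202022100310100013000030
    ∷ cert 3 14 9 10110100131112210022100
    ∷ cert 100 472 99 74000099007474009900002500252500740000740074000000
    ∷ cert 9 42 9 3300333330030030552421551133 ∷ []

  certs-5-16-5 : List Cert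
  certs-5-16-5 =
      cert 1 8 9 1111111111111111111111111 ∷ []

  certs-5-16-4 : List Cert
  certs-5-16-4 =
      cert 8 72 99 1010101010101010101010000000000020201010000000000000002020
    ∷ cert 10 64 99 40606040606000404060620180604060406040604
    ∷ cert 48 291 99 490000505050009900495000005049490000000000005049
    ∷ cert 1 0 9 0
    ∷ cert 4 26 9 5500500555555500055000
    ∷ cert 5 25 9 3005033050020220302323020
    ∷ cert 2 14 9 3300330000000000330330333003 ∷ []

  certs-5-16-3 : List Cert
  certs-5-16-3 =
      cert 128 813 99 60434386174300523060992230827730000030693047561747695222343452600000 ∷ []

  certs-5-17-4 : List Cert
  certs-5-17-4 =
      cert 5 36 9 2442220232511541001413321423222200 ∷ []

  certs-6-19-4 : List Cert
  certs-6-19-4 =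
      cert 39 236 99 4080808000000000400040404040404040416201612161204040408000004000404000008040808001616160400160000040000040404080804041620081212161616161616
    ∷ cert 197 1034 99 99990049250049002500999900254900004925002525500049250049490025000000999900492500500025494950492550000049250025254900492500494900250000
    ∷ cert 36 198 99 10060700070600001000002018080313030308130300100607000706000010000020180803130303081303120302090009021200031010
    ∷ cert 102 558 99 220032340014280000340008320034000036000050000030241818000616005424204860242818424200120000001802000030606012120812000004
    ∷ cert 131 688 99 66050000220000490027000050001649000060000005666100000033069900003360113916666600110000003800490016666600170000000033
    ∷ cert 616 3077 999 212000000192000212000115385000231000500000000000000385000000000000231000365000000077000000000000192346000250212000000154077000000019019000192000000173000000000096038423000000173269
    ∷ cert 5 25 9 11013001001001220011022020110021012001102101013
    ∷ cert 10 50 9 5001004101401015151001504154010400000511541004100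
    ∷ cert 3 16 9 1111000220000000000001111000000000000020000200111111111111
    ∷ cert 155 830 99 1485000021640749000000000035000042491407000000001400495799280071710028280000281414574242004242424200141457425757420014000014
    ∷ cert 173 692 99 74000000000074000000002500000000490025000049250000000025007400000000007400250000000025005099250000994900002500000000
    ∷ cert 197 986 99 3020301030693079000010003000100020001099892050000020400000000000990000000079690000001030000000308900490079004900998920495930
    ∷ cert 5 25 9 300000002201111100110110020000100221110110010010001102222100
    ∷ cert 552 2759 999 328022000000000000000022030127022000082000030328000000261000037112224172000000000201052000276224075000000052157142000000000000000067201157187000500396000052000000000000000157
    ∷ cert 196 1030 99 4974740087000050000074990000250000990000250000250000120000000000504900000000493737626249990000490037376212492574744949490000004949000000
    ∷ cert 127 650 99 1515000015150000000000002619302245521104110441560015150015150000151500000000000022301926455200151500415615001500341956493023600037000000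
    ∷ cert 37 191 99 6080800080000020000001400140416020400160600061000020808000000000608000006001412161000001610000602160000000600162010000016 ∷ []

  certs-6-19-3 : List Cert
  certs-6-19-3 =
      cert 299 1680 99 39007067848200895794008472005076120511002308001764490082650097777777990000446372040719001700141583007449965700770009052121002807000017163208001400150212240015110000 ∷ []

  certs-6-20-5 : List Cert
  certs-6-20-5 =
      cert 32 216 99 12121212000000000000020002020002000012122020202012121212000000000000100002000000121010101212001012120000000000101200121010121010121220202020 ∷ []

  certs-6-20-4 : List Cert
  certs-6-20-4 =
      cert 216 1496 99 59005959599900995999009959005959202020002020002059590059590099999959990000595959202020002000202099005959995900590020202020002020200020202020002000202020200020205959
    ∷ cert 842 5335 999 156469375000000469281000469000000000500000000062156031000000000344000156313000188000000000000000000000281031094000219281250187312125281000406281156250281000000031000000000250250187281281375000281000250000000000281000000281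
    ∷ cert 560 3513 999 92469092153347000000000000000000000500061316153061000000000000000000000000092000000000061000092061000041051082071000010112000000000112041204010071204286000143122000153000000071204092143112286204061204071122153000000000092000143010173112061
    ∷ cert 767 4834 999 269269000000000269385077192269000000000000000000000000077000000077077269192115038115038000000115115346346154154000000115115500500269269385385000000000000000000308115077115077154115115038038077192115192000038000000385038231000115000000115000
    ∷ cert 940 5648 999 289000078068000159094000141000000021174000151000310154365404044018000247500068078289000000141000094159021000000154365000151018174000044404310000247500000000292000073292000073000000107107396398242000000398396242000000
    ∷ cert 872 5508 999 249074496000000095226139385385116000041344016005143000011129068000144500000324256444233000223167382000053000000271256000091000104000000054106002000017000000233000383204229000352000167224000220219288009049109038000000330368
    ∷ cert 769 4863 999 245125144000240500000000266029417013139000094000034000000000227013161000108113000000285025000227080248049000329074000258161171135062000000000364161351157108000000415323080203170352000159000000000070028000213297000347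
    ∷ cert 17 107 9 902205800850220980089011044700330322370022422119000223300033030033342266 ∷ []

  certs-6-22-5 : List Cert
  certs-6-22-5 =
      cert 5 38 9 11110003201002220111212012210000212100020200202302022122101110012120321012010001
    ∷ cert 5 47 9 31220150110034002002204053320010143003201040230103231222000141200245203301120301
    ∷ cert 17 158 99 300200000060006030100000008000400050004020000000010131806000203050007000014000000060208000010150003190005130511000015150907090808050011000600072007001405000011010000031103
    ∷ cert 3 24 9 20000002101020000012000012100000002000011020000001020200011200000000012210001121021121110001
    ∷ cert 3 24 9 20101001000100100101200001011010101000001100100111001001210012000100000010021020211212102002 ∷ []

  certs-6-23-6 : List Cert
  certs-6-23-6 =
      cert 0 7 9 1100010100010010000001111010001100001010000111000001011000110010010101001001111
    ∷ cert 0 11 9 20200021100010200002020121100120100023010011100310011112001110111211101300000020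
    ∷ cert 0 8 9 200101000000000000000021211000101001000101002000201112100200111211000021120001011111
    ∷ cert 0 11 9 40000000000010000005000030000000000000000000000000050500030000000000405021101243022102211012
    ∷ cert 0 27 9 90800000000005040004200008000000103000000009504005062401300000000000003584053900614308051075
    ∷ cert 0 22 9 151446000100260020330000100401105002000323002510510120319020050001005003203165140001
    ∷ cert 0 11 9 403102100000100000250302011112200000130010200101000100020010021000111122001202
    ∷ cert 0 8 9 210212000000000000200011100303030011100111110120201112023000000000010000
    ∷ cert 0 56 99 11070001001400000000000000200003001300000000110000050200161705000000090000021804021518030009000000000005000800050004000919000017000002141609060000050800
    ∷ cert 0 7 9 22000010000200001002000101000102101010200000020321000020000021000131010010
    ∷ cert 0 27 9 270000094000950000005400404018832001014001300504407002020402008200250650360000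
    ∷ cert 0 9 9 102102111000220012200000200210013000010121000100000021110100201100002030000023
    ∷ cert 0 49 99 800110100001000000000001111030500000015040900000002001900000017060802160000000018070000200200000006050000000000000808000606000600060500001000050000070100
    ∷ cert 0 24 9 804000002000140004500000545000710020740103090035004006030003000430001860000080
    ∷ cert 0 3 9 100100000000000100100000100000100000000000010110000000000110101000011001000000
    ∷ cert 0 19 9 30001000400001200371302032040900023000064521030300200010000030025040050301350
    ∷ cert 0 6 9 20000100000200000200000100000111200210020000000000000001210030012100000102001
    ∷ cert 0 12 9 220313100011001000000400000000310010023004131000100010420040041010500103041000
    ∷ cert 0 9 9 12050000000000000002000202000000003000211300332120403200010000300010000002
    ∷ cert 0 7 9 1130003000000001000000000000003222023000000000100020001020100020020022000000100001
    ∷ cert 0 9 9 320220000000000021000001000001250201300000031002000000001212002012300103000011000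
    ∷ cert 0 10 9 2100010121001011202201012002021120200000020023113200001000100000020010013
    ∷ cert 0 16 9 600000001022000401610040100004041000051220000000030010090400003210422244
    ∷ cert 0 7 9 301010111000010100110100000000000000000301010111000010100110100000122001102102
    ∷ cert 4 68 99 60009000900140006090000060306000020000000000014060000000000060000090011030600000009000000000000090000000000171100060000000903000906060006090009000306060006001100000000
    ∷ cert 0 13 9 302000000520002002015031000000000020000223200000010030102410001002041030200010304312
    ∷ cert 0 4 9 200100000010000000000000000000000010000000100011000000000000011111010100000101102110
    ∷ cert 0 9 9 100001010000001001101012100100131102120000112202210000001102011200202111
    ∷ cert 0 12 9 2001000000000003122301000100100020420014301013150104013120030400100030
    ∷ cert 0 8 9 10010000000000010100203000200200200202003020120130103002110001200100120
    ∷ cert 0 10 9 1002000000001030020020210000002111210220012122020200001312210020010020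
    ∷ cert 0 4 9 100001010000001000000001000000001001000101001010001000000000000000000110002201101100
    ∷ cert 0 6 9 20000010001000001020000000000111010000001000000120100000000130001102102001030111
    ∷ cert 0 6 9 110020001010000001001001010000200020000101101111101000100010001000101000001221
    ∷ cert 0 10 9 122122100000101101002101010102212022010011100012001000110201100000100011102120
    ∷ cert 0 8 9 300000000000210002000000010020300000000000202100000000100200100110011100102200303113
    ∷ cert 0 5 9 1000000000000000000000011011000100000000100001110200111201110020010010110010000
    ∷ cert 0 3 9 10000100100000000000001110110000100110011001000100100000
    ∷ cert 0 6 9 110000002000110012020100000101101012200000000000100101010100000002000110000200
    ∷ cert 0 19 9 16305000292000000100200100003033002001007040200100520100200230034009163409001
    ∷ cert 0 7 9 1202000000001000020000000000000003212010101002200003111020201100010200010000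
    ∷ cert 0 3 9 100000001000001000000000001000000000000100010000000000001010000011010000022001
    ∷ cert 0 7 9 102001001200000010000001000000000200100010000112000000000001210210011210020121003
    ∷ cert 0 3 9 100000000000010001000010000000100000000000100000100010000000000000000010101100011011 ∷ []

  certs-7-25-5 : List Cert
  certs-7-25-5 =
      cert 61 461 99 50007030608060111031000050006060715100000001700001401000015000007000400040700000006001018061015000000000803000708001002051800110700070000190914020016161104203000040000000201000200140005150000000000000000070002060016001600201800002521001108131201002416091400000000050200010001050808010003000000030311000900000000120000000007050114000000070000000000000004000021060000241101200021001521
    ∷ cert 63 468 99 120007060206001001000000000900051302001400000204180015000000080112130600011322030012050009030205001300090008000000000000000000000407120015000000000000000000000026080111210005000804000200160012001000000506000000090011250019000000000000001300171000002000000000050000000706000102000011020000000100130000000402000000000008080009080000070000000009002303180019031323000008161200220005000000210000120913001204252320001209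
    ∷ cert 65 481 99 270301000003000300000505012800020010000001000607030709040008040007002307000000050010000101020426000000000000110207020500090306020407030900200023210024000000000000000000000008000000000000110000140113000000000400000200000000010007000000000006130916041317141900100411051118042419000024210000000000000000001500000001000000021700000004000500000100000000001200000500160000170017000202000000000000000000000800000000000017101205041812040710150916041613
    ∷ cert 67 487 99 10090200001100011500080026101103000005080003001400081200000400000001091403140000000000031700120412120007060100080000000000000007030000000014000005000104000000071711010009200016100400000109130207040002000000001010000000000301020000061300110000120300000000150815240618220715070203000001001000060300010018000000000000000000190017090800050006001700120507010111110000040000000000030111000010000100000100050008071100001716062100060016000000130300060000
    ∷ cert 64 473 99 1410041300020310140200050810000000120000160600180018000500030000000026181000080900000006000000000000030300000000100608000007000000130000030000000000090309130000000002011001100712113002090000080000000505000000000000001309252210100000080700001510000302001713082017220000020013000000000000000110100704000017130700000822070300011203000614000000001600001013010000110612000502000000100104000700000000000900000000000000000900001508120000050601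
    ∷ cert 65 478 99 41118000100000010190000130811000000081704060000000200130000050009001300030000000000000000000305140000061006070400151400011204001506180320151800000700040606090116101415060200070005000000000000001404000000000000000000000100000000000000030507080000000000000600110600000000000500070025021800200002000200061219000005190019070000000000000000000000000016000000000300000200000000000814001600030001170604000201110000000000000000231700060016000122373524
    ∷ cert 65 478 99 6120201000003061415130000001212070600080600000000130008000611001500000000000000000500000200130310000414000507150705070900070608001427001101100509010713080013171411180000060006000000000000080000000700000400000000000000020005000200001600090000000000000606020000000400001000060014121404030413050300100718041605000614001400000000000000000004000001000309000000040000000000021209000000120200080000120000020004070800010200071500071112040126302121
    ∷ cert 67 489 99 10040100000113120818140017060000081400000000000010040017030608090002080713040013150011000008000500000006050009000600000000000000000022000200070608000603141905130010050006000800290900000000000000120000000000000000000002000000111119000201111222000000000500000600000007000011041304111500000400000206000000000005120009080100000004000506090500150021110700001800000500000000001514000006060805000200000000071020131609071215121318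
    ∷ cert 65 477 99 13180000100700170701050800000705021100180000000000110411000100000300040000130815000112190702000000000200040000000506000610031500120508001200022109000002000006020009170000021105001013120900000000040917081300101110090000000500000418000800001401000604000000070000091100000000000700000000000000030000000500210400080012050000110000000000040004000000040000001207000000000911150000000800150007060010120000140510050016121705000202250100030015091500000005
    ∷ cert 64 473 99 8142100000009001900220305000100110007242305070703040014061500000908080013021009000000190300120820070017192400000400000025000200010000160026170017000009040400160000071605010000000900040410010004000005002209091402050008000000060000160000000003060506000009080502000025000408060600000000001200000000000000000000000003000009000602270800000017030000000100000003000000000000000000150300010400060000000000000201001104000000131000000000000000000600001613
    ∷ cert 63 470 99 500031323031304100000000200000606000809000011000306000800090708120812001224000000110822000002000000000006140000000000000000000000160000000900030013220008010015020812060719090000000200000000000000000000000000000000000600000000120000000000000908040004071100000410000808001703020017122002000204000700000000171117001100150000000014000000000309060816000020000010020009000112001102000000190000001219052520152200152911 ∷ []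

  certs-7-26-6 : List Cert
  certs-7-26-6 =
      cert 46 397 99 40100071212010410000007020607060408040512000200080600040700010300100600000700080601100404040003000604090104150001001100001200041500061100121200060009282404343805000000000000000500190000001200000800070701020000000113040900120810002019000811061024051225120200000002000000030001002200130003000000060217000000000000090302070213040000000005040200000700000000000319100000200909190007031408
    ∷ cert 51 420 99 110005000418000500000000000705001200001000000006090019050000190004081400051409090010040004100312030700020013000000000000000005000413100106000003000000050000000022060006220000000700120403170301030200000015000003060006260516000005000000000605250606001700000000020000000000000000020401030000140305170004000013000000000012160010110006000000000007003500170009120517000216111200110005000000170004160109040900381613001611
    ∷ cert 45 388 99 22400170100000200110000220317000000100000000001120000000102110002000211001100000302001700001104100000001600000102002203010101032001000000180021170023000000000000000000000002000000000000020000131414000000020000000000000000000001000000000006111125062726250200011200131303122216000023190000000200001500011300000000000000001200000000000000000000001500001300000000130016120012000000000000000000000000000200000000000003010012130312120413261226052725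
    ∷ cert 47 398 99 7000008001107001303090008000401001016220000001200010708002800000000000603260002000000003000190024020004040801000200000000000018090100050009010001000000000000000103241507130007071800000515000004090001000006000811000000030515031003000500160100040200000003110418180319190508120500000000000202021502090027000002000000000000091120081000000007000800100700040000120000050003000100001004010004110000000500030004020000002607021309030012000002150000000000
    ∷ cert 50 409 99 804061513100803090300000001010810001509040000091200000006000500080000000020160000001300000000000000000000060000110000180017000008000000220000160005000006010000000000060013000816050513112508110001030300120015000001000000001115101523150000020907000603010300000214291519160000070003001100000400001100100902000013080000001309001400120107000827000000000600000000000000100002120003000000101700001500000000100600000000000000000000001705100000030004
    ∷ cert 49 405 99 51414090007000303130702031109000000101600000000010000100000000005000502000000010000000007060400110008011105110000131600001000001404150015130314000000120002130400031802160700070003000713000200030715000000001000000000080000000000000005001609040308000000000000030800000000000000060022022000070000000200140015131101150003000010000000020000000000000508000000001500060000000000071012001500000005150010000000120000000000000111230900030021000030411929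
    ∷ cert 49 406 99 70005110005000404111617120012001203031200050400000000090006001000001100000000040200050400000700050213001113000507151306001000040010001810120000150207080822000510090507090900001213000007000000000004001100000900000500000000000019000000000911150000001600000000000000000300000000040027080500000000000809100510122100000016000000000000000000000000000400001613000000140000000000070304010000020010020000030000000004030000000007260007000008000030313233
    ∷ cert 52 422 99 120000000017260810100010111100041400000000000000040014140800000013000310060019010007000914001107000000020010000411000200000000000316000003091305000808220706070013030011140600211000000000000015020000000200000000000008000000060705040808001100000007000100001100080004000820001904060002140900000000000507070000150007030700000900000500000800200411120000002100030000040000081920000000000005000000000802141210041516060311080409
    ∷ cert 48 401 99 17170001130103001200240007000010020415220000001100030003000000000000030007141500000109180000000012001600000000000000000224022100030710021700002202000110000002040012050006181100000622080201000002090220090314060715090600000700001306000400002004001500000000000000010800000000000000000000000000030000000400191300040118140000000000000000060000030000000000000603000000001911230000000005060008120000090000210000050408231415050000110504000006042200000007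
    ∷ cert 49 409 99 9080807090711090200000500110507130008141300151416070017041100001100030012091405000000090011130509181617031304000600000309000202060000080715171218000002110000020214130711090000001400000904000000000006001303122200190007000003000002140000000006040703000000000000000007001419043200000000001900000000000000000000000004000012000808380000000016040000001200000000000000000000000000090200070000000901000000040601000001000001000000000000000000000500030821
    ∷ cert 53 427 99 71024001113050000000000000010051400100900000709000600001113121702001612000001120418000000060003020002000000021100000017000709000000001300000618150010030015100013090507150200000008000000010000030000000200000000030800000200100000000000000014000009060002091300001500011109100006080712001000000100070000020016040900150000100003000006000703140012000414000011010005001104060011000000060800011026012235053300112410 ∷ []

  certs-7-26-5 : List Cert
  certs-7-26-5 =
      cert 55 454 99 405001307042400070008000402090000000003180611140310000004010700001600000811000000032000001301000204000000060000000000041200080000000018040700000700000700000000040608120007040002000704270216061300192700070600090015000000001700000000080700180000001502001008000000000000000000050010000700081000000005060008000000101107001708040001000000000000091000000012010010000511000800050000030200070000100007060000021100161310160000030813011100020002000011001212100600000000000600040300000004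
    ∷ cert 54 449 99 80010110400280002000700030900001504010005000206170000180000000000000011100602060822000000000013310502000000000000000001000000000000000000151003000000000000050514011700000601110000100006100608190105020001210417090000020003040000000000000014000306000213160300040000110015000009000000000011000000000804131511000000000000000001001200090011110203000000000300000021070004001200000000000100100613000010000000000006030022060600000100001307020500070307061110090407100300150000101200000000001202000017000000000000
    ∷ cert 55 455 99 2312080414050000000007110016070804020200060012001200050200000000130800150006120000140619000009050000000600000505050000000014200000080100000011050004000001001102000000000009121804240010000000191219120800000000000010000900000010000000000000000000000000150000040000000009000403090015090312050100090018061200040000000005020614001304090005030202070000000000080000000307210600100500070008000009000400000000140005030023000000150611000700010000050702082000010603010000000000000000000320
    ∷ cert 49 427 99 40000061204000700001204010806060403000002070020010007070002200000210000140100040300011500030600060005000000000000061101100000111105000000001211040204050709050900000004080004000002000703050805110403000000000001210700150600290247000002030004051902060200000200001900000800000700000000070000000400000021000100161303010200180300060900060001001500011910001000070000010003050200000310040300000000070709000001010403000200050318071400050004001500000200000000000000080013162001060105000300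
    ∷ cert 79 684 99 91100080000001240000000022807110000002706000000001200000015441801180009120900291300001813000000000000110001210008053100084600000000170012060012000200000006000000230000010000000200000012120400001200001100001800181800431516001000000000410000110000009900290000010002390600000700000000000000010010001200210100000000000000190000020000170900000000000806130008000000002200000200090000090012000316153904070804000004120016000000001300031702291003001614080000203902120001020900001216000428000000200000000000000000
    ∷ cert 63 537 99 11210030000080000250002150025000100000000000200006001000010030009180006120213000000040519000013000000001100100003000600120300000500010003000000262300000207060018080017070500001500000000000200070210020000281110020000000008000000000016000111290022190611000016000000000000000000122713100103170000000000160700003700000000211906200100000000060000000000100800000000051100000001000000000900000300080012140117000302000100000400000000351000000106140913031400001300031100000000000600000000002100101902090600002102
    ∷ cert 132 1184 99 300419020023000099000799000018004613000000000000220000000000000000001400093243000007251100042200001012001100431321210046461414000024012200050900001800000052002400100000192500000208003223070219003000009900049946000000130000002200000000180000000000000000320900221443001211100000250011001343000004072121001400004600240000001808320001001446222500002400000002521000190500090400000000000029000000002800000000320000000000001000050800280423121200300100255212222510144608050001100000122552252212001210461432003023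
    ∷ cert 52 443 99 220010120108060707120414001009000000020000030600000000000000000000001014000000070007071800001005031900000000020111181102060000120917030000000319010700000000040010000002000006120706091107220200130500121000000300000005000600000000000000000000081400000200021007140012001900020900040000000312180901060005001204160000000003140900000010020000000009000200000000020002000900000009000802060100020000000506000702070308001203030403120604000003150404090006100001000713020302070014010500001606
    ∷ cert 111 962 99 452900000012303315230002000010060000004703000000000000000000080020000002081800030715000000180021002225150046000000000700310025340028000607001200000524260500280006001738000000011719000010070329000000000011000000000000410002000899001424790000001800080005135504001200212000092605160611000000130019120005002220000600100607000217060336000000000000030305101337020603001429001021070000001200130300000300000200000039000000193100250317141000050000035100001400080300002600002405010000000600091350171027120007000546
    ∷ cert 70 604 99 220000110000150200000000071410000001002518010609150000000000000017000710130500000007100023110400000300000008170000000000000000070000000011001820000005332209002200000500100013000721150000000005050000070016010003000813000400020060000103002354003207130300000000000310000317000026000700000000000003020000041806010505051318220300001400000605180008000101060000020625000017000000000000000000000302002317011524000000010000000100050000041004061218211505002006000300000600000000000504101122092700000000171300040708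
    ∷ cert 54 449 99 51404092009061200001200000900100300000000000000000004000012000000000915110502030010002700060002000014000101040001030009170906000701150000000500000002000310180300160002000000000000000013110608110610150000000100120010000005000023000100000000000000000000111302060000060018020000000000000832000200000402101310000006000004000000000007001600110215030119040000000000090000000000000800090000000003000000110000001000000000051201061009000305080513020012000014000205000013030710071200000809000003070207060504030000
    ∷ cert 55 455 99 81200000000050000000100050700061200080806022108000000000907030003000500120000001100000000001504200200000000000010110000000204000004010003000003220708100124001900000005080310080000030304070900060600030511061506100000000500000000000000000000120605000012111100000005000400040200000010000000120700000000110420000000000408030005000218090300112503210000000100041600050200000600000100000000000002000009000003000005110500000505000000020617000008001702000014090410070705040100000501150000080000000117170907080805
    ∷ cert 61 490 99 90006041409150006000009110704001208000300000010000604000005000200000011061500000300000005000014090000000000090900030000001803031403031400101808030500101206000008070007081114060000110018020006000007000000000003000007141007000004000007000009150000000002000000060514060003180011001301031506000007000013070000000200210000020205160005020700000000000000100000100025060410150900030012090000000814000404000602000000131206160002000000060000000000001109070400180112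
    ∷ cert 57 465 99 90220041104000010000424070211000000120000050000120000050207011000000010000905000000000011020106010000000420000000000013051006000016070500002205040000001709110512000005000000041500000005000300000200000003000000090203120008070109001000000000000007081400020000010000000900000004061103170008000500062302001702050001001805000000000014000003090905000000050900040000000009180012020410140805000305090005050008011100090100080600001506090004031200000005000000000000131000110600021600240008
    ∷ cert 62 489 99 42329002100011505000023003118000000090002000012170013050700000000000208000500050010100004140000030403000005061110002600071505180007000918001702032714000009000000000802000900000000160100210006000908000903000100000600000003101000001300000012000200001501001112040006070600080000050809001000010005000000081022000016030002001607000011040600000000000504020907090204120500000008000000001700000005061613010300000000000000000000000000000000000000000000000000000000000000000000000000000000000000000000000000000000 ∷ []

  -- Evaluation of the certificates

  slope-1-2 : slopeExists 1 (thresholds ((1 , 0) ∷ []) row0 2) 2 1 ≡ true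
  slope-1-2 = refl

  check-1-2-1 : GlueChecked 1 1 1 graphs-1-2 graphs-0-0 certs-1-2-1
  check-1-2-1 = checked refl

  check-row1 : rowOK 0 row0 0 ([]) row1 ≡ true
  check-row1 = refl

  slope-2-4 : slopeExists 2 (thresholds ((1 , 1) ∷ []) row1 4) 4 3 ≡ true
  slope-2-4 = refl

  check-2-4-1 : GlueChecked 2 1 3 graphs-2-4 graphs-1-2 certs-2-4-1
  check-2-4-1 = checked refl

  slope-2-5 : slopeExists 2 (thresholds ((2 , 1) ∷ []) row1 5) 5 5 ≡ true
  slope-2-5 = refl

  check-2-5-2 : GlueChecked 2 2 5 graphs-2-5 graphs-1-2 certs-2-5-2
  check-2-5-2 = checked refl

  check-row2 : rowOK 1 row1 0 ([]) row2 ≡ true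
  check-row2 = refl

  slope-3-6 : slopeExists 3 (thresholds ((1 , 2) ∷ []) row2 6) 6 3 ≡ true
  slope-3-6 = refl

  check-3-6-1 : GlueChecked 3 1 3 graphs-3-6 (within 2 graphs-2-4) certs-3-6-1
  check-3-6-1 = checked refl

  slope-3-7 : slopeExists 3 (thresholds ((2 , 3) ∷ []) row2 7) 7 7 ≡ true
  slope-3-7 = refl

  check-3-7-2 : GlueChecked 3 2 7 graphs-3-7 graphs-2-4 certs-3-7-2
  check-3-7-2 = checked refl

  slope-3-8 : slopeExists 3 (thresholds ((2 , 5) ∷ []) row2 8) 8 10 ≡ true
  slope-3-8 = refl

  check-3-8-2 : GlueChecked 3 2 10 graphs-3-8 graphs-2-5 certs-3-8-2
  check-3-8-2 = checked refl

  check-row3 : rowOK 2 row2 0 ([]) row3 ≡ true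
  check-row3 = refl

  slope-4-10 : slopeExists 4 (thresholds ((2 , 7) ∷ (3 , 3) ∷ []) row3 10) 10 12 ≡ true
  slope-4-10 = refl

  check-4-10-3 : GlueChecked 4 3 12 graphs-4-10 graphs-3-6 certs-4-10-3
  check-4-10-3 = checked refl

  check-4-10-2 : GlueChecked 4 2 12 graphs-4-10 graphs-3-7 certs-4-10-2
  check-4-10-2 = checked refl

  slope-4-11 : slopeExists 4 (thresholds ((3 , 7) ∷ []) row3 11) 11 16 ≡ true
  slope-4-11 = refl

  check-4-11-3 : GlueChecked 4 3 16 graphs-4-11 graphs-3-7 certs-4-11-3
  check-4-11-3 = checked refl

  slope-4-12 : slopeExists 4 (thresholds ((3 , 10) ∷ []) row3 12) 12 20 ≡ true
  slope-4-12 = refl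

  check-4-12-3 : GlueChecked 4 3 20 graphs-4-12 graphs-3-8 certs-4-12-3
  check-4-12-3 = checked refl

  check-row4 : rowOK 3 row3 0 ([]) row4 ≡ true
  check-row4 = refl

  slope-5-14 : slopeExists 5 (thresholds ((2 , 15) ∷ (3 , 12) ∷ []) row4 14) 14 21 ≡ true
  slope-5-14 = refl

  check-5-14-3 : GlueChecked 5 3 21 graphs-5-14 graphs-4-10 certs-5-14-3
  check-5-14-3 = checked refl

  check-5-14-2 : GlueChecked 5 2 21 graphs-5-14 (within 15 graphs-4-11) certs-5-14-2
  check-5-14-2 = checked refl

  slope-5-15 : slopeExists 5 (thresholds ((3 , 16) ∷ (4 , 10) ∷ []) row4 15) 15 26 ≡ true
  slope-5-15 = refl

  check-5-15-4 : GlueChecked 5 4 26 graphs-5-15 (within 10 graphs-4-10) certs-5-15-4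
  check-5-15-4 = checked refl

  check-5-15-3 : GlueChecked 5 3 26 graphs-5-15 graphs-4-11 certs-5-15-3
  check-5-15-3 = checked refl

  slope-5-16 : slopeExists 5 (thresholds ((3 , 20) ∷ (4 , 16) ∷ (5 , 10) ∷ []) row4 16) 16 33 ≡ true
  slope-5-16 = refl

  check-5-16-5 : GlueChecked 5 5 33 graphs-5-16 (within 10 graphs-4-10) certs-5-16-5
  check-5-16-5 = checked refl

  check-5-16-4 : GlueChecked 5 4 33 graphs-5-16 graphs-4-11 certs-5-16-4
  check-5-16-4 = checked refl

  check-5-16-3 : GlueChecked 5 3 33 graphs-5-16 graphs-4-12 certs-5-16-3
  check-5-16-3 = checked refl

  slope-5-17 : slopeExists 5 (thresholds ((4 , 20) ∷ []) row4 17) 17 38 ≡ true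
  slope-5-17 = refl

  check-5-17-4 : GlueChecked 5 4 38 [] graphs-4-12 certs-5-17-4
  check-5-17-4 = checked refl

  check-row5 : rowOK 4 row4 0 ((14 , 20) ∷ (16 , 32) ∷ (17 , 39) ∷ []) row5 ≡ true
  check-row5 = refl

  slope-6-19 : slopeExists 6 (thresholds ((3 , 25) ∷ (4 , 21) ∷ []) row5 19) 19 37 ≡ true
  slope-6-19 = refl

  check-6-19-4 : GlueChecked 6 4 37 graphs-6-19 graphs-5-14 certs-6-19-4
  check-6-19-4 = checked refl

  check-6-19-3 : GlueChecked 6 3 37 graphs-6-19 (within 25 graphs-5-15) certs-6-19-3
  check-6-19-3 = checked refl

  slope-6-20 : slopeExists 6 (thresholds ((4 , 26) ∷ (5 , 20) ∷ []) row5 20) 20 44 ≡ true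
  slope-6-20 = refl

  check-6-20-5 : GlueChecked 6 5 44 graphs-6-20 (within 20 graphs-5-14) certs-6-20-5
  check-6-20-5 = checked refl

  check-6-20-4 : GlueChecked 6 4 44 graphs-6-20 graphs-5-15 certs-6-20-4
  check-6-20-4 = checked refl

  slope-6-22 : slopeExists 6 (thresholds ((5 , 32) ∷ []) row5 22) 22 59 ≡ true
  slope-6-22 = refl

  check-6-22-5 : GlueChecked 6 5 59 [] (within 32 graphs-5-16) certs-6-22-5
  check-6-22-5 = checked refl

  slope-6-23 : slopeExists 6 (thresholds ((6 , 33) ∷ []) row5 23) 23 69 ≡ true
  slope-6-23 = refl

  check-6-23-6 : GlueChecked 6 6 69 [] graphs-5-16 certs-6-23-6
  check-6-23-6 = checked refl

  check-row6 : rowOK 5 row5 0 ((19 , 37) ∷ (20 , 44) ∷ (22 , 60) ∷ (23 , 1000) ∷ []) row6 ≡ true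
  check-row6 = refl

  slope-7-25 : slopeExists 7 (thresholds ((5 , 37) ∷ []) row6 25) 25 63 ≡ true
  slope-7-25 = refl

  check-7-25-5 : GlueChecked 7 5 63 [] graphs-6-19 certs-7-25-5
  check-7-25-5 = checked refl

  slope-7-26 : slopeExists 7 (thresholds ((5 , 44) ∷ (6 , 37) ∷ []) row6 26) 26 72 ≡ true
  slope-7-26 = refl

  check-7-26-6 : GlueChecked 7 6 72 [] graphs-6-19 certs-7-26-6
  check-7-26-6 = checked refl

  check-7-26-5 : GlueChecked 7 5 72 [] graphs-6-20 certs-7-26-5
  check-7-26-5 = checked refl

  check-row7 : rowOK 6 row6 0 ((25 , 64) ∷ (26 , 73) ∷ (29 , 1000) ∷ []) row7 ≡ true
  check-row7 = refl

  check-row8 : rowOK 7 row7 0 ([]) row8 ≡ true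
  check-row8 = refl

  check-43 : rowValue 8 row8 43 1000 ≡ true
  check-43 = refl

  -- Ramsey bounds

  row6-large : ∀ n → 23 ≤ n → n ≤ 28 → nth row6 n ≡ 1000
  row6-large n lo hi = subst (λ m → nth row6 m ≡ 1000) (m+[n∸m]≡n lo) (go (n ∸ 23) (∸-monoˡ-≤ 23 hi))
    where
    go : ∀ i → i ≤ 5 → nth row6 (23 + i) ≡ 1000
    go 0 _ = refl
    go 1 _ = refl
    go 2 _ = refl
    go 3 _ = refl
    go 4 _ = refl
    go 5 _ = refl
    go (suc (suc (suc (suc (suc (suc i)))))) (s≤s (s≤s (s≤s (s≤s (s≤s ())))))

  module Ramsey3 {N : ℕ} (G : Graph N) (tf : TriangleFree G) where
    open OnGraph G
    open Bounds G tf
    open Gluing G tf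
    open Classifying G tf

    valid0 : RowValid 0 row0
    valid0 n [] d refl α = z≤n
    valid0 n (x ∷ L) d l α with α (x ∷ []) ([] ∷ []) ([] ∷ []) (λ { (here e) → here e })
    ... | ()

    class-0-0 : Classified 0 0 0 graphs-0-0
    class-0-0 = classified-empty-graph

    class-1-2 : Classified 1 2 1 graphs-1-2
    class-1-2 = classify row0 ((1 , 0) ∷ []) valid0 slope-1-2 (step certs-1-2-1 class-0-0 check-1-2-1 [])

    valid1 : RowValid 1 row1
    valid1 = row-valid row0 ([]) row1 valid0 check-row1
      ([])

    class-2-4 : Classified 2 4 3 graphs-2-4
    class-2-4 = classify row1 ((1 , 1) ∷ []) valid1 slope-2-4 (step certs-2-4-1 class-1-2 check-2-4-1 [])

    class-2-5 : Classified 2 5 5 graphs-2-5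
    class-2-5 = classify row1 ((2 , 1) ∷ []) valid1 slope-2-5 (step certs-2-5-2 class-1-2 check-2-5-2 [])

    valid2 : RowValid 2 row2
    valid2 = row-valid row1 ([]) row2 valid1 check-row2
      ([])

    class-3-6 : Classified 3 6 3 graphs-3-6
    class-3-6 = classify row2 ((1 , 2) ∷ []) valid2 slope-3-6 (step certs-3-6-1 (Classified-within 2 (≤ᵇ-sound refl) class-2-4) check-3-6-1 [])

    class-3-7 : Classified 3 7 7 graphs-3-7
    class-3-7 = classify row2 ((2 , 3) ∷ []) valid2 slope-3-7 (step certs-3-7-2 class-2-4 check-3-7-2 [])

    class-3-8 : Classified 3 8 10 graphs-3-8
    class-3-8 = classify row2 ((2 , 5) ∷ []) valid2 slope-3-8 (step certs-3-8-2 class-2-5 check-3-8-2 [])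

    valid3 : RowValid 3 row3
    valid3 = row-valid row2 ([]) row3 valid2 check-row3
      ([])

    class-4-10 : Classified 4 10 12 graphs-4-10
    class-4-10 = classify row3 ((2 , 7) ∷ (3 , 3) ∷ []) valid3 slope-4-10 (step certs-4-10-2 class-3-7 check-4-10-2 (step certs-4-10-3 class-3-6 check-4-10-3 []))

    class-4-11 : Classified 4 11 16 graphs-4-11
    class-4-11 = classify row3 ((3 , 7) ∷ []) valid3 slope-4-11 (step certs-4-11-3 class-3-7 check-4-11-3 [])

    class-4-12 : Classified 4 12 20 graphs-4-12
    class-4-12 = classify row3 ((3 , 10) ∷ []) valid3 slope-4-12 (step certs-4-12-3 class-3-8 check-4-12-3 [])

    valid4 : RowValid 4 row4
    valid4 = row-valid row3 ([]) row4 valid3 check-row4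
      ([])

    class-5-14 : Classified 5 14 21 graphs-5-14
    class-5-14 = classify row4 ((2 , 15) ∷ (3 , 12) ∷ []) valid4 slope-5-14 (step certs-5-14-2 (Classified-within 15 (≤ᵇ-sound refl) class-4-11) check-5-14-2 (step certs-5-14-3 class-4-10 check-5-14-3 []))

    class-5-15 : Classified 5 15 26 graphs-5-15
    class-5-15 = classify row4 ((3 , 16) ∷ (4 , 10) ∷ []) valid4 slope-5-15 (step certs-5-15-3 class-4-11 check-5-15-3 (step certs-5-15-4 (Classified-within 10 (≤ᵇ-sound refl) class-4-10) check-5-15-4 []))

    class-5-16 : Classified 5 16 33 graphs-5-16
    class-5-16 = classify row4 ((3 , 20) ∷ (4 , 16) ∷ (5 , 10) ∷ []) valid4 slope-5-16 (step certs-5-16-3 class-4-12 check-5-16-3 (step certs-5-16-4 class-4-11 check-5-16-4 (step certs-5-16-5 (Classified-within 10 (≤ᵇ-sound refl) class-4-10) check-5-16-5 [])))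

    class-5-17 : Classified 5 17 38 []
    class-5-17 = classify row4 ((4 , 20) ∷ []) valid4 slope-5-17 (step certs-5-17-4 class-4-12 check-5-17-4 [])

    valid5 : RowValid 5 row5
    valid5 = row-valid row4 ((14 , 20) ∷ (16 , 32) ∷ (17 , 39) ∷ []) row5 valid4 check-row5
      ((Classified-min 20 (≤ᵇ-sound refl) refl class-5-14) ∷ (Classified-min 32 (≤ᵇ-sound refl) refl class-5-16) ∷ (Classified-empty class-5-17) ∷ [])

    class-6-19 : Classified 6 19 37 graphs-6-19
    class-6-19 = classify row5 ((3 , 25) ∷ (4 , 21) ∷ []) valid5 slope-6-19 (step certs-6-19-3 (Classified-within 25 (≤ᵇ-sound refl) class-5-15) check-6-19-3 (step certs-6-19-4 class-5-14 check-6-19-4 []))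

    class-6-20 : Classified 6 20 44 graphs-6-20
    class-6-20 = classify row5 ((4 , 26) ∷ (5 , 20) ∷ []) valid5 slope-6-20 (step certs-6-20-4 class-5-15 check-6-20-4 (step certs-6-20-5 (Classified-within 20 (≤ᵇ-sound refl) class-5-14) check-6-20-5 []))

    class-6-22 : Classified 6 22 59 []
    class-6-22 = classify row5 ((5 , 32) ∷ []) valid5 slope-6-22 (step certs-6-22-5 (Classified-within 32 (≤ᵇ-sound refl) class-5-16) check-6-22-5 [])

    class-6-23 : Classified 6 23 69 []
    class-6-23 = classify row5 ((6 , 33) ∷ []) valid5 slope-6-23 (step certs-6-23-6 class-5-16 check-6-23-6 [])

    valid6 : RowValid 6 row6
    valid6 = row-valid row5 ((19 , 37) ∷ (20 , 44) ∷ (22 , 60) ∷ (23 , 1000) ∷ []) row6 valid5 check-row6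
      ((Classified-min 37 (≤ᵇ-sound refl) refl class-6-19) ∷ (Classified-min 44 (≤ᵇ-sound refl) refl class-6-20) ∷ (Classified-empty class-6-22) ∷ (Classified-none (≤ᵇ-sound refl) class-6-23) ∷ [])

    class-7-25 : Classified 7 25 63 []
    class-7-25 = classify row6 ((5 , 37) ∷ []) valid6 slope-7-25 (step certs-7-25-5 class-6-19 check-7-25-5 [])

    class-7-26 : Classified 7 26 72 []
    class-7-26 = classify row6 ((5 , 44) ∷ (6 , 37) ∷ []) valid6 slope-7-26 (step certs-7-26-5 class-6-20 check-7-26-5 (step certs-7-26-6 class-6-19 check-7-26-6 []))

    no29 : ∀ L → Distinct L → length L ≡ 29 → α≤ 7 L → ⊥
    no29 = no-29 G tf (valid6 22 , λ n lo hi → subst (MinEdges 6 n) (row6-large n lo hi) (valid6 n))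

    valid7 : RowValid 7 row7
    valid7 = row-valid row6 ((25 , 64) ∷ (26 , 73) ∷ (29 , 1000) ∷ []) row7 valid6 check-row7
      ((Classified-empty class-7-25) ∷ (Classified-empty class-7-26) ∷ (λ L d l α → ⊥-elim (no29 L d l α)) ∷ [])

    valid8 : RowValid 8 row8
    valid8 = row-valid row7 ([]) row8 valid7 check-row8
      ([])

    min43 : MinEdges 9 43 1000
    min43 = rowValue-sound 8 row8 valid8 43 1000 check-43

  -- Matchings in the complement

  module Matchings {N : ℕ} (G : Graph N) where
    open OnGraph G
    open import Data.List.Membership.DecPropositional (Finₚ._≟_ {N}) using (_∈?_)

    ≢-sym′ : ∀ {x y : V} → x ≢ y → y ≢ x
    ≢-sym′ n e = n (sym e)

    Clique : List V → Set
    Clique = AllPairs (λ x y → x ~ y ≡ true)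

    remove : V → List V → List V
    remove x = filter (λ y → ¬? (y Finₚ.≟ x))

    ∈-remove⁺ : ∀ {x y S} → y ∈ S → y ≢ x → y ∈ remove x S
    ∈-remove⁺ {x} m n = ∈-filter⁺ (λ y → ¬? (y Finₚ.≟ x)) m n

    ∈-remove⁻ : ∀ {x y} S → y ∈ remove x S → y ∈ S × y ≢ x
    ∈-remove⁻ {x} S m = ∈-filter⁻ (λ y → ¬? (y Finₚ.≟ x)) {xs = S} m

    Distinct-remove : ∀ x {S} → Distinct S → Distinct (remove x S)
    Distinct-remove x = AllPairsₚ.filter⁺ _

    remove-↭ : ∀ {x S} → Distinct S → x ∈ S → S ↭ x ∷ remove x S
    remove-↭ d m = ∈-remove Finₚ._≟_ d m

    length-⊆ : ∀ {xs ys} → Distinct xs → xs ⊆ ys → length xs ≤ length ys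
    length-⊆ {[]}     {ys} d s = z≤n
    length-⊆ {x ∷ xs} {ys} (n ∷ d) s with ∈-split (s (here refl))
      where
      ∈-split : ∀ {x : V} {ys} → x ∈ ys → ∃ λ zs → ys ↭ x ∷ zs
      ∈-split (here refl)        = _ , refl
      ∈-split {ys = y ∷ _} (there m) with ∈-split m
      ... | zs , π = y ∷ zs , ↭-trans (prep y π) (swap y _ refl)
    ... | zs , π = subst (suc (length xs) ≤_) (sym (↭-length π)) (s≤s (length-⊆ d sub))
      where
      sub : xs ⊆ zs
      sub m with ∈-resp-↭ π (s (there m))
      ... | here refl = ⊥-elim (All.lookup n m refl)
      ... | there m′  = m′

    verts : List (V × V) → List V
    verts []            = []
    verts ((x , y) ∷ M) = x ∷ y ∷ verts M

    verts-++ : ∀ M M′ → verts (M ++ M′) ≡ verts M ++ verts M′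
    verts-++ []      M′ = refl
    verts-++ (e ∷ M) M′ = cong (λ l → proj₁ e ∷ proj₂ e ∷ l) (verts-++ M M′)

    length-verts : ∀ M → length (verts M) ≡ length M + length M
    length-verts []      = refl
    length-verts (_ ∷ M) rewrite length-verts M = cong suc (sym (+-suc (length M) (length M)))

    -- Matchings live in the complement of G: the two ends of an edge are not adjacent in G.
    Matching : List (V × V) → Set
    Matching M = Distinct (verts M) × All (λ (x , y) → x ~ y ≡ false) M

    extend : ∀ {x y M} → Matching M → x ≢ y → x ~ y ≡ false → x ∉ verts M → y ∉ verts M → Matching ((x , y) ∷ M)
    extend {x} {y} {M} (d , a) x≢y na x∉ y∉ = (ne ∷ Allₚ.¬Any⇒All¬ _ y∉ ∷ d) , na ∷ a
      where
      ne : All (x ≢_) (y ∷ verts M)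
      ne = x≢y ∷ Allₚ.¬Any⇒All¬ _ x∉

    -- The matching M taken apart at a vertex x that it covers: the edge at x, and `rest`, which
    -- leaves x uncovered.
    record Uncovered (x : V) (M : List (V × V)) : Set where
      field
        partner  : V
        rest     : List (V × V)
        size     : length M ≡ suc (length rest)
        vertices : verts M ↭ x ∷ partner ∷ verts rest
        isEdge   : x ~ partner ≡ false
        matching : Matching rest

      distinct : Distinct (verts M) → x ≢ partner × x ∉ verts rest × partner ∉ verts rest
      distinct d with Distinct-↭ vertices d
      ... | (n ∷ a) ∷ b ∷ _ = n , (λ m → All.lookup a m refl) , (λ m → All.lookup b m refl)

      partner∈ : partner ∈ verts M
      partner∈ = ∈-resp-↭ (↭-sym vertices) (there (here refl))

      rest⊆ : verts rest ⊆ verts M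
      rest⊆ m = ∈-resp-↭ (↭-sym vertices) (there (there m))

    uncover : ∀ {x} M → Matching M → x ∈ verts M → Uncovered x M
    uncover ((x , y) ∷ M) (_ ∷ _ ∷ d , na ∷ a) (here refl) = record
      { partner = y ; rest = M ; size = refl ; vertices = refl ; isEdge = na ; matching = d , a }
    uncover ((x , y) ∷ M) (_ ∷ _ ∷ d , na ∷ a) (there (here refl)) = record
      { partner = x ; rest = M ; size = refl ; vertices = swap x y refl ; isEdge = trans (~-sym y x) na ; matching = d , a }
    uncover {v} ((x , y) ∷ M) ((x≢y ∷ dx) ∷ dy ∷ d , na ∷ a) (there (there m)) = record
      { partner = U.partner ; rest = (x , y) ∷ U.rest ; size = cong suc U.size
      ; vertices = ↭-trans (prep x (prep y U.vertices)) (shift₂ x y v U.partner)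
      ; isEdge = U.isEdge
      ; matching = extend U.matching x≢y na (λ m → All.lookup dx (U.rest⊆ m) refl) (λ m → All.lookup dy (U.rest⊆ m) refl) }
      where
      module U = Uncovered (uncover M (d , a) m)
      shift₂ : ∀ (x y v w : V) {l} → x ∷ y ∷ v ∷ w ∷ l ↭ v ∷ w ∷ x ∷ y ∷ l
      shift₂ x y v w {l} = ↭-trans (shift v (x ∷ y ∷ []) (w ∷ l)) (prep v (shift w (x ∷ y ∷ []) l))

    record Exchanged (P : V → Set) (total : ℕ) (x y z : V) : Set where
      constructor exchanged
      field
        {M′ N′}   : List (V × V)
        matching₁ : Matching M′
        matching₂ : Matching N′
        inside₁   : ∀ {v} → v ∈ verts M′ → P v
        inside₂   : ∀ {v} → v ∈ verts N′ → P v
        sizes     : length M′ + length N′ ≡ total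
        avoids    : y ∉ verts M′
        avoids′   : x ∉ verts M′ ⊎ z ∉ verts M′

    -- Gallai: swap M and N along their alternating path that starts at y.
    exchange : ∀ m (P : V → Set) M N x z y → length M ≤ m → Matching M → Matching N →
      (∀ {v} → v ∈ verts M → P v) → (∀ {v} → v ∈ verts N → P v) → P y →
      x ≢ z → x ∉ verts M → z ∉ verts M → y ∉ verts N → Exchanged P (length M + length N) x y z
    exchange m P M N x z y l mM mN inM inN Py x≢z x∉ z∉ y∉ with y ∈? verts M
    ... | no y∉M = exchanged mM mN inM inN refl y∉M (inj₁ x∉)
    exchange zero P [] N x z y l mM mN inM inN Py x≢z x∉ z∉ y∉ | yes ()
    exchange (suc m) P M N x z y l mM mN inM inN Py x≢z x∉ z∉ y∉ | yes y∈ = go (y₁ ∈? verts N)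
      where
      module U = Uncovered (uncover M mM y∈)
      y₁ = U.partner
      M₁ = U.rest
      dU = U.distinct (proj₁ mM)
      y≢y₁ = proj₁ dU
      y∉M₁ = proj₁ (proj₂ dU)
      y₁∉M₁ = proj₂ (proj₂ dU)
      x≢y₁ : x ≢ y₁
      x≢y₁ e = x∉ (subst (_∈ verts M) (sym e) U.partner∈)
      z≢y₁ : z ≢ y₁
      z≢y₁ e = z∉ (subst (_∈ verts M) (sym e) U.partner∈)
      x∉M₁ : x ∉ verts M₁
      x∉M₁ m = x∉ (U.rest⊆ m)
      z∉M₁ : z ∉ verts M₁
      z∉M₁ m = z∉ (U.rest⊆ m)
      go : Dec (y₁ ∈ verts N) → Exchanged P (length M + length N) x y z
      -- The path ends at y₁, and its single edge moves from M to N.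
      go (no y₁∉N) = exchanged U.matching (extend mN y≢y₁ U.isEdge y∉ y₁∉N) (inM ∘ U.rest⊆)
        (λ { (here refl) → Py ; (there (here refl)) → inM U.partner∈ ; (there (there m)) → inN m })
        (trans (+-suc (length M₁) (length N)) (cong (_+ length N) (sym U.size))) y∉M₁ (inj₁ x∉M₁)
      go (yes y₁∈N) = go′ (y₂ Finₚ.≟ x) (y₂ Finₚ.≟ z)
        where
        module W = Uncovered (uncover N mN y₁∈N)
        y₂ = W.partner
        N₁ = W.rest
        dW = W.distinct (proj₁ mN)
        y₁≢y₂ = proj₁ dW
        y₁∉N₁ = proj₁ (proj₂ dW)
        y₂∉N₁ = proj₂ (proj₂ dW)
        y≢y₂ : y ≢ y₂
        y≢y₂ e = y∉ (subst (_∈ verts N) (sym e) W.partner∈)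
        y∉N₁ : y ∉ verts N₁
        y∉N₁ m = y∉ (W.rest⊆ m)
        sizes-suc : ∀ {a b c d} → c ≡ suc a → d ≡ suc b → suc a + suc b ≡ c + d
        sizes-suc refl refl = refl
        inM′ : ∀ {v L} → (∀ {v} → v ∈ L → P v) → v ∈ y₁ ∷ y₂ ∷ L → P v
        inM′ h (here refl)         = inM U.partner∈
        inM′ h (there (here refl)) = inN W.partner∈
        inM′ h (there (there m))   = h m
        inN′ : ∀ {v L} → (∀ {v} → v ∈ L → P v) → v ∈ y ∷ y₁ ∷ L → P v
        inN′ h (here refl)         = Py
        inN′ h (there (here refl)) = inM U.partner∈
        inN′ h (there (there m))   = h m
        off : ∀ {v L} → v ≢ y₁ → v ≢ y₂ → v ∉ L → v ∉ y₁ ∷ y₂ ∷ L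
        off a b c (here e)          = a e
        off a b c (there (here e))  = b e
        off a b c (there (there m)) = c m
        -- The path ends at y₂ if this is x or z, which M does not cover. The exchange covers it,
        -- but leaves the other one of x and z uncovered.
        direct : y₂ ∉ verts M₁ → x ∉ y₁ ∷ y₂ ∷ verts M₁ ⊎ z ∉ y₁ ∷ y₂ ∷ verts M₁ → Exchanged P (length M + length N) x y z
        direct y₂∉M₁ av = exchanged (extend U.matching y₁≢y₂ W.isEdge y₁∉M₁ y₂∉M₁) (extend W.matching y≢y₁ U.isEdge y∉N₁ y₁∉N₁)
          (inM′ (inM ∘ U.rest⊆)) (inN′ (inN ∘ W.rest⊆)) (sizes-suc U.size W.size) (off y≢y₁ y≢y₂ y∉M₁) av
        go′ : Dec (y₂ ≡ x) → Dec (y₂ ≡ z) → Exchanged P (length M + length N) x y z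
        go′ (yes e) _ = direct (subst (_∉ verts M₁) (sym e) x∉M₁) (inj₂ (off z≢y₁ (λ e′ → x≢z (trans (sym e) (sym e′))) z∉M₁))
        go′ (no _) (yes e) = direct (subst (_∉ verts M₁) (sym e) z∉M₁) (inj₁ (off x≢y₁ (λ e′ → x≢z (trans e′ e)) x∉M₁))
        -- Strengthening P keeps y and y₁ out of the matchings returned, so the edges at y₁ can be
        -- put back with their roles exchanged.
        go′ (no y₂≢x) (no y₂≢z) with exchange m (λ v → P v × v ≢ y × v ≢ y₁) M₁ N₁ x z y₂
            (s≤s⁻¹ (subst (_≤ suc m) U.size l)) U.matching W.matching
            (λ q → inM (U.rest⊆ q) , (λ { refl → y∉M₁ q }) , (λ { refl → y₁∉M₁ q }))
            (λ q → inN (W.rest⊆ q) , (λ { refl → y∉N₁ q }) , (λ { refl → y₁∉N₁ q }))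
            (inN W.partner∈ , ≢-sym′ y≢y₂ , ≢-sym′ y₁≢y₂) x≢z x∉M₁ z∉M₁ y₂∉N₁
        ... | exchanged {M′} {N′} m₁ m₂ i₁ i₂ s av av′ = exchanged
          (extend m₁ y₁≢y₂ W.isEdge (λ q → proj₂ (proj₂ (i₁ q)) refl) av)
          (extend m₂ y≢y₁ U.isEdge (λ q → proj₁ (proj₂ (i₂ q)) refl) (λ q → proj₂ (proj₂ (i₂ q)) refl))
          (inM′ (proj₁ ∘ i₁)) (inN′ (proj₁ ∘ i₂)) (sizes-suc′ s)
          (off y≢y₁ y≢y₂ (λ q → proj₁ (proj₂ (i₁ q)) refl))
          (case⊎ av′)
          where
          case⊎ : x ∉ verts M′ ⊎ z ∉ verts M′ → x ∉ y₁ ∷ y₂ ∷ verts M′ ⊎ z ∉ y₁ ∷ y₂ ∷ verts M′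
          case⊎ (inj₁ a) = inj₁ (off x≢y₁ (≢-sym′ y₂≢x) a)
          case⊎ (inj₂ a) = inj₂ (off z≢y₁ (≢-sym′ y₂≢z) a)
          sizes-suc′ : length M′ + length N′ ≡ length M₁ + length N₁ → suc (length M′) + suc (length N′) ≡ length M + length N
          sizes-suc′ s = trans (cong suc (+-suc (length M′) (length N′))) (trans (cong (suc ∘ suc) s)
            (trans (cong suc (sym (+-suc (length M₁) (length N₁)))) (sizes-suc U.size W.size)))

  -- Reduction to factor-critical pieces

  module Decomposition {N : ℕ} (G : Graph N) where
    open OnGraph G
    open Matchings G
    open import Data.List.Membership.DecPropositional (Finₚ._≟_ {N}) using (_∈?_)

    MatchingIn : List V → ℕ → Set
    MatchingIn S s = ∃ λ M → Matching M × verts M ⊆ S × length M ≡ s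

    MaxMatching : List V → Set
    MaxMatching S = ∃ λ M → Matching M × verts M ⊆ S × (∀ M′ → Matching M′ → verts M′ ⊆ S → length M′ ≤ length M)

    length-remove : ∀ {x S} → Distinct S → x ∈ S → length S ≡ suc (length (remove x S))
    length-remove d m = ↭-length (remove-↭ d m)

    -- Either x stays uncovered or it is matched with some y ∈ ys.
    maxMatching′ : ∀ m S → length S ≤ m → Distinct S → MaxMatching S
    bestWith : ∀ m x S → length S ≤ m → x ∉ S → Distinct S → ∀ ys → ys ⊆ S →
      ∃ λ M → Matching M × verts M ⊆ x ∷ S × (∀ M′ → Matching M′ → verts M′ ⊆ S → length M′ ≤ length M) ×
        (∀ y M″ → y ∈ ys → x ~ y ≡ false → Matching M″ → verts M″ ⊆ remove y S → suc (length M″) ≤ length M)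

    maxMatching′ m       []      l d = [] , ([] , []) , (λ ()) , λ { [] _ _ → z≤n ; (_ ∷ _) _ s → ⊥-elim (empty (s (here refl))) }
      where
      empty : ∀ {x : V} → x ∈ [] → ⊥
      empty ()
    maxMatching′ (suc m) (x ∷ S) l (nx ∷ d) with bestWith m x S (s≤s⁻¹ l) (λ q → All.lookup nx q refl) d S id
    ... | M , mM , M⊆ , free , used = M , mM , M⊆ , best
      where
      best : ∀ M′ → Matching M′ → verts M′ ⊆ x ∷ S → length M′ ≤ length M
      best M′ mM′ s with x ∈? verts M′
      ... | no x∉ = free M′ mM′ sub
        where
        sub : verts M′ ⊆ S
        sub q with s q
        ... | here refl = ⊥-elim (x∉ q)
        ... | there r   = r
      ... | yes x∈ = subst (_≤ length M) (sym U.size) (used U.partner U.rest p∈ U.isEdge U.matching sub)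
        where
        module U = Uncovered (uncover M′ mM′ x∈)
        dU = U.distinct (proj₁ mM′)
        tail : ∀ {v} → v ∈ x ∷ S → v ≢ x → v ∈ S
        tail (here e)  n = ⊥-elim (n e)
        tail (there q) n = q
        p∈ : U.partner ∈ S
        p∈ = tail (s U.partner∈) (λ e → proj₁ dU (sym e))
        sub : verts U.rest ⊆ remove U.partner S
        sub q = ∈-remove⁺ (tail (s (U.rest⊆ q)) (λ { refl → proj₁ (proj₂ dU) q })) (λ { refl → proj₂ (proj₂ dU) q })

    bestWith m x S l x∉ d [] ys⊆ with maxMatching′ m S l d
    ... | M , mM , M⊆ , best = M , mM , there ∘ M⊆ , best , λ _ _ ()
    bestWith m x S l x∉ d (y ∷ ys) ys⊆ with bestWith m x S l x∉ d ys (ys⊆ ∘ there)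
    ... | M , mM , M⊆ , free , used with x ~ y in e
    ... | true = M , mM , M⊆ , free , λ { y′ M″ (here refl) na → ⊥-elim (true≢false e na) ; y′ M″ (there q) → used y′ M″ q }
    ... | false with maxMatching′ m (remove y S) (≤-trans (≤-trans (n≤1+n _) (≤-reflexive (sym (length-remove d (ys⊆ (here refl)))))) l) (Distinct-remove y d)
    ... | M₁ , mM₁ , M₁⊆ , best₁ with suc (length M₁) ≤? length M
    ... | yes le = M , mM , M⊆ , free , λ { y′ M″ (here refl) na mM″ s → ≤-trans (s≤s (best₁ M″ mM″ s)) le ; y′ M″ (there q) → used y′ M″ q }
    ... | no ¬le = (x , y) ∷ M₁ ,
      extend mM₁ (λ { refl → x∉ (ys⊆ (here refl)) }) e (λ q → x∉ (proj₁ (∈-remove⁻ S (M₁⊆ q)))) (λ q → proj₂ (∈-remove⁻ S (M₁⊆ q)) refl) ,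
      (λ { (here refl) → here refl ; (there (here refl)) → there (ys⊆ (here refl)) ; (there (there q)) → there (proj₁ (∈-remove⁻ S (M₁⊆ q))) }) ,
      (λ M′ mM′ s → ≤-trans (free M′ mM′ s) bigger) ,
      λ { y′ M″ (here refl) na mM″ s → s≤s (best₁ M″ mM″ s) ; y′ M″ (there q) na mM″ s → ≤-trans (used y′ M″ q na mM″ s) bigger }
      where
      bigger : length M ≤ suc (length M₁)
      bigger = <⇒≤ (≰⇒> ¬le)

    abstract
      -- Only the specification is ever used; the exhaustive recursion behind it should not unfold
      -- in types that mention the result.
      maxMatching : ∀ S → Distinct S → MaxMatching S
      maxMatching S d = maxMatching′ (length S) S ≤-refl d

    NoTriple : List V → Set
    NoTriple S = ∀ x y z → x ∈ S → y ∈ S → z ∈ S → Distinct (x ∷ y ∷ z ∷ []) → Indep (x ∷ y ∷ z ∷ []) → ⊥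

    Superadditive : (ℕ → ℕ) → Set
    Superadditive g = ∀ a b → g a + g b ≤ g (a + b)

    -- With a matching of size ν such a C takes ν + 1 colours; g ν bounds by how much a clique in C
    -- falls short of that.
    OddRamsey : (ℕ → ℕ) → Set
    OddRamsey g = ∀ ν C → Distinct C → length C ≡ suc (ν + ν) → NoTriple C → ∃ λ Q → Clique Q × Q ⊆ C × suc ν ≤ length Q + g ν

    module _ (g : ℕ → ℕ) (sup : Superadditive g) (ramsey : OddRamsey g) where

      g-mono : ∀ {a b} → a ≤ b → g a ≤ g b
      g-mono {a} {b} a≤b = subst (λ z → g a ≤ g z) (m+[n∸m]≡n a≤b) (≤-trans (m≤m+n (g a) (g (b ∸ a))) (sup a (b ∸ a)))

      -- Using the edges of M as colour classes takes |S| - |M| colours, which `bound` compares with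
      -- the clique Q.
      record Balanced (S : List V) : Set where
        constructor balanced
        field
          {M}       : List (V × V)
          {Q}       : List V
          matching  : Matching M
          M⊆        : verts M ⊆ S
          clique    : Clique Q
          Q⊆        : Q ⊆ S
          bound     : length S ≤ length M + (length Q + g (length M))

      module FactorCritical (S : List V) (d : Distinct S) (x₀ : V) (x₀∈ : x₀ ∈ S)
        (ν : ℕ) (top : ∀ M → Matching M → verts M ⊆ S → length M ≤ ν)
        (avoiding : ∀ x → x ∈ S → MatchingIn (remove x S) ν) where

        -- No maximum matching misses both x₀ and y. When every vertex is missed by some maximum
        -- matching, Gallai's lemma makes this class closed under adjacency in the complement.
        Together : V → Set
        Together y = y ≡ x₀ ⊎ ¬ MatchingIn (remove y (remove x₀ S)) ν

        together? : ∀ y → Dec (Together y)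
        together? y with y Finₚ.≟ x₀
        ... | yes e = yes (inj₁ e)
        ... | no ne with maxMatching (remove y (remove x₀ S)) (Distinct-remove y (Distinct-remove x₀ d))
        ... | M , mM , M⊆ , best with length M ≟ ν
        ... | yes e = no λ { (inj₁ e′) → ne e′ ; (inj₂ f) → f (M , mM , M⊆ , e) }
        ... | no n  = yes (inj₂ λ { (M′ , mM′ , M′⊆ , refl) → n (≤-antisym (top M mM (λ q → proj₁ (∈-remove⁻ S (proj₁ (∈-remove⁻ (remove x₀ S) (M⊆ q)))))) (best M′ mM′ M′⊆)) })

        C R : List V
        C = filter together? S
        R = filter (λ y → ¬? (together? y)) S

        S↭ : S ↭ C ++ R
        S↭ = filter-partition together? S

        ∈C : ∀ {y} → y ∈ C → y ∈ S × Together y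
        ∈C = ∈-filter⁻ together?

        ∈R : ∀ {y} → y ∈ R → y ∈ S × ¬ Together y
        ∈R = ∈-filter⁻ (λ y → ¬? (together? y))

        apart : ∀ {y} → ¬ Together y → ¬ ¬ MatchingIn (remove y (remove x₀ S)) ν
        apart h f = h (inj₂ f)

        too-big : ∀ {x y M} → x ∈ S → y ∈ S → Matching M → verts M ⊆ S → length M ≡ ν → x ≢ y → x ~ y ≡ false → x ∉ verts M → y ∉ verts M → ⊥
        too-big {x} {y} {M} x∈ y∈ mM M⊆ l ne na x∉ y∉ = <-irrefl l (top ((x , y) ∷ M) (extend mM ne na x∉ y∉)
          (λ { (here refl) → x∈ ; (there (here refl)) → y∈ ; (there (there q)) → M⊆ q }))

        -- Suppose yz is an edge of the complement. Some maximum matching M misses x₀ and y, and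
        -- some N₀ misses z. Exchanging them along the path from z makes M miss z while still
        -- missing x₀ or y: the former contradicts `Together z`, the latter lets yz enlarge the
        -- matching.
        complete : ∀ {y z} → y ∈ R → z ∈ C → y ~ z ≡ true
        complete {y} {z} y∈ z∈ with y ~ z in e
        ... | true = refl
        ... | false = ⊥-elim (apart (proj₂ (∈R y∈)) λ { (M , mM , M⊆ , l) → contra M mM M⊆ l (proj₂ (∈C z∈)) })
          where
          y≢z : y ≢ z
          y≢z refl = proj₂ (∈R y∈) (proj₂ (∈C z∈))
          y≢x₀ : y ≢ x₀
          y≢x₀ p = proj₂ (∈R y∈) (inj₁ p)
          contra : ∀ M → Matching M → verts M ⊆ remove y (remove x₀ S) → length M ≡ ν → Together z → ⊥
          contra M mM M⊆ l t = go t
            where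
            M⊆S : verts M ⊆ S
            M⊆S q = proj₁ (∈-remove⁻ S (proj₁ (∈-remove⁻ (remove x₀ S) (M⊆ q))))
            y∉ : y ∉ verts M
            y∉ q = proj₂ (∈-remove⁻ (remove x₀ S) (M⊆ q)) refl
            x₀∉ : x₀ ∉ verts M
            x₀∉ q = proj₂ (∈-remove⁻ S (proj₁ (∈-remove⁻ (remove x₀ S) (M⊆ q)))) refl
            go : Together z → ⊥
            go (inj₁ refl) = too-big (proj₁ (∈R y∈)) (proj₁ (∈C z∈)) mM M⊆S l y≢z e y∉ x₀∉
            go (inj₂ f) with avoiding z (proj₁ (∈C z∈))
            ... | N₀ , mN , N⊆ , lN with exchange (length M) (_∈ S) M N₀ x₀ y z ≤-refl mM mN M⊆S (λ q → proj₁ (∈-remove⁻ S (N⊆ q))) (proj₁ (∈C z∈))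
                    (≢-sym′ y≢x₀) x₀∉ y∉ (λ q → proj₂ (∈-remove⁻ S (N⊆ q)) refl)
            ... | exchanged {M′} {N′} m₁ m₂ i₁ i₂ s av av′ = finish av′
              where
              -- M′ and N′ have 2ν edges together and at most ν each.
              l′ : length M′ ≡ ν
              l′ = ≤-antisym (top M′ m₁ i₁) (+-cancelʳ-≤ ν _ _ (≤-trans (≤-reflexive (trans (sym (cong₂ _+_ l lN)) (sym s))) (+-monoʳ-≤ (length M′) (top N′ m₂ i₂))))
              finish : x₀ ∉ verts M′ ⊎ y ∉ verts M′ → ⊥
              finish (inj₁ a) = f (M′ , m₁ , (λ q → ∈-remove⁺ (∈-remove⁺ (i₁ q) (λ { refl → a q })) (λ { refl → av q })) , l′)
              finish (inj₂ b) = too-big (proj₁ (∈R y∈)) (proj₁ (∈C z∈)) m₁ i₁ l′ y≢z e b av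

        x₀∈C : x₀ ∈ C
        x₀∈C = ∈-filter⁺ together? x₀∈ (inj₁ refl)

        C⊆ : C ⊆ S
        C⊆ q = proj₁ (∈C q)

        dC : Distinct C
        dC = AllPairsₚ.filter⁺ together? d

        dR : Distinct R
        dR = AllPairsₚ.filter⁺ (λ y → ¬? (together? y)) d

        split : ∀ {y} → y ∈ S → y ∈ C ⊎ y ∈ R
        split m = ∈-++⁻ C (∈-resp-↭ S↭ m)

        -- Testing one end is enough, because by `complete` no matching edge joins C to R.
        inside : List (V × V) → List (V × V)
        inside M = filter (λ e → together? (proj₁ e)) M

        -- A maximum matching that misses x₀ covers every other vertex of C, by definition of
        -- `Together`, and its edges do not leave C.
        nearPerfect : ∃ λ M → Matching M × verts M ⊆ C × length C ≡ suc (length M + length M)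
        nearPerfect with avoiding x₀ x₀∈
        ... | M , mM , M⊆ , l = inside M , (proj₁ (restrict M mM (λ q → proj₁ (∈-remove⁻ S (M⊆ q))))) , in⊆C ,
            trans (length-remove dC x₀∈C) (cong suc (trans (≤-antisym (length-⊆ (Distinct-remove x₀ dC) covered)
              (length-⊆ (proj₁ (proj₁ (restrict M mM (λ q → proj₁ (∈-remove⁻ S (M⊆ q)))))) (λ q → ∈-remove⁺ (in⊆C q) (λ { refl → proj₂ (∈-remove⁻ S (M⊆ (proj₁ (proj₂ (restrict M mM (λ q → proj₁ (∈-remove⁻ S (M⊆ q))))) q))) refl }))))
              (length-verts (inside M))))
          where
          same-side : ∀ {x y} → x ∈ S → y ∈ S → x ~ y ≡ false → x ∈ C → y ∈ C
          same-side x∈ y∈ na xC with split y∈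
          ... | inj₁ yC = yC
          ... | inj₂ yR = ⊥-elim (true≢false (complete yR xC) (trans (~-sym _ _) na))
          restrict : ∀ M → Matching M → verts M ⊆ S → Matching (inside M) × (verts (inside M) ⊆ verts M)
            × (∀ {y} → y ∈ C → y ∈ verts M → y ∈ verts (inside M)) × (verts (inside M) ⊆ C)
          restrict [] mM s = ([] , []) , id , (λ _ q → q) , λ ()
          restrict ((x , y) ∷ M) ((x≢y ∷ dx) ∷ dy ∷ dM , na ∷ aM) s with restrict M (dM , aM) (λ q → s (there (there q))) | together? x
          ... | m′ , sub , cov , inC | yes tx = extend m′ x≢y na (λ q → All.lookup dx (sub q) refl) (λ q → All.lookup dy (sub q) refl) ,
              (λ { (here e) → here e ; (there (here e)) → there (here e) ; (there (there q)) → there (there (sub q)) }) ,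
              (λ { yC (here e) → here e ; yC (there (here e)) → there (here e) ; yC (there (there q)) → there (there (cov yC q)) }) ,
              (λ { (here refl) → xC ; (there (here refl)) → same-side (s (here refl)) (s (there (here refl))) na xC ; (there (there q)) → inC q })
            where
            xC : x ∈ C
            xC = ∈-filter⁺ together? (s (here refl)) tx
          ... | m′ , sub , cov , inC | no ¬tx = m′ , (λ q → there (there (sub q))) ,
              (λ { zC (here refl) → ⊥-elim (¬tx (proj₂ (∈C zC)))
                 ; zC (there (here refl)) → ⊥-elim (¬tx (proj₂ (∈C (same-side (s (there (here refl))) (s (here refl)) (trans (~-sym _ _) na) zC))))
                 ; zC (there (there q)) → cov zC q }) , inC
          res = restrict M mM (λ q → proj₁ (∈-remove⁻ S (M⊆ q)))
          in⊆C : verts (inside M) ⊆ C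
          in⊆C = proj₂ (proj₂ (proj₂ res))
          covered : remove x₀ C ⊆ verts (inside M)
          covered {y} q with ∈-remove⁻ C q
          ... | yC , y≢x₀ with y ∈? verts M
          ... | yes y∈ = proj₁ (proj₂ (proj₂ res)) yC y∈
          ... | no y∉ with proj₂ (∈C yC)
          ... | inj₁ e = ⊥-elim (y≢x₀ e)
          ... | inj₂ f = ⊥-elim (f (M , mM , (λ q → ∈-remove⁺ (M⊆ q) (λ { refl → y∉ q })) , l))

      -- If deleting some x lowers the matching number, the bound for S minus x extends to S, as the
      -- matching number pays for x. Otherwise C is split off: it has 2|M₁| + 1 vertices, so
      -- `ramsey` applies to it, while R is treated by induction. All of C is adjacent to all of R,
      -- so the two cliques unite, and superadditivity adds up the deficits.
      balance : ∀ m S → length S ≤ m → Distinct S → NoTriple S → Balanced S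
      balance m [] l d nt = balanced {M = []} {Q = []} ([] , []) (λ ()) [] (λ ()) z≤n
      balance (suc m) (x₀ ∷ S₀) l d nt with maxMatching (x₀ ∷ S₀) d
      ... | M , mM , M⊆ , best = cases (any? essential? S)
        where
        S = x₀ ∷ S₀
        ν = length M
        sub : ∀ {T} → T ⊆ S → NoTriple T
        sub s x y z a b c = nt x y z (s a) (s b) (s c)
        essential? : ∀ x → Dec (length (proj₁ (maxMatching (remove x S) (Distinct-remove x d))) < ν)
        essential? x = length (proj₁ (maxMatching (remove x S) (Distinct-remove x d))) <? ν
        cases : Dec _ → Balanced S
        cases (yes ess) with find ess
        ... | x , x∈ , lt with balance m (remove x S) (s≤s⁻¹ (subst (_≤ suc m) (length-remove d x∈) l)) (Distinct-remove x d) (sub (λ q → proj₁ (∈-remove⁻ S q)))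
        ... | balanced {M₁} {Q} mM₁ M₁⊆ cQ Q⊆ b = balanced {M = M} {Q = Q} mM M⊆ cQ (λ q → proj₁ (∈-remove⁻ S (Q⊆ q)))
              (subst (_≤ ν + (length Q + g ν)) (sym (length-remove d x∈)) (≤-trans (s≤s b) (+-mono-≤ lt′ (+-monoʳ-≤ (length Q) (g-mono (≤-trans (n≤1+n _) lt′))))))
          where
          lt′ : length M₁ < ν
          lt′ = ≤-trans (s≤s (proj₂ (proj₂ (proj₂ (maxMatching (remove x S) (Distinct-remove x d)))) M₁ mM₁ M₁⊆)) lt
        cases (no ¬ess) = combine nearPerfect
          where
          avoiding : ∀ x → x ∈ S → MatchingIn (remove x S) ν
          avoiding x x∈ = avoids (maxMatching (remove x S) (Distinct-remove x d)) (λ lt → ¬ess (lose x∈ lt))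
            where
            avoids : (mm : MaxMatching (remove x S)) → ¬ (length (proj₁ mm) < ν) → MatchingIn (remove x S) ν
            avoids (M₁ , mM₁ , M₁⊆ , _) ≮ = M₁ , mM₁ , M₁⊆ , ≤-antisym (best M₁ mM₁ (λ q → proj₁ (∈-remove⁻ S (M₁⊆ q)))) (≮⇒≥ ≮)
          open FactorCritical S d x₀ (here refl) ν best avoiding
          combine : (∃ λ M → Matching M × verts M ⊆ C × length C ≡ suc (length M + length M)) → Balanced S
          combine (M₁ , mM₁ , M₁⊆ , lC) with ramsey (length M₁) C dC lC (sub C⊆)
             | balance m R (s≤s⁻¹ (≤-trans (≤-trans (s≤s (m≤n+m (length R) (length M₁ + length M₁))) (≤-reflexive (trans (cong (_+ length R) (sym lC)) (trans (sym (length-++ C)) (sym (↭-length S↭)))))) l)) dR (sub (λ q → proj₁ (∈R q)))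
          ... | Q₁ , cQ₁ , Q₁⊆ , b₁ | balanced {M₂} {Q₂} mM₂ M₂⊆ cQ₂ Q₂⊆ b₂ = balanced {M = M₁ ++ M₂} {Q = Q₁ ++ Q₂}
            (subst Distinct (sym (verts-++ M₁ M₂)) (AllPairsₚ.++⁺ (proj₁ mM₁) (proj₁ mM₂)
               (All.tabulate (λ p → All.tabulate (λ q e → proj₂ (∈R (M₂⊆ q)) (subst Together e (proj₂ (∈C (M₁⊆ p)))))))) ,
             Allₚ.++⁺ (proj₂ mM₁) (proj₂ mM₂))
            (λ q → join M₁⊆ M₂⊆ (∈-++⁻ (verts M₁) (subst (_ ∈_) (verts-++ M₁ M₂) q)))
            (AllPairsₚ.++⁺ cQ₁ cQ₂ (All.tabulate (λ p → All.tabulate (λ q → trans (~-sym _ _) (complete (Q₂⊆ q) (Q₁⊆ p))))))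
            (λ q → join Q₁⊆ Q₂⊆ (∈-++⁻ Q₁ q))
            (begin
              length S ≡⟨ trans (↭-length S↭) (length-++ C) ⟩
              length C + length R ≡⟨ cong (_+ length R) (trans lC (sym (+-suc (length M₁) (length M₁)))) ⟩
              length M₁ + suc (length M₁) + length R ≤⟨ +-mono-≤ (+-monoʳ-≤ (length M₁) b₁) b₂ ⟩
              length M₁ + (length Q₁ + g (length M₁)) + (length M₂ + (length Q₂ + g (length M₂))) ≡⟨ lem (length M₁) (length Q₁) (g (length M₁)) (length M₂) (length Q₂) (g (length M₂)) ⟩
              length M₁ + length M₂ + (length Q₁ + length Q₂ + (g (length M₁) + g (length M₂))) ≤⟨ +-monoʳ-≤ (length M₁ + length M₂) (+-monoʳ-≤ (length Q₁ + length Q₂) (sup (length M₁) (length M₂))) ⟩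
              length M₁ + length M₂ + (length Q₁ + length Q₂ + g (length M₁ + length M₂)) ≡⟨ cong₂ (λ a b → a + (b + g a)) (sym (length-++ M₁)) (sym (length-++ Q₁)) ⟩
              length (M₁ ++ M₂) + (length (Q₁ ++ Q₂) + g (length (M₁ ++ M₂))) ∎)
            where
            open ≤-Reasoning
            join : ∀ {L₁ L₂ v} → L₁ ⊆ C → L₂ ⊆ R → v ∈ L₁ ⊎ v ∈ L₂ → v ∈ S
            join a b (inj₁ q) = C⊆ (a q)
            join a b (inj₂ q) = proj₁ (∈R (b q))
            lem : ∀ a b c d e f → a + (b + c) + (d + (e + f)) ≡ a + d + (b + e + (c + f))
            lem = solve-∀

  -- Colourings

  module Colourings {N : ℕ} (G : Graph N) where
    open OnGraph G
    open Matchings G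
    open Decomposition G

    Triple : V → V → V → Set
    Triple x y z = Distinct (x ∷ y ∷ z ∷ []) × Indep (x ∷ y ∷ z ∷ [])

    triple? : ∀ x y z → Dec (Triple x y z)
    triple? x y z = AllPairs.allPairs? (λ a b → ¬? (a Finₚ.≟ b)) _ ×-dec AllPairs.allPairs? (λ a b → (a ~ b) Bool.≟ false) _

    findTriple : ∀ S → (∃ λ x → ∃ λ y → ∃ λ z → x ∈ S × y ∈ S × z ∈ S × Triple x y z) ⊎ NoTriple S
    findTriple S with any? (λ x → any? (λ y → any? (λ z → triple? x y z) S) S) S
    ... | yes p with find p
    ... | x , x∈ , q with find q
    ... | y , y∈ , r with find r
    ... | z , z∈ , t = inj₁ (x , y , z , x∈ , y∈ , z∈ , t)
    findTriple S | no ¬p = inj₂ (λ x y z a b c d i → ¬p (lose a (lose b (lose c (d , i)))))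

    module _ (g : ℕ → ℕ) (sup : Superadditive g) (g2 : 1 ≤ g 2) (ramsey : OddRamsey g) where

      -- `saved` is the number of vertices minus the number of classes: two for each triple and one
      -- for each pair.
      record Coloured (S : List V) : Set where
        constructor coloured
        field
          classes : List (List V)
          {Q}     : List V
          saved   : ℕ
          indep   : All Indep classes
          covers  : S ↭ concat classes
          clique  : Clique Q
          count   : length classes + saved ≡ length S
          bound   : length classes ≤ length Q + g saved

      pairs : List (V × V) → List (List V)
      pairs = map (λ (x , y) → x ∷ y ∷ [])

      concat-pairs : ∀ M → concat (pairs M) ≡ verts M
      concat-pairs []      = refl
      concat-pairs (e ∷ M) = cong (λ l → proj₁ e ∷ proj₂ e ∷ l) (concat-pairs M)

      concat-singletons : ∀ (U : List V) → concat (map [_] U) ≡ U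
      concat-singletons []      = refl
      concat-singletons (x ∷ U) = cong (x ∷_) (concat-singletons U)

      concat-++ : ∀ (A B : List (List V)) → concat (A ++ B) ≡ concat A ++ concat B
      concat-++ []      B = refl
      concat-++ (a ∷ A) B = trans (cong (a ++_) (concat-++ A B)) (sym (++-assoc a (concat A) (concat B)))

      complementOf : ∀ {S} L → Distinct S → Distinct L → L ⊆ S → ∃ λ U → S ↭ L ++ U
      complementOf {S} [] dS dL s = S , refl
      complementOf {S} (x ∷ L) dS (n ∷ dL) s with complementOf L (Distinct-remove x dS) dL (λ q → ∈-remove⁺ (s (there q)) (λ { refl → All.lookup n q refl }))
      ... | U , π = U , ↭-trans (remove-↭ dS (s (here refl))) (prep x π)

      -- A triple costs one class and raises `saved` by 2; its class is paid for by 1 ≤ g 2 and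
      -- superadditivity, without enlarging the clique.
      colour : ∀ m S → length S ≤ m → Distinct S → Coloured S
      colour m S l d with findTriple S
      colour m S l d | inj₂ nt with balance g sup ramsey (length S) S ≤-refl d nt
      ... | balanced {M} {Q} mM M⊆ cQ Q⊆ b with complementOf (verts M) d (proj₁ mM) M⊆
      ... | U , π = coloured (pairs M ++ map [_] U) {Q} (length M)
          (Allₚ.++⁺ (Allₚ.map⁺ (All.map (λ na → (na ∷ []) ∷ [] ∷ []) (proj₂ mM))) (Allₚ.map⁺ (All.tabulate (λ _ → [] ∷ []))))
          (subst (S ↭_) (sym (trans (concat-++ (pairs M) (map [_] U)) (cong₂ _++_ (concat-pairs M) (concat-singletons U)))) π)
          cQ (trans (cong (_+ length M) lenc) count)
          (subst (_≤ length Q + g (length M)) (sym lenc) (+-cancelʳ-≤ (length M) _ _ (≤-trans (≤-reflexive count) (≤-trans b (≤-reflexive (+-comm (length M) _))))))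
        where
        lenc : length (pairs M ++ map [_] U) ≡ length M + length U
        lenc = trans (length-++ (pairs M)) (cong₂ _+_ (length-map _ M) (length-map _ U))
        count : length M + length U + length M ≡ length S
        count = trans (lem (length M) (length U)) (sym (trans (↭-length π) (trans (length-++ (verts M)) (cong (_+ length U) (length-verts M)))))
          where
          lem : ∀ a b → a + b + a ≡ a + a + b
          lem = solve-∀
      colour zero [] l d | inj₁ (x , y , z , () , _)
      colour (suc m) S l d | inj₁ (x , y , z , x∈ , y∈ , z∈ , dT@((x≢y ∷ x≢z ∷ []) ∷ (y≢z ∷ []) ∷ _) , iT)
        with complementOf (x ∷ y ∷ z ∷ []) d dT (λ { (here refl) → x∈ ; (there (here refl)) → y∈ ; (there (there (here refl))) → z∈ })
      ... | U , π with colour m U (s≤s⁻¹ (≤-trans (≤-trans (s≤s (≤-trans (n≤1+n _) (n≤1+n _))) (≤-reflexive (sym (↭-length π)))) l)) (drop3 (Distinct-↭ π d))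
        where
        drop3 : ∀ {a b c : V} {U} → Distinct (a ∷ b ∷ c ∷ U) → Distinct U
        drop3 (_ ∷ _ ∷ _ ∷ d) = d
      ... | coloured classes {Q} saved ind cov cQ count bound = coloured ((x ∷ y ∷ z ∷ []) ∷ classes) {Q} (2 + saved) (iT ∷ ind)
        (↭-trans π (++⁺ˡ (x ∷ y ∷ z ∷ []) cov)) cQ
        (trans (lem (length classes) saved) (trans (cong (3 +_) count) (sym (↭-length π))))
        (begin
          suc (length classes) ≤⟨ s≤s bound ⟩
          suc (length Q + g saved) ≡⟨ +-suc (length Q) (g saved) ⟨
          length Q + suc (g saved) ≤⟨ +-monoʳ-≤ (length Q) (≤-trans (+-monoˡ-≤ (g saved) g2) (sup 2 saved)) ⟩
          length Q + g (2 + saved) ∎)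
        where
        open ≤-Reasoning
        lem : ∀ a b → suc (a + (2 + b)) ≡ 3 + (a + b)
        lem a b = cong suc (trans (+-suc a (suc b)) (cong suc (+-suc a b)))

    clique⇒HasClique : ∀ {q} Q → Clique Q → q ≤ length Q → HasClique G q
    clique⇒HasClique {q} Q c q≤ = (λ i → lookup Q (inject≤ i q≤)) ,
      (λ {i} {j} e → injective i j e) , (λ i j ne → adjacent i j ne) , λ _ → _
      where
      lookup-adj : ∀ Q → Clique Q → ∀ (i j : Fin (length Q)) → i ≢ j → lookup Q i ~ lookup Q j ≡ true
      lookup-adj (x ∷ Q) (a ∷ c) Fin.zero    Fin.zero    n = ⊥-elim (n refl)
      lookup-adj (x ∷ Q) (a ∷ c) Fin.zero    (Fin.suc j) n = All.lookup a (∈-lookup j)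
      lookup-adj (x ∷ Q) (a ∷ c) (Fin.suc i) Fin.zero    n = trans (~-sym _ _) (All.lookup a (∈-lookup i))
      lookup-adj (x ∷ Q) (a ∷ c) (Fin.suc i) (Fin.suc j) n = lookup-adj Q c i j (λ e → n (cong Fin.suc e))
      adjacent : ∀ i j → i ≢ j → lookup Q (inject≤ i q≤) ~ lookup Q (inject≤ j q≤) ≡ true
      adjacent i j ne = lookup-adj Q c _ _ (λ e → ne (Finₚ.inject≤-injective q≤ q≤ i j e))
      injective : ∀ i j → lookup Q (inject≤ i q≤) ≡ lookup Q (inject≤ j q≤) → i ≡ j
      injective i j e with i Finₚ.≟ j
      ... | yes p = p
      ... | no ne = ⊥-elim (true≢false (adjacent i j ne) (trans (cong (_~ _) e) (Graph.irrefl G _)))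

    -- The first a₁ ∸ 1 independent classes receive colour 1, the next a₂ ∸ 1 receive colour 2, and so on.
    owner : ∀ {r} → Vec ℕ r → ℕ → Fin r ⊎ ℕ
    owner Vec.[]       j = inj₂ j
    owner (a Vec.∷ as) j with j <? a ∸ 1
    ... | yes _ = inj₁ Fin.zero
    ... | no _  with owner as (j ∸ (a ∸ 1))
    ... | inj₁ i = inj₁ (Fin.suc i)
    ... | inj₂ l = inj₂ l

    base : ∀ {r} → Vec ℕ r → Fin r → ℕ
    base (a Vec.∷ as) Fin.zero    = 0
    base (a Vec.∷ as) (Fin.suc i) = (a ∸ 1) + base as i

    owner-range : ∀ {r} (a : Vec ℕ r) j i → owner a j ≡ inj₁ i → base a i ≤ j × j < base a i + (Vec.lookup a i ∸ 1)
    owner-range (a Vec.∷ as) j i e with j <? a ∸ 1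
    owner-range (a Vec.∷ as) j Fin.zero refl | yes lt = z≤n , lt
    owner-range (a Vec.∷ as) j i e | no ≮ with owner as (j ∸ (a ∸ 1)) in eq
    owner-range (a Vec.∷ as) j (Fin.suc i) refl | no ≮ | inj₁ .i with owner-range as (j ∸ (a ∸ 1)) i eq
    ... | lo , hi = ≤-trans (+-monoʳ-≤ (a ∸ 1) lo) (≤-reflexive back) ,
      ≤-trans (≤-reflexive (trans (cong suc (sym back)) (sym (+-suc (a ∸ 1) _)))) (≤-trans (+-monoʳ-≤ (a ∸ 1) hi) (≤-reflexive (sym (+-assoc (a ∸ 1) (base as i) _))))
      where
      back : (a ∸ 1) + (j ∸ (a ∸ 1)) ≡ j
      back = m+[n∸m]≡n (≮⇒≥ ≮)

    owner-total : ∀ {r} (a : Vec ℕ r) j l → owner a j ≡ inj₂ l → Vec.sum (Vec.map (λ x → x ∸ 1) a) ≤ j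
    owner-total Vec.[]       j l e = z≤n
    owner-total (a Vec.∷ as) j l e with j <? a ∸ 1
    owner-total (a Vec.∷ as) j l () | yes _
    ... | no ≮ with owner as (j ∸ (a ∸ 1)) in eq
    ... | inj₂ l′ = ≤-trans (+-monoʳ-≤ (a ∸ 1) (owner-total as (j ∸ (a ∸ 1)) l′ eq)) (≤-reflexive (m+[n∸m]≡n (≮⇒≥ ≮)))

    classOf : ∀ (cs : List (List V)) {x} → x ∈ concat cs → Fin (length cs)
    classOf (c ∷ cs) m with ∈-++⁻ c m
    ... | inj₁ _ = Fin.zero
    ... | inj₂ q = Fin.suc (classOf cs q)

    classOf-∈ : ∀ cs {x} (m : x ∈ concat cs) → x ∈ lookup cs (classOf cs m)
    classOf-∈ (c ∷ cs) m with ∈-++⁻ c m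
    ... | inj₁ q = q
    ... | inj₂ q = classOf-∈ cs q

    Indep-lookup : ∀ {cs} → All Indep cs → ∀ i → Indep (lookup cs i)
    Indep-lookup (a ∷ as) Fin.zero    = a
    Indep-lookup (a ∷ as) (Fin.suc i) = Indep-lookup as i

    Indep-∈ : ∀ {I x y} → Indep I → x ∈ I → y ∈ I → x ~ y ≡ false
    Indep-∈ (a ∷ d) (here refl) (here refl) = Graph.irrefl G _
    Indep-∈ (a ∷ d) (here refl) (there q)   = All.lookup a q
    Indep-∈ (a ∷ d) (there p)   (here refl) = trans (~-sym _ _) (All.lookup a p)
    Indep-∈ (a ∷ d) (there p)   (there q)   = Indep-∈ d p q

    -- With fewer than m classes, `owner` merges at most aᵢ - 1 of them into colour i. By the
    -- pigeonhole principle two vertices of a clique of size aᵢ in that colour would share an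
    -- independent class.
    arrows⇒chromatic : ∀ {r} (a : Vec ℕ r) → (∀ i → 2 ≤ Vec.lookup a i) → VertexArrows G a →
      ∀ cs → All Indep cs → (∀ x → x ∈ concat cs) → mOf a ≤ length cs
    arrows⇒chromatic {r} a a≥2 arr cs ind cov with mOf a ≤? length cs
    ... | yes p = p
    ... | no ¬p = ⊥-elim (contra (arr c))
      where
      few : length cs ≤ Vec.sum (Vec.map (λ x → x ∸ 1) a)
      few = s≤s⁻¹ (subst (length cs <_) (+-comm _ 1) (≰⇒> ¬p))
      j : V → ℕ
      j x = toℕ (classOf cs (cov x))
      chosen : ∀ x → ∃ λ i → owner a (j x) ≡ inj₁ i
      chosen x with owner a (j x) in eq
      ... | inj₁ i = i , refl
      ... | inj₂ l = ⊥-elim (<⇒≱ (Finₚ.toℕ<n (classOf cs (cov x))) (≤-trans few (owner-total a (j x) l eq)))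
      c : V → Fin r
      c x = proj₁ (chosen x)
      contra : (∃ λ i → CliqueIn G (Vec.lookup a i) (λ v → c v ≡ i)) → ⊥
      contra (i , f , inj , adjacent , col) with Finₚ.pigeonhole {m = Vec.lookup a i ∸ 1} {n = Vec.lookup a i} (∸-monoʳ-< {Vec.lookup a i} {1} {0} (s≤s z≤n) (≤-trans (s≤s z≤n) (a≥2 i))) h
        where
        range : ∀ v → c v ≡ i → base a i ≤ j v × j v < base a i + (Vec.lookup a i ∸ 1)
        range v refl = owner-range a (j v) (c v) (proj₂ (chosen v))
        h : Fin (Vec.lookup a i) → Fin (Vec.lookup a i ∸ 1)
        h s = fromℕ< {j (f s) ∸ base a i} (+-cancelˡ-< (base a i) _ _ (subst (_< base a i + (Vec.lookup a i ∸ 1)) (sym (m+[n∸m]≡n (proj₁ (range (f s) (col s))))) (proj₂ (range (f s) (col s)))))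
      ... | s , t , s<t , e = true≢false (adjacent s t s≢t) (Indep-∈ (Indep-lookup ind (classOf cs (cov (f s)))) (classOf-∈ cs (cov (f s)))
          (subst (λ k → f t ∈ lookup cs k) (sym same) (classOf-∈ cs (cov (f t)))))
        where
        s≢t : s ≢ t
        s≢t refl = <-irrefl refl s<t
        low : ∀ v → c v ≡ i → base a i ≤ j v
        low v refl = proj₁ (owner-range a (j v) (c v) (proj₂ (chosen v)))
        same : classOf cs (cov (f s)) ≡ classOf cs (cov (f t))
        same = Finₚ.toℕ-injective (trans (sym (m+[n∸m]≡n (low (f s) (col s)))) (trans (cong (base a i +_) (trans (sym (Finₚ.toℕ-fromℕ< _)) (trans (cong toℕ e) (Finₚ.toℕ-fromℕ< _)))) (m+[n∸m]≡n (low (f t) (col t)))))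

  -- Independent sets and Ramsey bounds for subgraphs

  module _ {N : ℕ} (G : Graph N) where
    open OnGraph G
    open Matchings G

    MaxIndep : List V → Set
    MaxIndep L = ∃ λ I → Distinct I × Indep I × I ⊆ L × α≤ (length I) L

    -- Ramsey bounds only refute `α≤`; a maximum independent set, found by branching on one vertex,
    -- turns the refutation into an actual set.
    maxIndep : ∀ m L → length L ≤ m → Distinct L → MaxIndep L
    maxIndep m [] l d = [] , [] , [] , id , λ { [] _ _ _ → z≤n ; (_ ∷ _) _ _ s → ⊥-elim (empty (s (here refl))) }
      where
      empty : ∀ {x : V} → x ∈ [] → ⊥
      empty ()
    maxIndep (suc m) (x ∷ L) l (nx ∷ d) with maxIndep m L (s≤s⁻¹ l) d
       | maxIndep m (far L x) (≤-trans (≤-trans (length-⊆ (Distinct-far x d) (λ q → proj₁ (∈-far⁻ L x q))) ≤-refl) (s≤s⁻¹ l)) (Distinct-far x d)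
    ... | I , dI , iI , I⊆ , maxI | J , dJ , iJ , J⊆ , maxJ = choose (length I ≤? suc (length J))
      where
      open import Data.List.Membership.DecPropositional (Finₚ._≟_ {N}) using (_∈?_)
      covers : ∀ {b} → length I ≤ b → suc (length J) ≤ b → α≤ b (x ∷ L)
      covers lI lJ K dK iK K⊆ with x ∈? K
      ... | no x∉ = ≤-trans (maxI K dK iK (λ {v} q → tail (K⊆ q) (λ { refl → x∉ q }))) lI
        where
        tail : ∀ {v} → v ∈ x ∷ L → v ≢ x → v ∈ L
        tail (here e)  n = ⊥-elim (n e)
        tail (there q) n = q
      ... | yes x∈ with remove-↭ dK x∈
      ... | π with Distinct-↭ π dK | Indep-↭ π iK
      ... | dx ∷ dK′ | ix ∷ iK′ = ≤-trans (≤-reflexive (↭-length π)) (≤-trans (s≤s (maxJ (remove x K) dK′ iK′ sub)) lJ)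
        where
        tail : ∀ {v} → v ∈ x ∷ L → v ≢ x → v ∈ L
        tail (here e)  n = ⊥-elim (n e)
        tail (there q) n = q
        sub : remove x K ⊆ far L x
        sub q with ∈-remove⁻ K q
        ... | v∈ , v≢ = ∈-filter⁺ (λ y → ¬? (y Finₚ.≟ x)) (∈-filter⁺ (λ y → ¬? (x ~ y Bool.≟ true)) (tail (K⊆ v∈) v≢)
                          (λ e → true≢false e (All.lookup ix q))) v≢
      choose : Dec (length I ≤ suc (length J)) → MaxIndep (x ∷ L)
      choose (yes le) = x ∷ J , (All.tabulate (λ q e → proj₂ (proj₂ (∈-far⁻ L x (J⊆ q))) (sym e)) ∷ dJ) ,
        (All.tabulate (λ q → proj₁ (proj₂ (∈-far⁻ L x (J⊆ q)))) ∷ iJ) ,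
        (λ { (here e) → here e ; (there q) → there (proj₁ (∈-far⁻ L x (J⊆ q))) }) , covers le ≤-refl
      choose (no ¬le) = I , dI , iI , there ∘ I⊆ , covers ≤-refl (<⇒≤ (≰⇒> ¬le))

  -- R(3, k + 1) ≤ N.
  RamseyBound : ℕ → ℕ → Set
  RamseyBound k N = ∀ {m} (H : Graph m) → TriangleFree H → ∀ L →
    OnGraph.Distinct H L → length L ≡ N → OnGraph.α≤ H k L → ⊥

  RamseyBound-≤ : ∀ {k N} → RamseyBound k N → ∀ {m} (H : Graph m) → TriangleFree H → ∀ L →
    OnGraph.Distinct H L → N ≤ length L → OnGraph.α≤ H k L → ⊥
  RamseyBound-≤ {k} {N} R H tf L d l α = R H tf (take N L) (AllPairsₚ.take⁺ N d) (trans (length-take N L) (m≤n⇒m⊓n≡m l))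
    (OnGraph.α≤-mono H (take-⊆ N L) α)
    where
    take-⊆ : ∀ {A : Set} n (xs : List A) → take n xs ⊆ xs
    take-⊆ (suc n) (x ∷ xs) (here e)  = here e
    take-⊆ (suc n) (x ∷ xs) (there m) = there (take-⊆ n xs m)

  lookup-injective : ∀ {A : Set} {xs : List A} → AllPairs _≢_ xs → ∀ i j → lookup xs i ≡ lookup xs j → i ≡ j
  lookup-injective (a ∷ d) Fin.zero    Fin.zero    e = refl
  lookup-injective (a ∷ d) Fin.zero    (Fin.suc j) e = ⊥-elim (All.lookup a (∈-lookup j) e)
  lookup-injective (a ∷ d) (Fin.suc i) Fin.zero    e = ⊥-elim (All.lookup a (∈-lookup i) (sym e))
  lookup-injective (a ∷ d) (Fin.suc i) (Fin.suc j) e = cong Fin.suc (lookup-injective d i j e)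

  module _ {n m : ℕ} (G : Graph n) (φ : Fin m → Fin n) where

    -- The complement of the graph that G induces along φ, with loops removed.
    cograph : Graph m
    cograph = record
      { adj    = λ i j → not (does (i Finₚ.≟ j)) ∧ not (adj G (φ i) (φ j))
      ; sym    = λ i j → cong₂ _∧_ (cong not (does-sym i j)) (cong not (Graph.sym G (φ i) (φ j)))
      ; irrefl = λ i → cong (λ b → not b ∧ not (adj G (φ i) (φ i))) (does-refl i)
      }
      where
      does-refl : ∀ i → does (i Finₚ.≟ i) ≡ true
      does-refl i with i Finₚ.≟ i
      ... | yes _ = refl
      ... | no n  = ⊥-elim (n refl)
      does-sym : ∀ i j → does (i Finₚ.≟ j) ≡ does (j Finₚ.≟ i)
      does-sym i j with i Finₚ.≟ j | j Finₚ.≟ i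
      ... | yes _ | yes _ = refl
      ... | no _  | no _  = refl
      ... | yes e | no n  = ⊥-elim (n (sym e))
      ... | no n  | yes e = ⊥-elim (n (sym e))

    cograph-true : ∀ i j → adj cograph i j ≡ true → i ≢ j × adj G (φ i) (φ j) ≡ false
    cograph-true i j e with i Finₚ.≟ j | adj G (φ i) (φ j)
    ... | no ne | false = ne , refl

    cograph-false : ∀ i j → i ≢ j → adj cograph i j ≡ false → adj G (φ i) (φ j) ≡ true
    cograph-false i j ne e with i Finₚ.≟ j | adj G (φ i) (φ j)
    ... | yes p | _     = ⊥-elim (ne p)
    ... | no _  | true  = refl

  -- The hypothesis is applied to the complement of H on L: a 10-clique there is an independent set
  -- of H, and an independent triple there is a triangle of H.
  RamseyLe⇒RamseyBound : RamseyLe 10 3 41 → RamseyBound 9 41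
  RamseyLe⇒RamseyBound R {m} H tf L d l α with R (length L) (≤-reflexive (sym l)) (cograph H (lookup L))
  ... | inj₁ (f , inj , clique , _) = 1+n≰n (α I dI iI (λ q → I⊆ q))
    where
    I = tabulate {n = 10} (λ s → lookup L (f s))
    dI : AllPairs _≢_ I
    dI = AllPairsₚ.tabulate⁺ (λ {s} {t} ne e → ne (inj (lookup-injective d _ _ e)))
    iI : AllPairs (λ x y → adj H x y ≡ false) I
    iI = AllPairsₚ.tabulate⁺ (λ {s} {t} ne → proj₂ (cograph-true H (lookup L) (f s) (f t) (clique s t ne)))
    I⊆ : I ⊆ L
    I⊆ q with ∈-tabulate⁻ {f = λ s → lookup L (f s)} q
    ... | s , refl = ∈-lookup (f s)
  ... | inj₂ (f , inj , indep) = true≢false (edge Fin.zero (Fin.suc (Fin.suc Fin.zero)) (λ ()))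
      (tf _ _ _ (edge Fin.zero (Fin.suc Fin.zero) (λ ())) (edge (Fin.suc Fin.zero) (Fin.suc (Fin.suc Fin.zero)) (λ ())))
    where
    edge : ∀ s t → s ≢ t → adj H (lookup L (f s)) (lookup L (f t)) ≡ true
    edge s t ne = cograph-false H (lookup L) (f s) (f t) (λ e → ne (inj e)) (indep s t ne)

  -- The function g and its superadditivity

  gain : List ℕ → ℕ → ℕ
  gain tab t = if-small (t <ᵇ 21)
    where
    if-small : Bool → ℕ
    if-small true  = nth tab t
    if-small false = t ∸ 9

  gain-small : ∀ tab t → t < 21 → gain tab t ≡ nth tab t
  gain-small tab t lt with t <ᵇ 21 | <⇒<ᵇ lt
  ... | true | _ = refl

  gain-large : ∀ tab t → 21 ≤ t → gain tab t ≡ t ∸ 9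
  gain-large tab t le with t <ᵇ 21 in e
  ... | false = refl
  ... | true  = ⊥-elim (<⇒≱ (<ᵇ⇒< t 21 (subst T (sym e) _)) le)

  superAt : List ℕ → ℕ → ℕ → Bool
  superAt tab a b = nth tab a + nth tab b ≤ᵇ gain tab (a + b)

  superRow : List ℕ → ℕ → Bool
  superRow tab a = all (superAt tab a) (upTo 21)

  belowAt : List ℕ → ℕ → Bool
  belowAt tab b = nth tab b ≤ᵇ b

  module Gain (tab : List ℕ) (small-sup : all (superRow tab) (upTo 21) ≡ true) (small-le : all (belowAt tab) (upTo 21) ≡ true) where

    gain-≤ : ∀ t → gain tab t ≤ t
    gain-≤ t with t <? 21
    ... | yes lt = subst (_≤ t) (sym (gain-small tab t lt)) (≤ᵇ-sound (all-∈ (belowAt tab) (upTo 21) small-le (∈-upTo⁺ lt)))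
    ... | no ≮   = subst (_≤ t) (sym (gain-large tab t (≮⇒≥ ≮))) (m∸n≤m t 9)

    -- From 21 on the gain has slope 1, so an increase of the argument by b pays for `gain tab b` ≤
    -- b. Only pairs below 21 remain for the finite check.
    large : ∀ a b → 21 ≤ a → gain tab a + gain tab b ≤ gain tab (a + b)
    large a b le = begin
      gain tab a + gain tab b ≤⟨ +-mono-≤ (≤-reflexive (gain-large tab a le)) (gain-≤ b) ⟩
      (a ∸ 9) + b ≡⟨ +-∸-comm b (≤-trans (m≤m+n 9 12) le) ⟨
      a + b ∸ 9 ≡⟨ gain-large tab (a + b) (≤-trans le (m≤m+n a b)) ⟨
      gain tab (a + b) ∎
      where open ≤-Reasoning

    gain-super : ∀ a b → gain tab a + gain tab b ≤ gain tab (a + b)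
    gain-super a b with a <? 21 | b <? 21
    ... | no ≮   | _      = large a b (≮⇒≥ ≮)
    ... | yes lt | no ≮   = subst₂ _≤_ (+-comm (gain tab b) (gain tab a)) (cong (gain tab) (+-comm b a)) (large b a (≮⇒≥ ≮))
    ... | yes lt | yes lt′ = subst (_≤ gain tab (a + b)) (sym (cong₂ _+_ (gain-small tab a lt) (gain-small tab b lt′)))
      (≤ᵇ-sound (all-∈ (superAt tab a) (upTo 21) (all-∈ (superRow tab) (upTo 21) small-sup (∈-upTo⁺ lt)) (∈-upTo⁺ lt′)))

    module _ (bound : ∀ ν → ν < 21 → ∃ λ N → N ≤ suc (ν + ν) × RamseyBound (ν ∸ nth tab ν) N) (bound43 : RamseyBound 9 43) where

      -- The case distinction is at 21 because 2 * 21 + 1 = 43; from there on R(3,10) ≤ 43 serves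
      -- for all ν.
      bounds : ∀ ν → ∃ λ k → ∃ λ N → ν ≤ k + gain tab ν × N ≤ suc (ν + ν) × RamseyBound k N
      bounds ν with ν <? 21
      ... | yes lt with bound ν lt
      ... | N , le , R = ν ∸ nth tab ν , N , subst (λ z → ν ≤ ν ∸ nth tab ν + z) (sym (gain-small tab ν lt))
        (≤-trans (m≤n+m∸n ν (nth tab ν)) (≤-reflexive (+-comm (nth tab ν) _))) , le , R
      bounds ν | no ≮ = 9 , 43 , subst (λ z → ν ≤ 9 + z) (sym (gain-large tab ν (≮⇒≥ ≮))) (m≤n+m∸n ν 9) ,
        s≤s (+-mono-≤ (≮⇒≥ ≮) (≮⇒≥ ≮)) , bound43

      module _ {n : ℕ} (G : Graph n) where
        open OnGraph G
        open Matchings G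
        open Decomposition G
        open Colourings G

        -- Without independent triples in C, the complement H is triangle-free, and an independent
        -- set of H is a clique of G.
        oddRamsey : OddRamsey (gain tab)
        oddRamsey ν C dC lC nt with bounds ν
        ... | k , N , ν≤ , N≤ , R with maxIndep H (length V′) V′ ≤-refl (allFin⁺ (length C))
          where
          H = cograph G (lookup C)
          V′ = allFin (length C)
        ... | I , dI , iI , _ , α = map (lookup C) I , clique , (λ q → sub q) , bigEnough
          where
          H = cograph G (lookup C)
          tf : TriangleFree H
          tf x y z xy yz with adj H x z in e
          ... | false = refl
          ... | true with cograph-true G (lookup C) x y xy | cograph-true G (lookup C) y z yz | cograph-true G (lookup C) x z e
          ... | x≢y , nxy | y≢z , nyz | x≢z , nxz = ⊥-elim (nt _ _ _ (∈-lookup x) (∈-lookup y) (∈-lookup z)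
            (((x≢y ∘ lookup-injective dC x y) ∷ (x≢z ∘ lookup-injective dC x z) ∷ []) ∷ ((y≢z ∘ lookup-injective dC y z) ∷ []) ∷ [] ∷ [])
            ((nxy ∷ nxz ∷ []) ∷ (nyz ∷ []) ∷ [] ∷ []))
          clique : Clique (map (lookup C) I)
          clique = AllPairsₚ.map⁺ (AllPairs.zipWith (λ { {i} {j} (ne , e) → cograph-false G (lookup C) i j ne e }) (dI , iI))
          sub : map (lookup C) I ⊆ C
          sub q with ∈-map⁻ (lookup C) q
          ... | i , _ , refl = ∈-lookup i
          long : suc k ≤ length I
          long with suc k ≤? length I
          ... | yes p = p
          ... | no ¬p = ⊥-elim (RamseyBound-≤ {k} R H tf (allFin (length C)) (allFin⁺ (length C))
            (subst (N ≤_) (sym (trans (length-tabulate id) lC)) N≤)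
            (λ J dJ iJ s → ≤-trans (α J dJ iJ s) (s≤s⁻¹ (≰⇒> ¬p))))
          bigEnough : suc ν ≤ length (map (lookup C) I) + gain tab ν
          bigEnough = subst (λ z → suc ν ≤ z + gain tab ν) (sym (length-map (lookup C) I)) (≤-trans (s≤s ν≤) (+-monoˡ-≤ (gain tab ν) long))

        -- Here t is the number of colours saved. If m = q + κ, then q + κ is at most the number of
        -- classes, hence at most |Q| + g t, and |Q| is at most q - 1.
        large-order : 1 ≤ gain tab 2 → ∀ {r} (a : Vec ℕ r) → (∀ i → 2 ≤ Vec.lookup a i) → VertexArrows G a →
          ∀ {q} → CliqueNumberLt G q → ∃ λ t → mOf a + t ≤ n × (∀ κ → mOf a ≡ q + κ → suc κ ≤ gain tab t)
        large-order g2 a a≥2 arr {q} cl with colour (gain tab) gain-super g2 oddRamsey n (allFin n) (≤-reflexive (length-tabulate id)) (allFin⁺ n)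
        ... | coloured cs {Q} t ind cov cQ count bnd = t ,
          ≤-trans (+-monoˡ-≤ t m≤) (≤-reflexive (trans count (length-tabulate id))) ,
          λ κ e → +-cancelˡ-≤ (length Q) _ _ (begin
            length Q + suc κ ≡⟨ +-suc (length Q) κ ⟩
            suc (length Q) + κ ≤⟨ +-monoˡ-≤ κ (≰⇒> (λ q≤ → cl (clique⇒HasClique Q cQ q≤))) ⟩
            q + κ ≡⟨ e ⟨
            mOf a ≤⟨ m≤ ⟩
            length cs ≤⟨ bnd ⟩
            length Q + gain tab t ∎)
          where
          open ≤-Reasoning
          m≤ : mOf a ≤ length cs
          m≤ = arrows⇒chromatic a a≥2 arr cs ind (λ x → ∈-resp-↭ cov (∈-allFin x))

  -- The gains

  bound0 : RamseyBound 0 1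
  bound0 H tf L d l α = impossible H tf (Ramsey3.valid0 H tf 1) (≤ᵇ-sound refl) L d l α

  bound1 : RamseyBound 1 3
  bound1 H tf L d l α = impossible H tf (Ramsey3.valid1 H tf 3) (≤ᵇ-sound refl) L d l α

  bound2 : RamseyBound 2 7
  bound2 H tf L d l α = impossible H tf (Ramsey3.valid2 H tf 7) (≤ᵇ-sound refl) L d l α

  bound3 : RamseyBound 3 11
  bound3 H tf L d l α = impossible H tf (Ramsey3.valid3 H tf 11) (≤ᵇ-sound refl) L d l α

  bound4 : RamseyBound 4 15
  bound4 H tf L d l α = impossible H tf (Ramsey3.valid4 H tf 15) (≤ᵇ-sound refl) L d l α

  bound5 : RamseyBound 5 19
  bound5 H tf L d l α = impossible H tf (Ramsey3.valid5 H tf 19) (≤ᵇ-sound refl) L d l α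

  bound6 : RamseyBound 6 23
  bound6 H tf L d l α = impossible H tf (Ramsey3.valid6 H tf 23) (≤ᵇ-sound refl) L d l α

  bound7 : RamseyBound 7 29
  bound7 H tf L d l α = impossible H tf (Ramsey3.valid7 H tf 29) (≤ᵇ-sound refl) L d l α

  bound8 : RamseyBound 8 37
  bound8 H tf L d l α = impossible H tf (Ramsey3.valid8 H tf 37) (≤ᵇ-sound refl) L d l α

  bound9 : RamseyBound 9 43
  bound9 H tf L d l α = impossible H tf (Ramsey3.min43 H tf) (≤ᵇ-sound refl) L d l α

  -- The entry at k is 2ν + 1 for the first ν at which a table below asks for k; only the table
  -- `gains′` asks for k = 9. The value 9 for k = 3 would bring nothing: superadditivity forces the
  -- gain at 4 to be at least twice the gain 1 at 2.
  ramseyNumber : ℕ → ℕ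
  ramseyNumber k = nth (1 ∷ 3 ∷ 7 ∷ 11 ∷ 15 ∷ 19 ∷ 23 ∷ 29 ∷ 37 ∷ 41 ∷ []) k

  ramseyBound : ∀ k → k ≤ 8 → RamseyBound k (ramseyNumber k)
  ramseyBound 0 _ = bound0
  ramseyBound 1 _ = bound1
  ramseyBound 2 _ = bound2
  ramseyBound 3 _ = bound3
  ramseyBound 4 _ = bound4
  ramseyBound 5 _ = bound5
  ramseyBound 6 _ = bound6
  ramseyBound 7 _ = bound7
  ramseyBound 8 _ = bound8
  ramseyBound (suc (suc (suc (suc (suc (suc (suc (suc (suc k))))))))) (s≤s (s≤s (s≤s (s≤s (s≤s (s≤s (s≤s (s≤s ()))))))))

  ramseyBound′ : RamseyLe 10 3 41 → ∀ k → k ≤ 9 → RamseyBound k (ramseyNumber k)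
  ramseyBound′ R k k≤ with m≤n⇒m<n∨m≡n k≤
  ... | inj₁ lt = ramseyBound k (s≤s⁻¹ lt)
  ... | inj₂ refl = RamseyLe⇒RamseyBound R

  -- The entry at ν is the least D for which R(3, ν - D + 1) ≤ 2ν + 1 is known; gains′ uses R(3,10) ≤ 41.
  gains gains′ : List ℕ
  gains  = 0 ∷ 0 ∷ 1 ∷ 1 ∷ 2 ∷ 2 ∷ 3 ∷ 3 ∷ 4 ∷ 4 ∷ 5 ∷ 5 ∷ 6 ∷ 7 ∷ 7 ∷ 8 ∷ 9 ∷ 10 ∷ 10 ∷ 11 ∷ 12 ∷ []
  gains′ = 0 ∷ 0 ∷ 1 ∷ 1 ∷ 2 ∷ 2 ∷ 3 ∷ 3 ∷ 4 ∷ 4 ∷ 5 ∷ 5 ∷ 6 ∷ 7 ∷ 7 ∷ 8 ∷ 9 ∷ 10 ∷ 10 ∷ 11 ∷ 11 ∷ []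

  fits : List ℕ → ℕ → ℕ → Bool
  fits tab top ν = (ν ∸ nth tab ν ≤ᵇ top) ∧ (ramseyNumber (ν ∸ nth tab ν) ≤ᵇ suc (ν + ν))

  bounds-from : ∀ tab top → all (fits tab top) (upTo 21) ≡ true → (∀ k → k ≤ top → RamseyBound k (ramseyNumber k)) →
    ∀ ν → ν < 21 → ∃ λ N → N ≤ suc (ν + ν) × RamseyBound (ν ∸ nth tab ν) N
  bounds-from tab top ok R ν lt with ∧-true {ν ∸ nth tab ν ≤ᵇ top} (all-∈ (fits tab top) (upTo 21) ok (∈-upTo⁺ lt))
  ... | a , b = ramseyNumber (ν ∸ nth tab ν) , ≤ᵇ-sound b , R _ (≤ᵇ-sound a)

  gain-needs : List ℕ → ℕ → ℕ → Bool
  gain-needs tab κ t = gain tab t ≤ᵇ κ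

  needs : ∀ tab κ F → all (gain-needs tab κ) (upTo F) ≡ true → ∀ t → suc κ ≤ gain tab t → F ≤ t
  needs tab κ F ok t h with F ≤? t
  ... | yes p = p
  ... | no ¬p = ⊥-elim (<⇒≱ h (≤ᵇ-sound (all-∈ (gain-needs tab κ) (upTo F) ok (∈-upTo⁺ (≰⇒> ¬p)))))

  -- All gains below 21 are at most 12, so t lies where the gain is t - 9.
  needs-large : ∀ κ → 12 ≤ κ → ∀ t → suc κ ≤ gain gains t → κ + 10 ≤ t
  needs-large κ κ≥ t h = subst (_≤ t) (sym (+-suc κ 9)) (≤-trans (+-monoˡ-≤ 9 (subst (suc κ ≤_) (gain-large gains t t≥21) h))
    (≤-reflexive (m∸n+n≡m (≤-trans (m≤m+n 9 12) t≥21))))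
    where
    t≥21 : 21 ≤ t
    t≥21 = needs gains 12 21 refl t (≤-trans (s≤s κ≥) h)

  Order : List ℕ → ℕ → ℕ → ℕ → Set
  Order tab m q n = ∃ λ t → m + t ≤ n × (∀ κ → m ≡ q + κ → suc κ ≤ gain tab t)

  order-≤ : ∀ tab m q n → Order tab m q n → m ≤ n
  order-≤ tab m q n (t , le , g) = ≤-trans (m≤m+n m t) le

  order-finite : ∀ tab m q n κ F → all (gain-needs tab κ) (upTo F) ≡ true → Order tab m q n → m ≡ q + κ → m + F ≤ n
  order-finite tab m q n κ F ok (t , le , g) e = ≤-trans (+-monoʳ-≤ m (needs tab κ F ok t (g κ e))) le

  order-large : ∀ m q n κ → 12 ≤ κ → Order gains m q n → m ≡ q + κ → m + (κ + 10) ≤ n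
  order-large m q n κ κ≥ (t , le , g) e = ≤-trans (+-monoʳ-≤ m (needs-large κ κ≥ t (g κ e))) le

  order : ∀ {r n q} (a : Vec ℕ r) → (∀ i → 2 ≤ Vec.lookup a i) → (G : Graph n) → VertexArrows G a → CliqueNumberLt G q →
    Order gains (mOf a) q n
  order a a≥2 G arr cl = Gain.large-order gains refl refl (bounds-from gains 8 refl ramseyBound) bound9 G (s≤s z≤n) a a≥2 arr cl

  order′ : ∀ {r n q} → RamseyLe 10 3 41 → (a : Vec ℕ r) → (∀ i → 2 ≤ Vec.lookup a i) → (G : Graph n) → VertexArrows G a →
    CliqueNumberLt G q → Order gains′ (mOf a) q n
  order′ R a a≥2 G arr cl =
    Gain.large-order gains′ refl refl (bounds-from gains′ 9 refl (ramseyBound′ R)) bound9 G (s≤s z≤n) a a≥2 arr cl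

-- The bounds over the integers

open import Defs
open import Data.Nat using (ℕ; _<_; _≤_) renaming (_+_ to _+ℕ_)
open import Data.Integer using (ℤ; +_; -[1+_]; _+_; _-_; _*_) renaming (_≤_ to _≤ℤ_)
open import Data.Vec using (Vec; lookup)
open import Data.Fin using (Fin)
open import Data.Product using (_×_)
open import Relation.Binary.PropositionalEquality using (_≡_)

import Data.Integer as ℤ
import Data.Integer.Properties as ℤₚ
open import Data.List.Base using (List; upTo)
open import Data.Bool.ListAction using (all)
open import Data.Bool.Base using (true)
open import Data.Nat.Base as ℕ using (suc; s≤s; z≤n)
import Data.Nat.Properties as ℕₚ
open import Data.Product using (proj₁; proj₂; _,_)
import Relation.Binary.PropositionalEquality as ≡
open Development using (gains; gains′; Order; order; order′; order-≤; order-finite; order-large; gain-needs)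

theorem7p1 : (r : ℕ) (a : Vec ℕ r) → (∀ (i : Fin r) → 2 ≤ lookup a i) →
    (k : ℤ) (q : ℕ) → + q ≡ + mOf a - k → maxOf a < q →
    (n : ℕ) (G : Graph n) → VertexArrows G a → CliqueNumberLt G q →
    ((-[1+ 0 ] ≤ℤ k) → (k ≤ℤ + 5) → (+ mOf a + + 2 * k + + 2 ≤ℤ + n))
    × (k ≡ + 6 → mOf a +ℕ 13 ≤ n)
    × (k ≡ + 7 → mOf a +ℕ 15 ≤ n)
    × (k ≡ + 8 → mOf a +ℕ 16 ≤ n)
    × (k ≡ + 9 → mOf a +ℕ 17 ≤ n)
    × (k ≡ + 10 → mOf a +ℕ 19 ≤ n)
    × (k ≡ + 11 → mOf a +ℕ 20 ≤ n)
    × (k ≡ + 11 → RamseyLe 10 3 41 → mOf a +ℕ 21 ≤ n)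
    × (+ 12 ≤ℤ k → + mOf a + k + + 10 ≤ℤ + n)
theorem7p1 r a a≥2 k q q≡ _ n G arr cl =
  small k q≡ ,
  (λ { ≡.refl → finite 6 13 ≡.refl q≡ }) ,
  (λ { ≡.refl → finite 7 15 ≡.refl q≡ }) ,
  (λ { ≡.refl → finite 8 16 ≡.refl q≡ }) ,
  (λ { ≡.refl → finite 9 17 ≡.refl q≡ }) ,
  (λ { ≡.refl → finite 10 19 ≡.refl q≡ }) ,
  (λ { ≡.refl → finite 11 20 ≡.refl q≡ }) ,
  (λ { ≡.refl R → conditional R q≡ }) ,
  unbounded k q≡
  where
  m = mOf a

  ord : Order gains m q n
  ord = order a a≥2 G arr cl

  m≡ : ∀ κ → + q ≡ + m - + κ → m ≡ q +ℕ κ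
  m≡ κ e = ℤₚ.+-injective (≡.sym (≡.trans (≡.cong (λ z → z + + κ) e) (≡.trans (ℤₚ.+-assoc (+ m) (ℤ.- (+ κ)) (+ κ))
    (≡.trans (≡.cong (λ z → + m + z) (ℤₚ.+-inverseˡ (+ κ))) (ℤₚ.+-identityʳ (+ m))))))

  finite : ∀ κ F → all (gain-needs gains κ) (upTo F) ≡ true → + q ≡ + m - + κ → m +ℕ F ≤ n
  finite κ F ok e = order-finite gains m q n κ F ok ord (m≡ κ e)

  conditional : RamseyLe 10 3 41 → + q ≡ + m - + 11 → m +ℕ 21 ≤ n
  conditional R e = order-finite gains′ m q n 11 21 ≡.refl (order′ R a a≥2 G arr cl) (m≡ 11 e)

  twice : ∀ κ → m +ℕ (2 ℕ.* κ +ℕ 2) ≤ n → + m + + 2 * + κ + + 2 ≤ℤ + n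
  twice κ h = ≡.subst (λ z → + m + z + + 2 ≤ℤ + n) (ℤₚ.pos-* 2 κ)
    (ℤ.+≤+ (≡.subst (_≤ n) (≡.sym (ℕₚ.+-assoc m (2 ℕ.* κ) 2)) h))

  small : ∀ k → + q ≡ + m - k → -[1+ 0 ] ≤ℤ k → k ≤ℤ + 5 → + m + + 2 * k + + 2 ≤ℤ + n
  -- Up to k = 5 the first entry of `gains` above k stands at position 2k + 2.
  small (+ 0) e _ _ = twice 0 (finite 0 2 ≡.refl e)
  small (+ 1) e _ _ = twice 1 (finite 1 4 ≡.refl e)
  small (+ 2) e _ _ = twice 2 (finite 2 6 ≡.refl e)
  small (+ 3) e _ _ = twice 3 (finite 3 8 ≡.refl e)
  small (+ 4) e _ _ = twice 4 (finite 4 10 ≡.refl e)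
  small (+ 5) e _ _ = twice 5 (finite 5 12 ≡.refl e)
  small (+ (suc (suc (suc (suc (suc (suc k))))))) e _ (ℤ.+≤+ (s≤s (s≤s (s≤s (s≤s (s≤s ()))))))
  -- For k = -1 the bound is m itself, since m classes require m vertices.
  small -[1+ 0 ] e _ _ = ≡.subst (_≤ℤ + n) (≡.sym (≡.trans (ℤₚ.+-assoc (+ m) -[1+ 1 ] (+ 2)) (ℤₚ.+-identityʳ (+ m))))
    (ℤ.+≤+ (order-≤ gains m q n ord))
  small -[1+ suc k ] e (ℤ.-≤- ()) _

  unbounded : ∀ k → + q ≡ + m - k → + 12 ≤ℤ k → + m + k + + 10 ≤ℤ + n
  unbounded (+ κ) e (ℤ.+≤+ κ≥12) = ℤ.+≤+ (≡.subst (_≤ n) (≡.sym (ℕₚ.+-assoc m κ 10))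
    (order-large m q n κ κ≥12 ord (m≡ κ e)))
  unbounded -[1+ k ] e ()
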